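{- Let $n\equiv 1\pmod 4$ be a positive integer. Then \[ \sum_{k=0}^{(n-1)/4}[8k+1]\frac{(q;q^4)_k^4}{(q^4;q^4)_k^4}q^{2k}\equiv \frac{(q^2;q^4)_{(n-1)/4}}{(q^4;q^4)_{(n-1)/4}}[n]\,q^{(1-n)/4}\pmod{[n]\Phi_n(q)^2}, \] and \[ \sum_{k=0}^{n-1}[8k+1]\frac{(q;q^4)_k^4}{(q^4;q^4)_k^4}q^{2k}\equiv \frac{(q^2;q^4)_{(n-1)/4}}{(q^4;q^4)_{(n-1)/4}}[n]\,q^{(1-n)/4}\pmod{[n]\Phi_n(q)^2}. \]
   Context: For an indeterminate $q$, $(a;q)_k=(1-a)(1-aq)\cdots(1-aq^{k-1})$ (with $(a;q)_0=1$) is the $q$-shifted factorial. For an integer $m$, $[m]=[m]_q=(1-q^m)/(1-q)$ is the $q$-integer. $\Phi_n(q)$ denotes the $n$-th cyclotomic polynomial in $q$. A congruence $A\equiv B\pmod{P(q)}$ between rational functions in $q$ means that $A-B$, written as a quotient of polynomials with denominator coprime to $P(q)$, has numerator divisible by $P(q)$. -}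

module Defs where

open import Algebra.Bundles.Raw using (RawRing)
import Algebra.Definitions.RawSemiring as RawSemiringDefs
open import Data.Bool.Base using (if_then_else_)
open import Data.Empty using (⊥-elim)
open import Data.Fin.Base using (toℕ)
open import Data.Fin.Properties using (toℕ<n)
open import Data.Integer.Base as ℤ using (ℤ; 0ℤ; 1ℤ; -1ℤ; +_; -[1+_])
import Data.Integer.Properties as ℤ
open import Data.List.Base using (List; []; _∷_; map)
open import Data.Nat.Base as ℕ using (ℕ; zero; suc; _≤_; _<_; z≤n; s≤s)
open import Data.Nat.Divisibility using () renaming (_∣?_ to _∣ℕ?_)
open import Data.Nat.Induction using (<-rec)
import Data.Nat.Properties as ℕ
open import Data.Product.Base using (Σ-syntax; ∃-syntax; _×_; _,_; proj₁)
open import Data.Sum.Base using (_⊎_; inj₁; inj₂; [_,_]′)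
open import Level using (0ℓ)
open import Relation.Binary.PropositionalEquality
  using (_≡_; refl; sym; trans; cong; cong₂; module ≡-Reasoning)
open import Relation.Nullary using (¬_; Dec; yes; no; does)

-- Coefficient lists, constant term first.  Trailing zeros are allowed, so
-- equality of polynomials is _≈ₚ_ rather than _≡_.
ℤ[q] : Set
ℤ[q] = List ℤ

coeff : ℤ[q] → ℕ → ℤ
coeff []      _       = 0ℤ
coeff (a ∷ f) zero    = a
coeff (a ∷ f) (suc i) = coeff f i

infix  4 _≈ₚ_ _≉ₚ_
infixl 6 _+ₚ_
infixl 7 _*ₚ_ _·ₚ_

_≈ₚ_ _≉ₚ_ : ℤ[q] → ℤ[q] → Set
f ≈ₚ g = ∀ i → coeff f i ≡ coeff g i
f ≉ₚ g = ¬ (f ≈ₚ g)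

_+ₚ_ : ℤ[q] → ℤ[q] → ℤ[q]
[]      +ₚ g       = g
(a ∷ f) +ₚ []      = a ∷ f
(a ∷ f) +ₚ (b ∷ g) = (a ℤ.+ b) ∷ (f +ₚ g)

_·ₚ_ : ℤ → ℤ[q] → ℤ[q]
c ·ₚ f = map (c ℤ.*_) f

_*ₚ_ : ℤ[q] → ℤ[q] → ℤ[q]
[]      *ₚ g = []
(a ∷ f) *ₚ g = (a ·ₚ g) +ₚ (0ℤ ∷ (f *ₚ g))

0ₚ 1ₚ qₚ : ℤ[q]
0ₚ = []
1ₚ = 1ℤ ∷ []
qₚ = 0ℤ ∷ 1ℤ ∷ []

ℤ[q]-rawRing : RawRing 0ℓ 0ℓ
ℤ[q]-rawRing = record
  { Carrier = ℤ[q]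
  ; _≈_     = _≈ₚ_
  ; _+_     = _+ₚ_
  ; _*_     = _*ₚ_
  ; -_      = -1ℤ ·ₚ_
  ; 0#      = 0ₚ
  ; 1#      = 1ₚ
  }

open RawRing ℤ[q]-rawRing public
  using () renaming (-_ to -ₚ_; rawSemiring to ℤ[q]-rawSemiring)
open RawSemiringDefs ℤ[q]-rawSemiring public
  using () renaming (_^_ to _^ₚ_; product to productₚ; _∣_ to _∣ₚ_; Coprime to Coprimeₚ)

zero? : ∀ f → Dec (f ≈ₚ 0ₚ)
zero? []      = yes λ _ → refl
zero? (a ∷ f) with a ℤ.≟ 0ℤ | zero? f
... | yes a≡0 | yes f≈0 = yes λ { zero → a≡0 ; (suc i) → f≈0 i }
... | no  a≢0 | _       = no λ eq → a≢0 (eq zero)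
... | yes _   | no  f≉0 = no λ eq → f≉0 λ i → eq (suc i)

coeff-+ : ∀ f g i → coeff (f +ₚ g) i ≡ coeff f i ℤ.+ coeff g i
coeff-+ []      g       i       = sym (ℤ.+-identityˡ _)
coeff-+ (a ∷ f) []      i       = sym (ℤ.+-identityʳ _)
coeff-+ (a ∷ f) (b ∷ g) zero    = refl
coeff-+ (a ∷ f) (b ∷ g) (suc i) = coeff-+ f g i

coeff-· : ∀ c f i → coeff (c ·ₚ f) i ≡ c ℤ.* coeff f i
coeff-· c []      i       = sym (ℤ.*-zeroʳ c)
coeff-· c (a ∷ f) zero    = refl
coeff-· c (a ∷ f) (suc i) = coeff-· c f i

coeff-∷* : ∀ a f g i →
  coeff ((a ∷ f) *ₚ g) i ≡ a ℤ.* coeff g i ℤ.+ coeff (0ℤ ∷ (f *ₚ g)) i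
coeff-∷* a f g i =
  trans (coeff-+ (a ·ₚ g) _ i) (cong (ℤ._+ coeff (0ℤ ∷ (f *ₚ g)) i) (coeff-· a g i))

coeff-*-vanish : ∀ f g m → (∀ j → j ≤ m → coeff g j ≡ 0ℤ) → coeff (f *ₚ g) m ≡ 0ℤ
coeff-*-vanish []      g m g≡0 = refl
coeff-*-vanish (a ∷ f) g m g≡0 = begin
  coeff ((a ∷ f) *ₚ g) m                            ≡⟨ coeff-∷* a f g m ⟩
  a ℤ.* coeff g m ℤ.+ coeff (0ℤ ∷ (f *ₚ g)) m       ≡⟨ cong₂ ℤ._+_ (cong (a ℤ.*_) (g≡0 m ℕ.≤-refl)) (shift m g≡0) ⟩
  a ℤ.* 0ℤ ℤ.+ 0ℤ                                   ≡⟨ cong (ℤ._+ 0ℤ) (ℤ.*-zeroʳ a) ⟩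
  0ℤ                                                ∎
  where
  open ≡-Reasoning
  shift : ∀ m → (∀ j → j ≤ m → coeff g j ≡ 0ℤ) → coeff (0ℤ ∷ (f *ₚ g)) m ≡ 0ℤ
  shift zero    _   = refl
  shift (suc m) g≡0 = coeff-*-vanish f g m λ j j≤m → g≡0 j (ℕ.m≤n⇒m≤1+n j≤m)

*-zero-product : ∀ f g → f *ₚ g ≈ₚ 0ₚ → f ≈ₚ 0ₚ ⊎ g ≈ₚ 0ₚ
*-zero-product []      g fg≈0 = inj₁ λ _ → refl
*-zero-product (a ∷ f) g fg≈0 with a ℤ.≟ 0ℤ
... | yes refl = [ (λ f≈0 → inj₁ λ { zero → refl ; (suc i) → f≈0 i }) , inj₂ ]′
                   (*-zero-product f g λ i → trans (sym (tail i)) (fg≈0 (suc i)))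
  where
  tail : ∀ i → coeff ((0ℤ ∷ f) *ₚ g) (suc i) ≡ coeff (f *ₚ g) i
  tail i = trans (coeff-∷* 0ℤ f g (suc i)) (ℤ.+-identityˡ _)
... | no a≢0 = inj₂ λ i → <-rec (λ i → coeff g i ≡ 0ℤ) step i
  where
  open ≡-Reasoning
  lower : ∀ i → (∀ {j} → j < i → coeff g j ≡ 0ℤ) → coeff (0ℤ ∷ (f *ₚ g)) i ≡ 0ℤ
  lower zero    _  = refl
  lower (suc i) ih = coeff-*-vanish f g i λ j j≤i → ih (s≤s j≤i)

  step : ∀ i → (∀ {j} → j < i → coeff g j ≡ 0ℤ) → coeff g i ≡ 0ℤ
  step i ih = [ (λ a≡0 → ⊥-elim (a≢0 a≡0)) , (λ gᵢ≡0 → gᵢ≡0) ]′ (ℤ.i*j≡0⇒i≡0∨j≡0 a agᵢ≡0)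
    where
    agᵢ≡0 : a ℤ.* coeff g i ≡ 0ℤ
    agᵢ≡0 = begin
      a ℤ.* coeff g i                              ≡⟨ ℤ.+-identityʳ _ ⟨
      a ℤ.* coeff g i ℤ.+ 0ℤ                       ≡⟨ cong (λ z → a ℤ.* coeff g i ℤ.+ z) (lower i ih) ⟨
      a ℤ.* coeff g i ℤ.+ coeff (0ℤ ∷ (f *ₚ g)) i  ≡⟨ coeff-∷* a f g i ⟨
      coeff ((a ∷ f) *ₚ g) i                       ≡⟨ fg≈0 i ⟩
      0ℤ                                           ∎

*-nonzero : ∀ f g → f ≉ₚ 0ₚ → g ≉ₚ 0ₚ → f *ₚ g ≉ₚ 0ₚ
*-nonzero f g f≉0 g≉0 fg≈0 = [ f≉0 , g≉0 ]′ (*-zero-product f g fg≈0)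

1-nonzero : 1ₚ ≉ₚ 0ₚ
1-nonzero eq with eq zero
... | ()

degree : ℤ[q] → ℕ
degree []      = 0
degree (a ∷ f) with zero? f
... | yes _ = 0
... | no  _ = suc (degree f)

-- Long division by g, which must be monic: if f = Q g + R then
-- a + q f = (c + q Q) g + (a + q R − c g), where c is the coefficient of
-- q^(deg g) in a + q R.
quotRem : ℤ[q] → ℤ[q] → ℤ[q] × ℤ[q]
quotRem []      g = [] , []
quotRem (a ∷ f) g with quotRem f g
... | Q , R = (c ∷ Q) , ((a ∷ R) +ₚ (ℤ.- c) ·ₚ g)
  where c = coeff (a ∷ R) (degree g)

quotₚ : ℤ[q] → ℤ[q] → ℤ[q]
quotₚ f g = proj₁ (quotRem f g)

-- Φ n = (q^n − 1) / ∏ Φ d, the product over the divisors d < n of n.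
Φ : ℕ → ℤ[q]
Φ = <-rec (λ _ → ℤ[q]) λ n Φ< →
  quotₚ (qₚ ^ₚ n +ₚ -ₚ 1ₚ)
        (productₚ {n} λ i → if does (toℕ i ∣ℕ? n) then Φ< (toℕ<n i) else 1ₚ)

-- Fractions over ℤ[q], up to cross-multiplication _≈_.
record ℚ⟨q⟩ : Set where
  constructor mk
  field
    num   : ℤ[q]
    den   : ℤ[q]
    den≉0 : den ≉ₚ 0ₚ

open ℚ⟨q⟩ public

infix  4 _≈_
infixl 6 _+_ _-_
infixl 7 _*_ _/_
infix  8 -_
infixr 8 _^ᶻ_
infix  9 _⁻¹

_≈_ : ℚ⟨q⟩ → ℚ⟨q⟩ → Set
x ≈ y = num x *ₚ den y ≈ₚ num y *ₚ den x

ι : ℤ[q] → ℚ⟨q⟩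
ι f = mk f 1ₚ 1-nonzero

_+_ _*_ : ℚ⟨q⟩ → ℚ⟨q⟩ → ℚ⟨q⟩
x + y = mk (num x *ₚ den y +ₚ num y *ₚ den x) (den x *ₚ den y) (*-nonzero (den x) (den y) (den≉0 x) (den≉0 y))
x * y = mk (num x *ₚ num y) (den x *ₚ den y) (*-nonzero (den x) (den y) (den≉0 x) (den≉0 y))

-_ : ℚ⟨q⟩ → ℚ⟨q⟩
- x = mk (-ₚ num x) (den x) (den≉0 x)

ℚ⟨q⟩-rawRing : RawRing 0ℓ 0ℓ
ℚ⟨q⟩-rawRing = record
  { Carrier = ℚ⟨q⟩
  ; _≈_     = _≈_
  ; _+_     = _+_
  ; _*_     = _*_
  ; -_      = -_
  ; 0#      = ι 0ₚ
  ; 1#      = ι 1ₚ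
  }

open RawRing ℚ⟨q⟩-rawRing public using (0#; 1#) renaming (rawSemiring to ℚ⟨q⟩-rawSemiring)
open RawSemiringDefs ℚ⟨q⟩-rawSemiring public using (_^_; sum; product)

_-_ : ℚ⟨q⟩ → ℚ⟨q⟩ → ℚ⟨q⟩
x - y = x + - y

-- Totalised by 0 ⁻¹ = 0.
_⁻¹ : ℚ⟨q⟩ → ℚ⟨q⟩
x ⁻¹ with zero? (num x)
... | yes _    = 0#
... | no  x≉0 = mk (den x) (num x) x≉0

_/_ : ℚ⟨q⟩ → ℚ⟨q⟩ → ℚ⟨q⟩
x / y = x * y ⁻¹

_^ᶻ_ : ℚ⟨q⟩ → ℤ → ℚ⟨q⟩
x ^ᶻ (+ m)    = x ^ m
x ^ᶻ -[1+ m ] = (x ⁻¹) ^ suc m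

q : ℚ⟨q⟩
q = ι qₚ

∑≤ : ℕ → (ℕ → ℚ⟨q⟩) → ℚ⟨q⟩
∑≤ N f = sum {suc N} λ k → f (toℕ k)

infixl 5 ∑≤
syntax ∑≤ N (λ k → x) = ∑[ k ≤ N ] x

-- ⟨ a ⨾ p ⟩ k is the shifted factorial (a; p)_k with base p.
⟨_⨾_⟩_ : ℚ⟨q⟩ → ℚ⟨q⟩ → ℕ → ℚ⟨q⟩
⟨ a ⨾ p ⟩ k = product {k} λ i → 1# - a * p ^ toℕ i

[_] : ℤ → ℚ⟨q⟩
[ m ] = (1# - q ^ᶻ m) / (1# - q)

-- The modulus is an element M of ℚ(q) that is a polynomial P, such as [ + n ],
-- which is defined as a quotient.  Coprimeₚ says that every common divisor
-- in ℤ[q] is a unit.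
_≅_[mod_] : ℚ⟨q⟩ → ℚ⟨q⟩ → ℚ⟨q⟩ → Set
A ≅ B [mod M ] =
  ∃[ P ] M ≈ ι P ×
  (∃[ N ] ∃[ D ] Σ[ D≉0 ∈ D ≉ₚ 0ₚ ]
     A - B ≈ mk N D D≉0 × Coprimeₚ D P × P ∣ₚ N)

infix 4 _≅_[mod_]

{-# OPTIONS --safe #-}

-- Write n = 4N + 1 and let c_k be the k-th summand.  Replacing one factor (q; q⁴)_k² / (q⁴; q⁴)_k² of c_k by
-- (q^{1+n}, q^{1−n}; q⁴)_k / (q^{4−n}, q^{4+n}; q⁴)_k turns the truncated sum into a terminating ₆φ₅ series, which a WZ
-- pair evaluates exactly to the right-hand side.  Since (1 − q^{m+n})(1 − q^{m−n}) = (1 − q^m)² − q^m t with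
-- t = q^{−n}(1 − q^n)², the replacement multiplies c_k by 1 + t L_k modulo Φ_n³, where L_k is a sum of terms
-- q^m / (1 − q^m)².  Now let d > 1 divide n and let r < d satisfy 4r + 1 ≡ 0 (mod d).  Modulo Φ_d the reflection
-- k ↦ r − k changes the sign of c_k and preserves L_k, so the sums of c_k and c_k L_k over k ≤ r vanish; c_k vanishes for
-- r < k < d, and each further block of d summands is a multiple of the first one.  Hence both congruences hold modulo
-- Φ_n³ and modulo Φ_d for the other divisors d, and [n] is the product of the Φ_d with 1 < d ∣ n, which are pairwise
-- comaximal up to integer constants.

module Submission where

open import Algebra.Bundles using (CommutativeMonoid; CommutativeRing; RawSemiring; Semiring)
open import Algebra.Solver.Ring.AlmostCommutativeRing using (fromCommutativeRing; _-Raw-AlmostCommutative⟶_)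
open import Data.Bool.Base using (if_then_else_)
open import Data.Empty using (⊥-elim)
open import Data.Fin.Base using (toℕ)
open import Data.Fin.Properties using (toℕ<n)
open import Data.Integer.Base as ℤ using (ℤ; 0ℤ; 1ℤ; -1ℤ; +_; -[1+_]; _⊖_)
import Data.Integer.Properties as ℤ
open import Data.Integer.Solver using (module +-*-Solver)
open import Data.List.Base using ([]; _∷_)
open import Data.Maybe.Base using (Maybe; just; nothing)
open import Data.Nat.Base as ℕ using (ℕ; zero; suc; _<_; _≤_; s≤s; z≤n; _∸_)
open import Data.Nat.DivMod as ℕ using (_%_)
open import Data.Nat.Divisibility as ℕ using (_∣_; _∤_; _∣?_)
open import Data.Nat.GCD using (module Bézout; module GCD; mkGCD)
open import Data.Nat.Induction using (<-rec; <-wellFounded)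
import Data.Nat.Properties as ℕ
import Data.Nat.Solver
open import Data.Product.Base using (Σ; _×_; _,_; proj₁; proj₂; ∃-syntax)
open import Data.Sum.Base using (_⊎_; inj₁; inj₂; [_,_]′)
open import Function.Base using (_∘_)
open import Induction.WellFounded using (module FixPoint)
open import Level using (0ℓ)
open import Relation.Binary.Definitions using (tri<; tri≈; tri>)
open import Relation.Binary.PropositionalEquality as ≡ using (_≡_; _≢_)
open import Relation.Nullary using (¬_; yes; no; does)
open import Relation.Unary using (Pred)
import Algebra.Definitions.RawMagma
import Algebra.Definitions.RawMonoid
import Algebra.Definitions.RawSemiring
import Algebra.Properties.AbelianGroup
import Algebra.Properties.CommutativeSemigroup
import Algebra.Properties.CommutativeSemiring.Exp
import Algebra.Properties.Monoid.Sum
import Algebra.Properties.Ring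
import Algebra.Properties.Semiring.Mult.TCOptimised
import Algebra.Solver.Ring
import Relation.Binary.Reasoning.Setoid
open GCD using (GCD)
open Data.Nat.Solver.+-*-Solver using () renaming (solve to solveℕ; _:+_ to _⊹_; _:*_ to _✶_; _:=_ to _≐_; con to lit)

-- The obstacle is that ℤ[q] is not a principal ideal domain: Φ_d and Φ_e may generate a proper
-- ideal that contains a prime number, so Bézout identities hold only up to a nonzero integer. Such
-- integers do no harm. In denominators they are units at every Φ_d, which is also what allows
-- halving in the reflection; and all moduli are monic, so an integer factor can be divided out
-- again at the end. The quantity t has order 2 at Φ_n. Modulo Φ_n³ only its first-order coefficient
-- counts, and this coefficient only modulo Φ_n, which is why arguments in a residue ring reach a
-- cube. At order 1 nothing has to be compared: the sums and the closed form vanish separately. For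
-- k ≥ d the denominator of c_k vanishes at Φ_d, so that c_k has no evident residue there. Zeros and
-- poles have to be followed through each block of d factors, and a block can be reduced only after
-- they have cancelled. The case n = 1 has no divisor d > 1 and is settled by an exact equality.

module IntegerSolver {c ℓ} (R : CommutativeRing c ℓ) where
  open CommutativeRing R
  open Algebra.Properties.Ring ring
  open Algebra.Properties.Semiring.Mult.TCOptimised semiring renaming (_×_ to _ℕ×_)
  open Relation.Binary.Reasoning.Setoid setoid

  -- The optimised multiple reduces `fromℤ 1ℤ` to `1#` itself, so solver terms with `con (+ 1)`
  -- match the goals by conversion.
  fromℤ : ℤ → Carrier
  fromℤ (+ n)    = n ℕ× 1#
  fromℤ -[1+ n ] = - (suc n ℕ× 1#)

  private
    fromℤ-⊖ : ∀ m n → fromℤ (m ⊖ n) ≈ m ℕ× 1# - n ℕ× 1#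
    fromℤ-⊖ m zero = begin
      fromℤ (m ⊖ 0) ≡⟨ ≡.cong fromℤ (ℤ.⊖-≥ {m} ℕ.z≤n) ⟩
      m ℕ× 1#  ≈⟨ +-identityʳ _ ⟨
      m ℕ× 1# + 0#  ≈⟨ +-congˡ -0#≈0# ⟨
      m ℕ× 1# - 0#  ∎
    fromℤ-⊖ zero (suc n) = sym (+-identityˡ _)
    fromℤ-⊖ (suc m) (suc n) = begin
      fromℤ (suc m ⊖ suc n)  ≡⟨ ≡.cong fromℤ (ℤ.[1+m]⊖[1+n]≡m⊖n m n) ⟩
      fromℤ (m ⊖ n)  ≈⟨ fromℤ-⊖ m n ⟩
      a - b  ≈⟨ +-identityˡ _ ⟨
      0# + (a - b)  ≈⟨ +-congʳ (-‿inverseʳ 1#) ⟨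
      (1# - 1#) + (a - b)  ≈⟨ +-assoc _ _ _ ⟩
      1# + (- 1# + (a - b))  ≈⟨ +-congˡ (+-assoc _ _ _) ⟨
      1# + ((- 1# + a) - b)  ≈⟨ +-congˡ (+-congʳ (+-comm _ _)) ⟩
      1# + ((a - 1#) - b)  ≈⟨ +-congˡ (+-assoc _ _ _) ⟩
      1# + (a + (- 1# - b))  ≈⟨ +-assoc _ _ _ ⟨
      (1# + a) + (- 1# - b)  ≈⟨ +-congˡ (-‿+-comm 1# b) ⟩
      (1# + a) - (1# + b)  ≈⟨ +-cong (sym (1+× m 1#)) (-‿cong (sym (1+× n 1#))) ⟩
      suc m ℕ× 1# - suc n ℕ× 1#  ∎
      where
      a = m ℕ× 1#
      b = n ℕ× 1#

    fromℤ-+ : ∀ i j → fromℤ (i ℤ.+ j) ≈ fromℤ i + fromℤ j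
    fromℤ-+ (+ m)    (+ n)    = ×-homo-+ 1# m n
    fromℤ-+ (+ m)    -[1+ n ] = fromℤ-⊖ m (suc n)
    fromℤ-+ -[1+ m ] (+ n)    = trans (fromℤ-⊖ n (suc m)) (+-comm _ _)
    fromℤ-+ -[1+ m ] -[1+ n ] = begin
      - (suc (suc (m ℕ.+ n)) ℕ× 1#)  ≡⟨ ≡.cong (λ k → - (suc k ℕ× 1#)) (ℕ.+-suc m n) ⟨
      - ((suc m ℕ.+ suc n) ℕ× 1#)  ≈⟨ -‿cong (×-homo-+ 1# (suc m) (suc n)) ⟩
      - (suc m ℕ× 1# + suc n ℕ× 1#)  ≈⟨ -‿+-comm _ _ ⟨
      - (suc m ℕ× 1#) - (suc n ℕ× 1#)  ∎

    fromℤ-neg : ∀ i → fromℤ (ℤ.- i) ≈ - fromℤ i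
    fromℤ-neg (+ zero)  = sym -0#≈0#
    fromℤ-neg (+ suc n) = refl
    fromℤ-neg -[1+ n ]  = sym (-‿involutive _)

    fromℤ-pos* : ∀ m n → fromℤ (+ m ℤ.* + n) ≈ fromℤ (+ m) * fromℤ (+ n)
    fromℤ-pos* m n = trans (reflexive (≡.cong fromℤ (≡.sym (ℤ.pos-* m n)))) (×1-homo-* m n)

    fromℤ-*+ : ∀ i n → fromℤ (i ℤ.* + n) ≈ fromℤ i * fromℤ (+ n)
    fromℤ-*+ (+ m)    n = fromℤ-pos* m n
    fromℤ-*+ -[1+ m ] n = begin
      fromℤ (-[1+ m ] ℤ.* + n)  ≡⟨ ≡.cong fromℤ (ℤ.neg-distribˡ-* (+ suc m) (+ n)) ⟨
      fromℤ (ℤ.- (+ suc m ℤ.* + n))  ≈⟨ fromℤ-neg (+ suc m ℤ.* + n) ⟩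
      - fromℤ (+ suc m ℤ.* + n)  ≈⟨ -‿cong (fromℤ-pos* (suc m) n) ⟩
      - (fromℤ (+ suc m) * fromℤ (+ n)) ≈⟨ -‿distribˡ-* _ _ ⟩
      fromℤ -[1+ m ] * fromℤ (+ n)  ∎

    fromℤ-* : ∀ i j → fromℤ (i ℤ.* j) ≈ fromℤ i * fromℤ j
    fromℤ-* i (+ n)    = fromℤ-*+ i n
    fromℤ-* i -[1+ n ] = begin
      fromℤ (i ℤ.* -[1+ n ])  ≡⟨ ≡.cong fromℤ (ℤ.neg-distribʳ-* i (+ suc n)) ⟨
      fromℤ (ℤ.- (i ℤ.* + suc n))  ≈⟨ fromℤ-neg (i ℤ.* + suc n) ⟩
      - fromℤ (i ℤ.* + suc n)  ≈⟨ -‿cong (fromℤ-*+ i (suc n)) ⟩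
      - (fromℤ i * fromℤ (+ suc n))  ≈⟨ -‿distribʳ-* _ _ ⟩
      fromℤ i * fromℤ -[1+ n ]  ∎

    morphism : ℤ.+-*-rawRing -Raw-AlmostCommutative⟶ fromCommutativeRing R
    morphism = record
      { ⟦_⟧    = fromℤ
      ; +-homo = fromℤ-+
      ; *-homo = fromℤ-*
      ; -‿homo = fromℤ-neg
      ; 0-homo = refl
      ; 1-homo = refl
      }

    coeff≟ : ∀ i j → Maybe (fromℤ i ≈ fromℤ j)
    coeff≟ i j with i ℤ.≟ j
    ... | yes ≡.refl = just refl
    ... | no  _      = nothing

  open Algebra.Solver.Ring ℤ.+-*-rawRing (fromCommutativeRing R) morphism coeff≟ public

-- Sums and products over initial segments of ℕ

module RangeFold {c ℓ} (M : CommutativeMonoid c ℓ) where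
  open CommutativeMonoid M
  open Algebra.Properties.CommutativeSemigroup commutativeSemigroup using (interchange)
  open Algebra.Definitions.RawMonoid rawMonoid using (sum)
  open Relation.Binary.Reasoning.Setoid setoid

  -- Recursion peels off the last index, because the inductions below extend sums and products at
  -- the top; `fold≈sum` connects this with the head-first `sum` of the statement.
  fold : ℕ → (ℕ → Carrier) → Carrier
  fold zero    f = ε
  fold (suc n) f = fold n f ∙ f n

  fold-cong : ∀ n {f g : ℕ → Carrier} → (∀ {i} → i < n → f i ≈ g i) → fold n f ≈ fold n g
  fold-cong zero    _   = refl
  fold-cong (suc n) f≈g = ∙-cong (fold-cong n (f≈g ∘ ℕ.m≤n⇒m≤1+n)) (f≈g ℕ.≤-refl)

  fold-ε : ∀ n {f : ℕ → Carrier} → (∀ {i} → i < n → f i ≈ ε) → fold n f ≈ ε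
  fold-ε zero    _   = refl
  fold-ε (suc n) f≈ε = trans (∙-cong (fold-ε n (f≈ε ∘ ℕ.m≤n⇒m≤1+n)) (f≈ε ℕ.≤-refl)) (identityˡ ε)

  fold-head : ∀ n (f : ℕ → Carrier) → fold (suc n) f ≈ f 0 ∙ fold n (f ∘ suc)
  fold-head zero    f = comm ε (f 0)
  fold-head (suc n) f = trans (∙-congʳ (fold-head n f)) (assoc _ _ _)

  fold-∙ : ∀ n (f g : ℕ → Carrier) → fold n (λ i → f i ∙ g i) ≈ fold n f ∙ fold n g
  fold-∙ zero    f g = sym (identityˡ ε)
  fold-∙ (suc n) f g = trans (∙-congʳ (fold-∙ n f g)) (interchange _ _ _ _)

  fold-+ : ∀ m n (f : ℕ → Carrier) → fold (m ℕ.+ n) f ≈ fold m f ∙ fold n (λ i → f (m ℕ.+ i))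
  fold-+ m zero f = begin
    fold (m ℕ.+ 0) f  ≡⟨ ≡.cong (λ k → fold k f) (ℕ.+-identityʳ m) ⟩
    fold m f  ≈⟨ identityʳ _ ⟨
    fold m f ∙ ε  ∎
  fold-+ m (suc n) f = begin
    fold (m ℕ.+ suc n) f  ≡⟨ ≡.cong (λ k → fold k f) (ℕ.+-suc m n) ⟩
    fold (m ℕ.+ n) f ∙ f (m ℕ.+ n)  ≈⟨ ∙-congʳ (fold-+ m n f) ⟩
    (fold m f ∙ fold n (λ i → f (m ℕ.+ i))) ∙ f (m ℕ.+ n)  ≈⟨ assoc _ _ _ ⟩
    fold m f ∙ (fold n (λ i → f (m ℕ.+ i)) ∙ f (m ℕ.+ n))  ∎

  -- Mirrored indices are given as pairs with sum n - 1, so no truncated subtraction appears in the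
  -- hypothesis.
  fold-reverse : ∀ n {f g : ℕ → Carrier} → (∀ i j → suc (i ℕ.+ j) ≡ n → f i ≈ g j) → fold n f ≈ fold n g
  fold-reverse zero        f≈g = refl
  fold-reverse (suc n) {f} {g} f≈g = begin
    fold n f ∙ f n  ≈⟨ ∙-cong (fold-reverse n λ i j eq → f≈g i (suc j) (≡.cong suc (≡.trans (ℕ.+-suc i j) eq)))
                                     (f≈g n 0 (≡.cong suc (ℕ.+-identityʳ n))) ⟩
    fold n (g ∘ suc) ∙ g 0 ≈⟨ comm _ _ ⟩
    g 0 ∙ fold n (g ∘ suc) ≈⟨ fold-head n g ⟨
    fold (suc n) g  ∎

  fold≈sum : ∀ n (f : ℕ → Carrier) → sum {n} (f ∘ toℕ) ≈ fold n f
  fold≈sum zero    f = refl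
  fold≈sum (suc n) f = trans (∙-congˡ (fold≈sum n (f ∘ suc))) (sym (fold-head n f))

module RangeSum {c ℓ} (R : CommutativeRing c ℓ) where
  open CommutativeRing R
  open RangeFold +-commutativeMonoid public
    renaming ( fold to ∑; fold-cong to ∑-cong; fold-ε to ∑-zero; fold-head to ∑-head; fold-∙ to ∑-+
             ; fold-+ to ∑-split; fold-reverse to ∑-reverse; fold≈sum to sum≈∑ )
  open RangeFold *-commutativeMonoid public
    renaming ( fold to ∏; fold-cong to ∏-cong; fold-ε to ∏-one; fold-head to ∏-head; fold-∙ to ∏-*
             ; fold-+ to ∏-split; fold-reverse to ∏-reverse; fold≈sum to product≈∏ )

  *-∑ : ∀ x n (f : ℕ → Carrier) → x * ∑ n f ≈ ∑ n (λ i → x * f i)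
  *-∑ x zero    f = zeroʳ x
  *-∑ x (suc n) f = trans (distribˡ x _ _) (+-congʳ (*-∑ x n f))

  ∑-telescope : ∀ n (f : ℕ → Carrier) → ∑ n (λ i → f (suc i) - f i) ≈ f n - f 0
  ∑-telescope zero    f = sym (-‿inverseʳ (f 0))
  ∑-telescope (suc n) f = trans (+-congʳ (∑-telescope n f))
    (solve 3 (λ a b c → (a :- b) :+ (c :- a) := c :- b) refl (f n) (f 0) (f (suc n)))
    where open IntegerSolver R using (solve; _:+_; _:-_; _:=_)

module RingKit {c ℓ} (R : CommutativeRing c ℓ) where
  open CommutativeRing R public
  open Semiring semiring using (rawSemiring) public
  open Algebra.Definitions.RawSemiring rawSemiring using (_^_) renaming (_×_ to _ℕ×_) public
  open Algebra.Properties.CommutativeSemiring.Exp commutativeSemiring using (^-homo-*; ^-assocʳ; ^-congˡ; ^-distrib-*) public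
  open IntegerSolver R using (Polynomial; solve; _:+_; _:*_; _:-_; :-_; _:=_; _:^_; con) public
  open RangeSum R public
  open Relation.Binary.Reasoning.Setoid setoid public

  one : ∀ {n} → Polynomial n
  one = con (+ 1)

  1^ : ∀ n → 1# ^ n ≈ 1#
  1^ zero    = refl
  1^ (suc n) = trans (*-identityˡ _) (1^ n)

-- Comaximality and cyclotomic polynomials

-- For ℤ[q] these are the nonzero integers: Bézout identities hold up to such constants only.
record Constants (R : CommutativeRing 0ℓ 0ℓ) : Set₁ where
  open RingKit R
  field
    Const   : Pred Carrier 0ℓ
    Const-* : ∀ {c d} → Const c → Const d → Const (c * d)
    Const-ℕ : ∀ n → Const (suc n ℕ× 1#)
    Const-1 : Const 1#

module Comaximality (R : CommutativeRing 0ℓ 0ℓ) (K : Constants R) where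
  open RingKit R
  open Constants K

  record Comaximal (f g : Carrier) : Set where
    constructor comaximal
    field
      {u v c} : Carrier
      const   : Const c
      bézout  : u * f + v * g ≈ c

  cop-sym : ∀ {f g} → Comaximal f g → Comaximal g f
  cop-sym (comaximal c eq) = comaximal c (trans (+-comm _ _) eq)

  cop-respʳ : ∀ {f g g′} → g ≈ g′ → Comaximal f g → Comaximal f g′
  cop-respʳ g≈g′ (comaximal c eq) = comaximal c (trans (+-congˡ (*-congˡ (sym g≈g′))) eq)

  cop-1 : ∀ {f} → Comaximal f 1#
  cop-1 {f} = comaximal {u = 0#} {v = 1#} Const-1 (solve 1 (λ f → con (+ 0) :* f :+ one :* one := one) refl f)

  cop-const : ∀ {f c} → Const c → Comaximal f c
  cop-const {f} {c} const = comaximal {u = 0#} {v = 1#} const (solve 2 (λ f c → con (+ 0) :* f :+ one :* c := c) refl f c)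

  cop-* : ∀ {f g h} → Comaximal f g → Comaximal f h → Comaximal f (g * h)
  cop-* {f} {g} {h} (comaximal {u} {v} c eq) (comaximal {u′} {v′} c′ eq′) =
    comaximal {u = u * (u′ * f + v′ * h) + v * g * u′} {v = v * v′} (Const-* c c′) (trans
      (solve 7 (λ f g h u v u′ v′ → (u :* (u′ :* f :+ v′ :* h) :+ v :* g :* u′) :* f :+ v :* v′ :* (g :* h)
         := (u :* f :+ v :* g) :* (u′ :* f :+ v′ :* h)) refl f g h u v u′ v′)
      (*-cong eq eq′))

  cop-factor : ∀ {f g} h → Comaximal f (g * h) → Comaximal f g
  cop-factor {f} {g} h (comaximal {u} {v} c eq) = comaximal {u = u} {v = v * h} c (trans
    (solve 5 (λ f g h u v → u :* f :+ v :* h :* g := u :* f :+ v :* (g :* h)) refl f g h u v) eq)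

  cop-^ : ∀ {f g} n → Comaximal f g → Comaximal f (g ^ n)
  cop-^ zero    _ = cop-1
  cop-^ (suc n) p = cop-* p (cop-^ n p)

  cop-∏ : ∀ {f g} n → (∀ {i} → i < n → Comaximal f (g i)) → Comaximal f (∏ n g)
  cop-∏ zero    _ = cop-1
  cop-∏ (suc n) p = cop-* (cop-∏ n λ i<n → p (ℕ.m≤n⇒m≤1+n i<n)) (p ℕ.≤-refl)

  -- Multiply the Bézout identity by x and insert each factorisation of x into the opposite term.
  -- The constant c remains; over ℤ[q] it is removed by `monic-multiple`.
  lcm-∣ : ∀ {f g x a b} → Comaximal f g → f * a ≈ x → g * b ≈ x →
    ∃[ c ] Const c × ∃[ y ] f * g * y ≈ c * x
  lcm-∣ {f} {g} {x} {a} {b} (comaximal {u} {v} {c} const eq) fa≈x gb≈x = c , const , (u * b + v * a) , (begin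
    f * g * (u * b + v * a)  ≈⟨ solve 6 (λ f g u v a b → f :* g :* (u :* b :+ v :* a) := u :* f :* (g :* b) :+ v :* g :* (f :* a)) refl
      f g u v a b ⟩
    u * f * (g * b) + v * g * (f * a)  ≈⟨ +-cong (*-congˡ gb≈x) (*-congˡ fa≈x) ⟩
    u * f * x + v * g * x  ≈⟨ distribʳ x _ _ ⟨
    (u * f + v * g) * x  ≈⟨ *-congʳ eq ⟩
    c * x  ∎)

module Cyclotomic (R : CommutativeRing 0ℓ 0ℓ) (K : Constants R) where
  open RingKit R
  open Constants K
  open Comaximality R K

  geometric : ∀ x m → x ^ m - 1# ≈ (x - 1#) * ∑ m (x ^_)
  geometric x zero    = solve 1 (λ x → one :- one := (x :- one) :* con (+ 0)) refl x
  geometric x (suc m) = begin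
    x * x ^ m - 1#  ≈⟨ solve 2 (λ x y → x :* y :- one := (y :- one) :+ (x :- one) :* y) refl x (x ^ m) ⟩
    (x ^ m - 1#) + (x - 1#) * x ^ m  ≈⟨ +-congʳ (geometric x m) ⟩
    (x - 1#) * ∑ m (x ^_) + (x - 1#) * x ^ m ≈⟨ distribˡ _ _ _ ⟨
    (x - 1#) * ∑ (suc m) (x ^_)  ∎

  geometric-mod : ∀ x m → ∃[ z ] ∑ m (x ^_) ≈ m ℕ× 1# + (x - 1#) * z
  geometric-mod x zero = 0# , sym (trans (+-identityˡ _) (zeroʳ _))
  geometric-mod x (suc m) with geometric-mod x m
  ... | z , eq = z + ∑ m (x ^_) , (begin
    ∑ m (x ^_) + x ^ m  ≈⟨ +-cong eq (solve 1 (λ y → y := one :+ (y :- one)) refl (x ^ m)) ⟩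
    (k + d * z) + (1# + (x ^ m - 1#))  ≈⟨ +-congˡ (+-congˡ (geometric x m)) ⟩
    (k + d * z) + (1# + d * ∑ m (x ^_))  ≈⟨ solve 4 (λ k d z s → (k :+ d :* z) :+ (one :+ d :* s) := (one :+ k) :+ d :* (z :+ s)) refl k
      d z (∑ m (x ^_)) ⟩
    (1# + k) + d * (z + ∑ m (x ^_))  ∎)
    where
    k = m ℕ× 1#
    d = x - 1#

  -- Every power of x is 1 modulo x - 1, so the sum is the integer m + 1 there. This is the source
  -- of the integer constants in the Bézout identities.
  cop-geometric : ∀ x m → Comaximal (x - 1#) (∑ (suc m) (x ^_))
  cop-geometric x m = comaximal {u = - z} {v = 1#} (Const-ℕ m) (begin
    - z * (x - 1#) + 1# * ∑ (suc m) (x ^_)  ≈⟨ +-congˡ (*-congˡ (proj₂ (geometric-mod x (suc m)))) ⟩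
    - z * (x - 1#) + 1# * (k + (x - 1#) * z)  ≈⟨ solve 3 (λ k d z → (:- z) :* d :+ one :* (k :+ d :* z) := k) refl k (x - 1#) z ⟩
    k  ∎)
    where
    k = suc m ℕ× 1#
    z = proj₁ (geometric-mod x (suc m))

  module WithBase
    (q : Carrier) (cancel : ∀ n {x y} → x * (q ^ suc n - 1#) ≈ y * (q ^ suc n - 1#) → x ≈ y)
    (Φ : ℕ → Carrier) where

    geometric-∣ : ∀ g {d} → g ∣ d → 0 < d → ∃[ m ] q ^ d - 1# ≈ (q ^ g - 1#) * ∑ (suc m) ((q ^ g) ^_)
    geometric-∣ g (ℕ.divides (suc m) ≡.refl) _ = m , trans
      (+-congʳ (trans (reflexive (≡.cong (q ^_) (ℕ.*-comm (suc m) g))) (sym (^-assocʳ q g (suc m))))) (geometric (q ^ g) (suc m))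

    Φ∣ : ℕ → ℕ → Carrier
    Φ∣ n i = if does (i ∣? n) then Φ i else 1#

    -- A proposition about a single n instead of a global assumption on Φ: the induction that
    -- establishes it in `cyc` already uses comaximality of the Φ at smaller indices.
    Factorised : ℕ → Set
    Factorised n = Φ n * ∏ n (Φ∣ n) ≈ q ^ n - 1#

    Φ∣-∣ : ∀ {g d} → g ∣ d → ∀ i → ∃[ e ] Φ∣ d i ≈ Φ∣ g i * e
    Φ∣-∣ {g} {d} g∣d i with i ∣? g | i ∣? d
    ... | yes _   | yes _   = 1# , sym (*-identityʳ _)
    ... | no  _   | yes _   = Φ i , sym (*-identityˡ _)
    ... | no  _   | no  _   = 1# , sym (*-identityʳ _)
    ... | yes i∣g | no  i∤d = ⊥-elim (i∤d (ℕ.∣-trans i∣g g∣d))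

    Φ∣-≡ : ∀ {n i} → i ∣ n → Φ∣ n i ≡ Φ i
    Φ∣-≡ {n} {i} i∣n with i ∣? n
    ... | yes _   = ≡.refl
    ... | no  i∤n = ⊥-elim (i∤n i∣n)

    Φ∣-∤ : ∀ {n i} → i ∤ n → Φ∣ n i ≡ 1#
    Φ∣-∤ {n} {i} i∤n with i ∣? n
    ... | yes i∣n = ⊥-elim (i∤n i∣n)
    ... | no  _   = ≡.refl

    ∏-proper : ∀ {g} → Factorised g → ∏ (suc g) (Φ∣ g) ≈ q ^ g - 1#
    ∏-proper {g} fact = trans (*-congˡ (reflexive (Φ∣-≡ {g} ℕ.∣-refl))) (trans (*-comm _ _) fact)

    -- The divisors of g, including g, are among the proper divisors of d, so their Φ can be taken
    -- out of the product; together they make up q^g - 1.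
    pow∣∏ : ∀ {g d} → g ∣ d → g < d → Factorised g → ∃[ y ] ∏ d (Φ∣ d) ≈ (q ^ g - 1#) * y
    pow∣∏ {g} {d} g∣d g<d fact with ℕ.m≤n⇒∃[o]m+o≡n g<d
    ... | k , ≡.refl = (∏ (suc g) e * rest) , (begin
      ∏ (suc g ℕ.+ k) (Φ∣ d)  ≈⟨ ∏-split (suc g) k (Φ∣ d) ⟩
      ∏ (suc g) (Φ∣ d) * rest  ≈⟨ *-congʳ (∏-cong (suc g) λ {i} _ → proj₂ (Φ∣-∣ g∣d i)) ⟩
      ∏ (suc g) (λ i → Φ∣ g i * e i) * rest  ≈⟨ *-congʳ (∏-* (suc g) (Φ∣ g) e) ⟩
      ∏ (suc g) (Φ∣ g) * ∏ (suc g) e * rest  ≈⟨ *-congʳ (*-congʳ (∏-proper {g} fact)) ⟩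
      (q ^ g - 1#) * ∏ (suc g) e * rest  ≈⟨ *-assoc _ _ _ ⟩
      (q ^ g - 1#) * (∏ (suc g) e * rest)  ∎)
      where
      e : ℕ → Carrier
      e i = proj₁ (Φ∣-∣ g∣d i)
      rest = ∏ k (λ i → Φ∣ d (suc g ℕ.+ i))

    -- Φ d divides (q^d − 1) / (q^g − 1) = 1 + q^g + ⋯, which is d / g modulo q^g − 1.
    cop-divisor : ∀ {g d} → suc g ∣ d → suc g < d → Factorised (suc g) → Factorised d → Comaximal (Φ d) (q ^ suc g - 1#)
    cop-divisor {g} {d} g∣d g<d fact-g fact-d with pow∣∏ g∣d g<d fact-g | geometric-∣ (suc g) g∣d (ℕ.≤-trans (s≤s z≤n) g<d)
    ... | y , ∏≈ | m , pow≈ = cop-sym (cop-factor y (cop-respʳ (sym Φy≈) (cop-geometric (q ^ suc g) m)))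
      where
      x = q ^ suc g
      Φy≈ : Φ d * y ≈ ∑ (suc m) (x ^_)
      Φy≈ = cancel g (begin
        Φ d * y * (x - 1#)  ≈⟨ solve 3 (λ a b c → a :* b :* c := a :* (c :* b)) refl (Φ d) y (x - 1#) ⟩
        Φ d * ((x - 1#) * y)  ≈⟨ *-congˡ ∏≈ ⟨
        Φ d * ∏ d (Φ∣ d)  ≈⟨ fact-d ⟩
        q ^ d - 1#  ≈⟨ pow≈ ⟩
        (x - 1#) * ∑ (suc m) (x ^_)  ≈⟨ *-comm _ _ ⟩
        ∑ (suc m) (x ^_) * (x - 1#)  ∎)

    pow-+ : ∀ m n → q ^ (m ℕ.+ n) - 1# ≈ q ^ m * (q ^ n - 1#) + (q ^ m - 1#)
    pow-+ m n = trans (+-congʳ (^-homo-* q m n))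
      (solve 2 (λ x y → x :* y :- one := x :* (y :- one) :+ (x :- one)) refl (q ^ m) (q ^ n))

    pow-∣ : ∀ {g d} → g ∣ d → ∃[ z ] q ^ d - 1# ≈ z * (q ^ g - 1#)
    pow-∣ {g} (ℕ.divides zero    ≡.refl) = 0# , trans (-‿inverseʳ 1#) (sym (zeroˡ _))
    pow-∣ {g} (ℕ.divides (suc m) ≡.refl) with pow-∣ {g} (ℕ.divides m ≡.refl)
    ... | z , eq = q ^ g * z + 1# , (begin
      q ^ (g ℕ.+ m ℕ.* g) - 1#  ≈⟨ pow-+ g (m ℕ.* g) ⟩
      q ^ g * (q ^ (m ℕ.* g) - 1#) + (q ^ g - 1#)  ≈⟨ +-congʳ (*-congˡ eq) ⟩
      q ^ g * (z * (q ^ g - 1#)) + (q ^ g - 1#)  ≈⟨ solve 3 (λ x z w → x :* (z :* w) :+ w := (x :* z :+ one) :* w) refl (q ^ g) z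
        (q ^ g - 1#) ⟩
      (q ^ g * z + 1#) * (q ^ g - 1#)  ∎)

    -- Euclid's algorithm on exponents: `pow-+` expands q^(g + yn) - 1, and writing the Bézout
    -- relation with one summand on each side keeps all exponents natural.
    pow-linear : ∀ {g m n} x y → g ℕ.+ y ℕ.* n ≡ x ℕ.* m →
      ∃[ a ] ∃[ b ] q ^ g - 1# ≈ a * (q ^ m - 1#) + b * (q ^ n - 1#)
    pow-linear {g} {m} {n} x y eq with pow-∣ (ℕ.divides {m} x ≡.refl) | pow-∣ (ℕ.divides {n} y ≡.refl)
    ... | z , qˣᵐ | w , qʸⁿ = z , - (q ^ g * w) , (begin
      q ^ g - 1#
        ≈⟨ solve 2 (λ u v → u := (v :+ u) :- v) refl (q ^ g - 1#) (q ^ g * (q ^ (y ℕ.* n) - 1#)) ⟩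
      (q ^ g * (q ^ (y ℕ.* n) - 1#) + (q ^ g - 1#)) - q ^ g * (q ^ (y ℕ.* n) - 1#)
        ≈⟨ +-congʳ (pow-+ g (y ℕ.* n)) ⟨
      (q ^ (g ℕ.+ y ℕ.* n) - 1#) - q ^ g * (q ^ (y ℕ.* n) - 1#)
        ≈⟨ +-cong (trans (reflexive (≡.cong (λ k → q ^ k - 1#) eq)) qˣᵐ) (-‿cong (*-congˡ qʸⁿ)) ⟩
      z * (q ^ m - 1#) - q ^ g * (w * (q ^ n - 1#))
        ≈⟨ solve 5 (λ z u g w v → z :* u :- g :* (w :* v) := z :* u :+ (:- (g :* w)) :* v) refl z (q ^ m - 1#) (q ^ g) w (q ^ n - 1#) ⟩
      z * (q ^ m - 1#) + (- (q ^ g * w)) * (q ^ n - 1#) ∎)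

    pow-gcd : ∀ {g m n} → GCD m n g → ∃[ a ] ∃[ b ] q ^ g - 1# ≈ a * (q ^ m - 1#) + b * (q ^ n - 1#)
    pow-gcd isGCD = from-identity (Bézout.identity isGCD)
      where
      from-identity : ∀ {g m n} → Bézout.Identity g m n → ∃[ a ] ∃[ b ] q ^ g - 1# ≈ a * (q ^ m - 1#) + b * (q ^ n - 1#)
      from-identity (Bézout.+- x y eq) = pow-linear x y eq
      from-identity (Bézout.-+ x y eq) = let a , b , pow≈ = pow-linear y x eq in b , a , trans pow≈ (+-comm _ _)

    -- Since d does not divide m, g = gcd(m, d) is a proper divisor of d and `cop-divisor` applies
    -- to q^g - 1. That element is a combination of q^m - 1 and q^d - 1, and the latter is a
    -- multiple of Φ d.
    cop-pow : ∀ {d} → 0 < d → (∀ {g} → 0 < g → g ≤ d → Factorised g) → ∀ {m} → d ∤ m → Comaximal (Φ d) (q ^ m - 1#)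
    cop-pow {d} 0<d fact {m} d∤m = by-gcd (mkGCD m d)
      where
      by-gcd : ∃[ g ] GCD m d g → Comaximal (Φ d) (q ^ m - 1#)
      by-gcd (zero  , isGCD) = ⊥-elim (d∤m (≡.subst (_∣ m) (≡.sym (ℕ.0∣⇒≡0 (GCD.gcd∣n isGCD))) (GCD.gcd∣m isGCD)))
      by-gcd (suc g , isGCD) = comaximal {u = u + v * b * ∏ d (Φ∣ d)} {v = v * a} const (begin
        (u + v * b * ∏ d (Φ∣ d)) * Φ d + v * a * (q ^ m - 1#)
          ≈⟨ solve 7 (λ u v b w f a x → (u :+ v :* b :* w) :* f :+ v :* a :* x := u :* f :+ v :* (a :* x :+ b :* (f :* w))) refl u v b
            (∏ d (Φ∣ d)) (Φ d) a (q ^ m - 1#) ⟩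
        u * Φ d + v * (a * (q ^ m - 1#) + b * (Φ d * ∏ d (Φ∣ d)))
          ≈⟨ +-congˡ (*-congˡ (+-congˡ (*-congˡ (fact 0<d ℕ.≤-refl)))) ⟩
        u * Φ d + v * (a * (q ^ m - 1#) + b * (q ^ d - 1#))
          ≈⟨ +-congˡ (*-congˡ pow≈) ⟨
        u * Φ d + v * (q ^ suc g - 1#)
          ≈⟨ bézout ⟩
        c ∎)
        where
        g∣d : suc g ∣ d
        g∣d = GCD.gcd∣n isGCD
        g<d : suc g < d
        g<d with ℕ.<-cmp (suc g) d
        ... | tri< g<d _ _    = g<d
        ... | tri≈ _ ≡.refl _ = ⊥-elim (d∤m (GCD.gcd∣m isGCD))
        ... | tri> _ _ d<g    = ⊥-elim (ℕ.<⇒≱ d<g (ℕ.∣⇒≤ {{ℕ.>-nonZero 0<d}} g∣d))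
        linear = pow-gcd isGCD
        a = proj₁ linear
        b = proj₁ (proj₂ linear)
        pow≈ = proj₂ (proj₂ linear)
        open Comaximal (cop-divisor g∣d g<d (fact (s≤s z≤n) (ℕ.<⇒≤ g<d)) (fact 0<d ℕ.≤-refl))

    -- Two different positive indices cannot divide each other. If d does not divide e, then Φ d is
    -- comaximal to q^e - 1, hence to its factor Φ e; otherwise the roles are exchanged.
    cop-Φ : ∀ {N} → (∀ {g} → 0 < g → g ≤ N → Factorised g) → ∀ {d e} → 0 < d → 0 < e → d ≤ N → e ≤ N → d ≢ e → Comaximal (Φ d) (Φ e)
    cop-Φ fact {d} {e} 0<d 0<e d≤N e≤N d≢e with d ∣? e
    ... | no d∤e = cop-factor _ (cop-respʳ (sym (fact 0<e e≤N)) (cop-pow 0<d (λ 0<g g≤d → fact 0<g (ℕ.≤-trans g≤d d≤N)) d∤e))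
    ... | yes d∣e = cop-sym (cop-factor _ (cop-respʳ (sym (fact 0<d d≤N)) (cop-pow 0<e (λ 0<g g≤e → fact 0<g (ℕ.≤-trans g≤e e≤N))
        λ e∣d → d≢e (ℕ.∣-antisym d∣e e∣d))))

    -- In the factorisation of q^n - 1 the index 0 contributes 1, because 0 does not divide n, and
    -- the index 1 contributes q - 1, which is cancelled.
    q-integer : ∀ {n} m → n ≡ 2 ℕ.+ m → Factorised 1 → Factorised n →
      ∑ n (q ^_) ≈ Φ n * ∏ m (λ i → Φ∣ n (2 ℕ.+ i))
    q-integer {n} m ≡.refl fact-1 fact-n = cancel 0 (begin
      ∑ n (q ^_) * (q ^ 1 - 1#)  ≈⟨ trans (*-comm _ _) (*-congʳ (+-congʳ (*-identityʳ q))) ⟩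
      (q - 1#) * ∑ n (q ^_)  ≈⟨ geometric q n ⟨
      q ^ n - 1#  ≈⟨ fact-n ⟨
      Φ n * ∏ n (Φ∣ n)  ≈⟨ *-congˡ (trans (∏-head (suc m) (Φ∣ n)) (*-cong Φ∣0 (trans (∏-head m (λ i → Φ∣ n (suc i))) (*-congʳ Φ∣1)))) ⟩
      Φ n * (1# * ((q ^ 1 - 1#) * Π))  ≈⟨ solve 3 (λ f x p → f :* (one :* (x :* p)) := f :* p :* x) refl (Φ n) (q ^ 1 - 1#) Π ⟩
      Φ n * Π * (q ^ 1 - 1#)  ∎)
      where
      Π = ∏ m (λ i → Φ∣ n (2 ℕ.+ i))
      Φ∣0 : Φ∣ n 0 ≈ 1#
      Φ∣0 = reflexive (Φ∣-∤ {n} {0} λ 0∣n → ℕ.1+n≢0 (ℕ.0∣⇒≡0 0∣n))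
      Φ∣1 : Φ∣ n 1 ≈ q ^ 1 - 1#
      Φ∣1 = trans (reflexive (Φ∣-≡ {n} {1} (ℕ.1∣ n))) (trans (sym (trans (*-congˡ (*-identityˡ 1#)) (*-identityʳ (Φ 1)))) fact-1)

-- Orders at a prime

-- I e is the ideal of order-e elements of the subring I 0.
record Filtration (K : CommutativeRing 0ℓ 0ℓ) : Set₁ where
  open RingKit K
  field
    I        : ℕ → Pred Carrier 0ℓ
    I-resp   : ∀ {e x y} → x ≈ y → I e x → I e y
    I-0#     : ∀ e → I e 0#
    I-1#     : I 0 1#
    I-+      : ∀ {e x y} → I e x → I e y → I e (x + y)
    I-neg    : ∀ {e x} → I e x → I e (- x)
    I-*      : ∀ {a b x y} → I a x → I b y → I (a ℕ.+ b) (x * y)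
    I-weaken : ∀ {e x} → I (suc e) x → I e x

  I-- : ∀ {e x y} → I e x → I e y → I e (x - y)
  I-- p r = I-+ p (I-neg r)

  I-≤ : ∀ {a b x} → a ≤ b → I b x → I a x
  I-≤ {a} {b} {x} a≤b p = descend (b ℕ.∸ a) (≡.subst (λ k → I k x) (≡.sym (ℕ.m∸n+n≡m a≤b)) p)
    where
    descend : ∀ k → I (k ℕ.+ a) x → I a x
    descend zero    p = p
    descend (suc k) p = descend k (I-weaken p)

  I-^ : ∀ {x} n → I 0 x → I 0 (x ^ n)
  I-^ zero    p = I-1#
  I-^ (suc n) p = I-* p (I-^ n p)

  I-∑ : ∀ {e f} n → (∀ {i} → i ℕ.< n → I e (f i)) → I e (∑ n f)
  I-∑ {e} zero    p = I-0# e
  I-∑ {e} (suc n) p = I-+ (I-∑ n λ i<n → p (ℕ.m≤n⇒m≤1+n i<n)) (p ℕ.≤-refl)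

module Residue {K : CommutativeRing 0ℓ 0ℓ} (F : Filtration K) where
  open RingKit K
  open Filtration F

  infix 4 _≡₁_
  record _≡₁_ (x y : Σ Carrier (I 0)) : Set where
    constructor congruent
    field difference : I 1 (proj₁ x - proj₁ y)
  open _≡₁_ public

  private
    from-≈ : ∀ {x y : Σ Carrier (I 0)} → proj₁ x ≈ proj₁ y → x ≡₁ y
    from-≈ eq = congruent (I-resp (sym (trans (+-congʳ eq) (-‿inverseʳ _))) (I-0# 1))

    infixl 6 _⊕_
    infixl 7 _⊗_
    _⊕_ _⊗_ : Σ Carrier (I 0) → Σ Carrier (I 0) → Σ Carrier (I 0)
    (x , p) ⊕ (y , r) = x + y , I-+ p r
    (x , p) ⊗ (y , r) = x * y , I-* p r

    ≡₁-sym : ∀ {x y} → x ≡₁ y → y ≡₁ x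
    ≡₁-sym {x , _} {y , _} (congruent p) = congruent (I-resp (solve 2 (λ x y → :- (x :- y) := y :- x) refl x y) (I-neg p))

    ≡₁-trans : ∀ {x y z} → x ≡₁ y → y ≡₁ z → x ≡₁ z
    ≡₁-trans {x , _} {y , _} {z , _} (congruent p) (congruent r) = congruent
      (I-resp (solve 3 (λ x y z → (x :- y) :+ (y :- z) := x :- z) refl x y z) (I-+ p r))

    ⊕-cong : ∀ {x x′ y y′} → x ≡₁ x′ → y ≡₁ y′ → x ⊕ y ≡₁ x′ ⊕ y′
    ⊕-cong {x , _} {x′ , _} {y , _} {y′ , _} (congruent p) (congruent r) =
      congruent (I-resp (solve 4 (λ x x′ y y′ → (x :- x′) :+ (y :- y′) := (x :+ y) :- (x′ :+ y′)) refl x x′ y y′) (I-+ p r))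

    ⊗-cong : ∀ {x x′ y y′} → x ≡₁ x′ → y ≡₁ y′ → x ⊗ y ≡₁ x′ ⊗ y′
    ⊗-cong {x , x∈} {x′ , x′∈} {y , y∈} {y′ , y′∈} (congruent p) (congruent r) =
      congruent (I-resp (solve 4 (λ x x′ y y′ → (x :- x′) :* y :+ x′ :* (y :- y′) := (x :* y) :- (x′ :* y′)) refl x x′ y y′)
        (I-+ (I-* p y∈) (I-* x′∈ r)))

    neg : Σ Carrier (I 0) → Σ Carrier (I 0)
    neg (x , p) = - x , I-neg p

    neg-cong : ∀ {x y} → x ≡₁ y → neg x ≡₁ neg y
    neg-cong {x , _} {y , _} (congruent p) = congruent (I-resp (solve 2 (λ x y → :- (x :- y) := (:- x) :- (:- y)) refl x y) (I-neg p))

  -- The quotient I 0 / I 1 as a setoid. Congruence becomes the equality of a ring, so `Reflection`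
  -- can argue with exact identities and still conclude membership in `I 1`.
  residueRing : CommutativeRing 0ℓ 0ℓ
  residueRing = record
    { Carrier = Σ Carrier (I 0)
    ; _≈_     = _≡₁_
    ; _+_     = _⊕_
    ; _*_     = _⊗_
    ; -_      = neg
    ; 0#      = 0# , I-0# 0
    ; 1#      = 1# , I-1#
    ; isCommutativeRing = record
      { isRing = record
        { +-isAbelianGroup = record
          { isGroup = record
            { isMonoid = record
              { isSemigroup = record
                { isMagma = record
                  { isEquivalence = record { refl = from-≈ refl ; sym = ≡₁-sym ; trans = ≡₁-trans }
                  ; ∙-cong = ⊕-cong }
                ; assoc = λ _ _ _ → from-≈ (+-assoc _ _ _) }
              ; identity = (λ _ → from-≈ (+-identityˡ _)) , (λ _ → from-≈ (+-identityʳ _)) }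
            ; inverse = (λ _ → from-≈ (-‿inverseˡ _)) , (λ _ → from-≈ (-‿inverseʳ _))
            ; ⁻¹-cong = neg-cong }
          ; comm = λ _ _ → from-≈ (+-comm _ _) }
        ; *-cong = ⊗-cong
        ; *-assoc = λ _ _ _ → from-≈ (*-assoc _ _ _)
        ; *-identity = (λ _ → from-≈ (*-identityˡ _)) , (λ _ → from-≈ (*-identityʳ _))
        ; distrib = (λ _ _ _ → from-≈ (distribˡ _ _ _)) , (λ _ _ _ → from-≈ (distribʳ _ _ _))
        }
      ; *-comm = λ _ _ → from-≈ (*-comm _ _)
      }
    }

record Embedding (R K : CommutativeRing 0ℓ 0ℓ) : Set where
  private
    module R = RingKit R
  open RingKit K
  field
    ι      : R.Carrier → Carrier
    ι-cong : ∀ {f g} → f R.≈ g → ι f ≈ ι g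
    ι-+    : ∀ f g → ι (f R.+ g) ≈ ι f + ι g
    ι-*    : ∀ f g → ι (f R.* g) ≈ ι f * ι g
    ι-neg  : ∀ f → ι (R.- f) ≈ - ι f
    ι-0#   : ι R.0# ≈ 0#
    ι-1#   : ι R.1# ≈ 1#

module Localisation {R K : CommutativeRing 0ℓ 0ℓ} (C : Constants R) (ε : Embedding R K) where
  private
    module R = RingKit R
  open RingKit K
  open Embedding ε
  open Comaximality R C

  -- P divides x in the localisation of R at the elements comaximal to P.
  record Divides (P : R.Carrier) (x : Carrier) : Set where
    constructor divides
    field
      {D M} : R.Carrier
      cop   : Comaximal P D
      eq    : ι D * x ≈ ι P * ι M

  -- If D₁ x = P₁ M₁ and D₂ x = P₂ M₂, then (D₁ P₂ + D₂ P₁) x = P₁ P₂ (M₁ + M₂).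
  divides-product : ∀ {P Q x} → Comaximal P Q → Divides P x → Divides Q x → Divides (P R.* Q) x
  divides-product {P} {Q} {x} P⊥Q (divides {D₁} {M₁} cop₁ eq₁) (divides {D₂} {M₂} cop₂ eq₂) =
    divides {D = D₁ R.* Q R.+ D₂ R.* P} {M = M₁ R.+ M₂} (cop-sym (cop-* (cop-sym copP) (cop-sym copQ))) (begin
      ι (D₁ R.* Q R.+ D₂ R.* P) * x
        ≈⟨ *-congʳ (trans (ι-+ _ _) (+-cong (ι-* D₁ Q) (ι-* D₂ P))) ⟩
      (ι D₁ * ι Q + ι D₂ * ι P) * x
        ≈⟨ solve 5 (λ d q e p x → (d :* q :+ e :* p) :* x := q :* (d :* x) :+ p :* (e :* x)) refl (ι D₁) (ι Q) (ι D₂) (ι P) x ⟩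
      ι Q * (ι D₁ * x) + ι P * (ι D₂ * x)
        ≈⟨ +-cong (*-congˡ eq₁) (*-congˡ eq₂) ⟩
      ι Q * (ι P * ι M₁) + ι P * (ι Q * ι M₂)
        ≈⟨ solve 4 (λ q p m n → q :* (p :* m) :+ p :* (q :* n) := p :* q :* (m :+ n)) refl (ι Q) (ι P) (ι M₁) (ι M₂) ⟩
      ι P * ι Q * (ι M₁ + ι M₂)
        ≈⟨ *-cong (ι-* P Q) (ι-+ M₁ M₂) ⟨
      ι (P R.* Q) * ι (M₁ R.+ M₂) ∎)
    where
    -- The new denominator is D₁ Q modulo P and D₂ P modulo Q, and adding a multiple of f does not
    -- affect comaximality with f.
    shift : ∀ {f g} h → Comaximal f g → Comaximal f (g R.+ h R.* f)
    shift {f} {g} h (comaximal {u} {v} {c} const eq) = comaximal {u = u R.+ R.- (v R.* h)} {v = v} const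
      (R.trans (R.solve 5 (λ f g h u v → (u R.:+ R.:- (v R.:* h)) R.:* f R.:+ v R.:* (g R.:+ h R.:* f) R.:= u R.:* f R.:+ v R.:* g)
        R.refl f g h u v) eq)
    copP : Comaximal P (D₁ R.* Q R.+ D₂ R.* P)
    copP = shift D₂ (cop-* cop₁ P⊥Q)
    copQ : Comaximal Q (D₁ R.* Q R.+ D₂ R.* P)
    copQ = cop-respʳ (R.+-comm _ _) (shift D₁ (cop-* cop₂ (cop-sym P⊥Q)))

  divides-resp : ∀ {P Q x} → P R.≈ Q → Divides P x → Divides Q x
  divides-resp P≈Q (divides cop eq) = divides (cop-sym (cop-respʳ P≈Q (cop-sym cop))) (trans eq (*-congʳ (ι-cong P≈Q)))

  -- The alternative `f i ≈ 1` covers the indices that do not divide n, so the product may run over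
  -- a full range.
  divides-∏ : ∀ m {P x f} → Divides P x →
    (∀ {i} → i ℕ.< m → f i R.≈ R.1# ⊎ Comaximal P (f i) × Divides (f i) x) →
    (∀ {i j} → i ℕ.< j → j ℕ.< m → Comaximal (f i) (f j)) → Divides (P R.* R.∏ m f) x
  divides-∏ zero    P∣x _ _ = divides-resp (R.sym (R.*-identityʳ _)) P∣x
  divides-∏ (suc m) {P} {x} {f} P∣x f∣x f⊥f with f∣x {m} ℕ.≤-refl
  ... | inj₁ f≈1 = divides-resp (R.*-congˡ (R.sym (R.trans (R.*-congˡ f≈1) (R.*-identityʳ _)))) previous
    where previous = divides-∏ m {f = f} P∣x (λ i<m → f∣x (ℕ.m≤n⇒m≤1+n i<m)) (λ i<j j<m → f⊥f i<j (ℕ.m≤n⇒m≤1+n j<m))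
  ... | inj₂ (P⊥f , fm∣x) = divides-resp (R.*-assoc P (R.∏ m f) (f m))
      (divides-product (cop-sym (cop-* (cop-sym P⊥f) (cop-∏ m λ i<m → cop-sym (f⊥f i<m ℕ.≤-refl)))) previous fm∣x)
    where previous = divides-∏ m {f = f} P∣x (λ i<m → f∣x (ℕ.m≤n⇒m≤1+n i<m)) (λ i<j j<m → f⊥f i<j (ℕ.m≤n⇒m≤1+n j<m))

  module At (P : R.Carrier) where

    -- Valuation at least e at P, with the denominator cleared; `Order 0` is the local ring at P.
    record Order (e : ℕ) (x : Carrier) : Set where
      constructor order
      field
        {D M} : R.Carrier
        cop   : Comaximal P D
        eq    : ι D * x ≈ ι (P R.^ e) * ι M

    order⇒divides : ∀ {e x} → Order e x → Divides (P R.^ e) x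
    order⇒divides {e} (order cop eq) = divides (cop-sym (cop-^ e (cop-sym cop))) eq

    order-ι : ∀ e M → Order e (ι (P R.^ e) * ι M)
    order-ι e M = order {D = R.1#} {M = M} cop-1 (trans (*-congʳ ι-1#) (*-identityˡ _))

    integral-ι : ∀ f → Order 0 (ι f)
    integral-ι f = order {D = R.1#} {M = f} cop-1 (*-congʳ refl)

    integral-inverse : ∀ {f y} → Comaximal P f → ι f * y ≈ 1# → Order 0 y
    integral-inverse {f} {y} cop eq = order {D = f} {M = R.1#} cop (trans eq (sym (trans (*-cong ι-1# ι-1#) (*-identityˡ 1#))))

    order-+ : ∀ {e x y} → Order e x → Order e y → Order e (x + y)
    order-+ {e} {x} {y} (order {D₁} {M₁} cop₁ eq₁) (order {D₂} {M₂} cop₂ eq₂) =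
      order {D = D₁ R.* D₂} {M = D₂ R.* M₁ R.+ D₁ R.* M₂} (cop-* cop₁ cop₂) (begin
        ι (D₁ R.* D₂) * (x + y)
          ≈⟨ *-congʳ (ι-* D₁ D₂) ⟩
        ι D₁ * ι D₂ * (x + y)
          ≈⟨ solve 4 (λ d e x y → d :* e :* (x :+ y) := e :* (d :* x) :+ d :* (e :* y)) refl (ι D₁) (ι D₂) x y ⟩
        ι D₂ * (ι D₁ * x) + ι D₁ * (ι D₂ * y)
          ≈⟨ +-cong (*-congˡ eq₁) (*-congˡ eq₂) ⟩
        ι D₂ * (p * ι M₁) + ι D₁ * (p * ι M₂)
          ≈⟨ solve 5 (λ d e p m n → e :* (p :* m) :+ d :* (p :* n) := p :* (e :* m :+ d :* n)) refl (ι D₁) (ι D₂) p (ι M₁) (ι M₂) ⟩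
        p * (ι D₂ * ι M₁ + ι D₁ * ι M₂)
          ≈⟨ *-congˡ (trans (ι-+ _ _) (+-cong (ι-* D₂ M₁) (ι-* D₁ M₂))) ⟨
        p * ι (D₂ R.* M₁ R.+ D₁ R.* M₂) ∎)
      where p = ι (P R.^ e)

    order-* : ∀ {a b x y} → Order a x → Order b y → Order (a ℕ.+ b) (x * y)
    order-* {a} {b} {x} {y} (order {D₁} {M₁} cop₁ eq₁) (order {D₂} {M₂} cop₂ eq₂) =
      order {D = D₁ R.* D₂} {M = M₁ R.* M₂} (cop-* cop₁ cop₂) (begin
        ι (D₁ R.* D₂) * (x * y)
          ≈⟨ *-congʳ (ι-* D₁ D₂) ⟩
        ι D₁ * ι D₂ * (x * y)
          ≈⟨ solve 4 (λ d e x y → d :* e :* (x :* y) := (d :* x) :* (e :* y)) refl (ι D₁) (ι D₂) x y ⟩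
        (ι D₁ * x) * (ι D₂ * y)
          ≈⟨ *-cong eq₁ eq₂ ⟩
        (ι (P R.^ a) * ι M₁) * (ι (P R.^ b) * ι M₂)
          ≈⟨ solve 4 (λ p m r n → (p :* m) :* (r :* n) := (p :* r) :* (m :* n)) refl (ι (P R.^ a)) (ι M₁) (ι (P R.^ b)) (ι M₂) ⟩
        (ι (P R.^ a) * ι (P R.^ b)) * (ι M₁ * ι M₂)
          ≈⟨ *-cong (trans (ι-cong (R.^-homo-* P a b)) (ι-* (P R.^ a) (P R.^ b))) (ι-* M₁ M₂) ⟨
        ι (P R.^ (a ℕ.+ b)) * ι (M₁ R.* M₂) ∎)

    order-filtration : Filtration K
    order-filtration = record
      { I        = Order
      ; I-resp   = λ { x≈y (order cop eq) → order cop (trans (*-congˡ (sym x≈y)) eq) }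
      ; I-0#     = λ e → order {D = R.1#} {M = R.0#} cop-1 (trans (zeroʳ _) (sym (trans (*-congˡ ι-0#) (zeroʳ _))))
      ; I-1#     = order {D = R.1#} {M = R.1#} cop-1 (*-congˡ (sym ι-1#))
      ; I-+      = order-+
      ; I-neg    = λ { {e} {x} (order {D} {M} cop eq) → order {D = D} {M = R.- M} cop (begin
          ι D * - x  ≈⟨ solve 2 (λ d x → d :* (:- x) := :- (d :* x)) refl (ι D) x ⟩
          - (ι D * x)  ≈⟨ -‿cong eq ⟩
          - (ι (P R.^ e) * ι M)  ≈⟨ solve 2 (λ d x → :- (d :* x) := d :* (:- x)) refl (ι (P R.^ e)) (ι M) ⟩
          ι (P R.^ e) * - ι M  ≈⟨ *-congˡ (ι-neg M) ⟨
          ι (P R.^ e) * ι (R.- M)  ∎) }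
      ; I-*      = order-*
      ; I-weaken = λ { {e} {x} (order {D} {M} cop eq) → order {D = D} {M = P R.* M} cop (begin
          ι D * x  ≈⟨ eq ⟩
          ι (P R.* P R.^ e) * ι M  ≈⟨ *-congʳ (ι-* P (P R.^ e)) ⟩
          (ι P * ι (P R.^ e)) * ι M  ≈⟨ solve 3 (λ p r m → (p :* r) :* m := r :* (p :* m)) refl (ι P) (ι (P R.^ e)) (ι M) ⟩
          ι (P R.^ e) * (ι P * ι M)  ≈⟨ *-congˡ (ι-* P M) ⟨
          ι (P R.^ e) * ι (P R.* M)  ∎) }
      }

-- The terminating very-well-poised ₆φ₅ sum

module SixPhiFive (K : CommutativeRing 0ℓ 0ℓ) where
  open RingKit K

  module _ (q p C D : Carrier) (CD≈1 : C * D ≈ 1#) (A⁻¹ B⁻¹ G⁻¹ : ℕ → Carrier)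
    (A-inverse : ∀ i → (1# - p ^ suc i) * A⁻¹ i ≈ 1#)
    (B-inverse : ∀ i → (1# - q * p ^ suc i * D) * B⁻¹ i ≈ 1#)
    (G-inverse : ∀ m → (1# - q * p ^ m) * G⁻¹ m ≈ 1#) where

    -- D stands for 1 / C, and the numerator p^N − p^i for 1 − p^{i−N}: no negative power of p occurs.
    factor : ℕ → ℕ → Carrier
    factor N i = (1# - q * p ^ i) * (1# - q * p ^ i) * (1# - C * p ^ i) * ((p ^ N - p ^ i) * p * D)
      * (A⁻¹ i * A⁻¹ i * B⁻¹ i * G⁻¹ (suc N ℕ.+ i))

    -- This is 1 - q times the very-well-poised ₆φ₅ in base p with a = b = q, c = C, d = p^(-N) and
    -- argument p^(N+1) / C.
    sixφfive : ℕ → Carrier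
    sixφfive N = ∑ (suc N) (λ k → (1# - q * (p ^ k * p ^ k)) * ∏ k (factor N))

    private
      -- The common part of the k-th terms of sixφfive N and sixφfive (N + 1).
      common : ℕ → ℕ → Carrier
      common N i = (1# - q * p ^ i) * (1# - q * p ^ i) * (1# - C * p ^ i) * ((p ^ suc N - p ^ i) * D)
        * (A⁻¹ i * A⁻¹ i * B⁻¹ i * G⁻¹ (suc N ℕ.+ i))

      τ v : ℕ → ℕ → Carrier
      τ N k = ∏ k (factor N)
      v N k = ∏ k (common N)

      -- The quotient of `factor N i` by `common N i` is (p^(N+1) - p^(i+1)) / (p^(N+1) - p^i),
      -- which telescopes. The cross-multiplied form stays valid at k = N + 1, where the last factor
      -- is zero.
      τ-v : ∀ N k → τ N k * (p ^ suc N - 1#) ≈ v N k * (p ^ suc N - p ^ k)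
      τ-v N zero    = refl
      τ-v N (suc k) = begin
        τ N k * factor N k * (w - 1#)  ≈⟨ solve 3 (λ a b c → a :* b :* c := a :* c :* b) refl (τ N k) (factor N k) (w - 1#) ⟩
        τ N k * (w - 1#) * factor N k  ≈⟨ *-congʳ (τ-v N k) ⟩
        v N k * (w - y) * factor N k  ≈⟨ solve 8 (λ v x y p D q C r →
          v :* (p :* x :- y) :* ((one :- q :* y) :* (one :- q :* y) :* (one :- C :* y) :* ((x :- y) :* p :* D) :* r)
          := v :* ((one :- q :* y) :* (one :- q :* y) :* (one :- C :* y) :* ((p :* x :- y) :* D) :* r) :* (p :* x :- p :* y))
          refl (v N k) (p ^ N) y p D q C (A⁻¹ k * A⁻¹ k * B⁻¹ k * G⁻¹ (suc N ℕ.+ k)) ⟩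
        v N k * common N k * (w - p * y)  ∎
        where
        w = p ^ suc N
        y = p ^ k

      G-inverse′ : ∀ N k → (1# - q * (p ^ suc N * p ^ k)) * G⁻¹ (suc N ℕ.+ k) ≈ 1#
      G-inverse′ N k = trans (*-congʳ (+-congˡ (-‿cong (*-congˡ (sym (^-homo-* p (suc N) k)))))) (G-inverse (suc N ℕ.+ k))

      -- Here the quotient of factors is p (1 - q p^(N+1+i)) / (1 - q p^(N+2+i)); it telescopes as
      -- well, the shift in `G⁻¹` cancelling against the neighbouring factor.
      τ′-v : ∀ N k → τ (suc N) k * (1# - q * (p ^ suc N * p ^ k)) ≈ v N k * (p ^ k * (1# - q * p ^ suc N))
      τ′-v N zero    = *-congˡ (solve 2 (λ q w → one :- q :* (w :* one) := one :* (one :- q :* w)) refl q (p ^ suc N))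
      τ′-v N (suc k) = begin
        τ (suc N) k * factor (suc N) k * (1# - q * (w * (p * y)))
          ≈⟨ solve 11 (λ t w y p D q C a b g E → t :* ((one :- q :* y) :* (one :- q :* y) :* (one :- C :* y) :* ((w :- y) :* p :* D) :*
            (a :* a :* b :* g)) :* E
            := t :* ((one :- q :* y) :* (one :- q :* y) :* (one :- C :* y) :* ((w :- y) :* p :* D) :* (a :* a :* b)) :* (E :* g))
            refl (τ (suc N) k) w y p D q C (A⁻¹ k) (B⁻¹ k) (G⁻¹ (suc (suc N) ℕ.+ k)) (1# - q * (w * (p * y))) ⟩
        τ (suc N) k * X * ((1# - q * (w * (p * y))) * G⁻¹ (suc (suc N) ℕ.+ k))
          ≈⟨ *-congˡ (trans (*-congʳ (solve 4 (λ q w p y → one :- q :* (w :* (p :* y)) := one :- q :* (p :* w :* y)) refl q w p y))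
            (G-inverse′ (suc N) k)) ⟩
        τ (suc N) k * X * 1#
          ≈⟨ *-congˡ (G-inverse′ N k) ⟨
        τ (suc N) k * X * ((1# - q * (w * y)) * G⁻¹ (suc N ℕ.+ k))
          ≈⟨ solve 4 (λ t x e g → t :* x :* (e :* g) := t :* e :* (x :* g)) refl (τ (suc N) k) X (1# - q * (w * y)) (G⁻¹ (suc N ℕ.+ k)) ⟩
        τ (suc N) k * (1# - q * (w * y)) * (X * G⁻¹ (suc N ℕ.+ k))
          ≈⟨ *-congʳ (τ′-v N k) ⟩
        v N k * (y * (1# - q * w)) * (X * G⁻¹ (suc N ℕ.+ k))
          ≈⟨ solve 10 (λ v w y p D q C a b g → v :* (y :* (one :- q :* w)) :*
            (((one :- q :* y) :* (one :- q :* y) :* (one :- C :* y) :* ((w :- y) :* p :* D) :* (a :* a :* b)) :* g)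
            := v :* ((one :- q :* y) :* (one :- q :* y) :* (one :- C :* y) :* ((w :- y) :* D) :* (a :* a :* b :* g)) :*
              ((p :* y) :* (one :- q :* w)))
            refl (v N k) w y p D q C (A⁻¹ k) (B⁻¹ k) (G⁻¹ (suc N ℕ.+ k)) ⟩
        v N k * common N k * (p * y * (1# - q * w)) ∎
        where
        w = p ^ suc N
        y = p ^ k
        X = (1# - q * y) * (1# - q * y) * (1# - C * y) * ((w - y) * p * D) * (A⁻¹ k * A⁻¹ k * B⁻¹ k)

      -- The WZ mate of the terms, multiplied by p^{N+1} − 1.
      certificate : ℕ → ℕ → Carrier
      certificate N k = (1# - q * p ^ suc N) * p ^ suc N * v N k * ((1# - p ^ k) * (1# - p ^ k) * (1# - q * p ^ k * D))

      -- What remains of the WZ equation once the common product `v N k` and the inverses are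
      -- removed, with y = p^k and w = p^(N+1).
      kernel : ∀ q y w D → - ((1# - w) * (1# - w) * (1# - q * (y * y)) * y * (1# - q * w * D)) - (1# - q * (y * y)) * (w - y) *
        (1# - w * D) * (1# - q * (w * y))
         ≈ (1# - q * y) * (1# - q * y) * (D - y) * (w - y) * w - w * ((1# - y) * (1# - y)) * (1# - q * y * D) * (1# - q * (w * y))
      kernel = solve 4 (λ q y w D →
           :- ((one :- w) :* (one :- w) :* (one :- q :* (y :* y)) :* y :* (one :- q :* w :* D)) :- (one :- q :* (y :* y)) :* (w :- y) :*
             (one :- w :* D) :* (one :- q :* (w :* y))
        := (one :- q :* y) :* (one :- q :* y) :* (D :- y) :* (w :- y) :* w :- w :* ((one :- y) :* (one :- y)) :* (one :- q :* y :* D) :*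
          (one :- q :* (w :* y))) refl

      -- The polynomial part of the certificate at k + 1 is chosen to cancel the inverses in
      -- `common N k`. The relation C D = 1 enters here, turning D (1 - C y) into D - y.
      certificate-suc : ∀ N k → certificate N (suc k) ≈ (1# - q * p ^ suc N) * v N k *
        ((1# - q * p ^ k) * (1# - q * p ^ k) * (D - p ^ k) * (p ^ suc N - p ^ k) * p ^ suc N * G⁻¹ (suc N ℕ.+ k))
      certificate-suc N k = begin
        (1# - q * w) * w * (v N k * common N k) * ((1# - p * y) * (1# - p * y) * (1# - q * (p * y) * D))
          ≈⟨ solve 11 (λ v w y D q C a b g E F →
             (one :- q :* w) :* w :* (v :* ((one :- q :* y) :* (one :- q :* y) :* (one :- C :* y) :* ((w :- y) :* D) :*
               (a :* a :* b :* g))) :* (E :* E :* F)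
             := (one :- q :* w) :* v :* ((one :- q :* y) :* (one :- q :* y) :* (D :- C :* D :* y) :* (w :- y) :* w :* g) :*
               ((E :* a) :* (E :* a) :* (F :* b)))
             refl (v N k) w y D q C (A⁻¹ k) (B⁻¹ k) (G⁻¹ (suc N ℕ.+ k)) (1# - p * y) (1# - q * (p * y) * D) ⟩
        (1# - q * w) * v N k * ((1# - q * y) * (1# - q * y) * (D - C * D * y) * (w - y) * w * G⁻¹ (suc N ℕ.+ k))
          * (((1# - p * y) * A⁻¹ k) * ((1# - p * y) * A⁻¹ k) * ((1# - q * (p * y) * D) * B⁻¹ k))
          ≈⟨ *-cong (*-congˡ (*-congʳ (*-congʳ (*-congʳ (*-congˡ (+-congˡ (-‿cong (*-congʳ CD≈1))))))))
                    (*-cong (*-cong (A-inverse k) (A-inverse k)) (B-inverse k)) ⟩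
        (1# - q * w) * v N k * ((1# - q * y) * (1# - q * y) * (D - 1# * y) * (w - y) * w * G⁻¹ (suc N ℕ.+ k)) * (1# * 1# * 1#)
          ≈⟨ solve 6 (λ q w v y D g → (one :- q :* w) :* v :*
            ((one :- q :* y) :* (one :- q :* y) :* (D :- one :* y) :* (w :- y) :* w :* g) :* (one :* one :* one)
             := (one :- q :* w) :* v :* ((one :- q :* y) :* (one :- q :* y) :* (D :- y) :* (w :- y) :* w :* g)) refl q w (v N k) y D
               (G⁻¹ (suc N ℕ.+ k)) ⟩
        (1# - q * w) * v N k * ((1# - q * y) * (1# - q * y) * (D - y) * (w - y) * w * G⁻¹ (suc N ℕ.+ k)) ∎
        where
        w = p ^ suc N
        y = p ^ k

      -- The terms for N + 1 and N are weighted by the two sides of the first-order recurrence of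
      -- the closed form, which makes their difference telescope in k. The factor w - 1 clears the
      -- denominator of the certificate.
      wz-pair : ∀ N k → let w = p ^ suc N ; y = p ^ k in
        (w - 1#) * ((1# - q * (y * y)) * τ (suc N) k * ((1# - w) * (1# - q * w * D)) - (1# - q * (y * y)) * τ N k *
          ((1# - q * w) * (1# - w * D)))
        ≈ certificate N (suc k) - certificate N k
      wz-pair N k = begin
        (w - 1#) * (c * τ′ * ((1# - w) * (1# - q * w * D)) - c * t * ((1# - q * w) * (1# - w * D)))
          ≈⟨ solve 6 (λ w c s t q D → (w :- one) :* (c :* s :* ((one :- w) :* (one :- q :* w :* D)) :- c :* t :*
            ((one :- q :* w) :* (one :- w :* D)))
               := :- (s :* one :* (c :* ((one :- w) :* (one :- w) :* (one :- q :* w :* D)))) :- (t :* (w :- one)) :*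
                 (c :* ((one :- q :* w) :* (one :- w :* D))) :* one)
               refl w c τ′ t q D ⟩
        - (τ′ * 1# * (c * ((1# - w) * (1# - w) * (1# - q * w * D)))) - (t * (w - 1#)) * (c * ((1# - q * w) * (1# - w * D))) * 1#
          ≈⟨ +-cong (-‿cong (*-congʳ (*-congˡ (sym (G-inverse′ N k))))) (-‿cong (*-cong (*-congʳ (τ-v N k)) (sym (G-inverse′ N k)))) ⟩
        - (τ′ * (e * g) * (c * ((1# - w) * (1# - w) * (1# - q * w * D)))) - (u * (w - y)) * (c * ((1# - q * w) * (1# - w * D))) * (e * g)
          ≈⟨ +-congʳ (-‿cong (trans (solve 4 (λ s e g z → s :* (e :* g) :* z := (s :* e) :* (g :* z)) refl τ′ e g
            (c * ((1# - w) * (1# - w) * (1# - q * w * D)))) (*-congʳ (τ′-v N k)))) ⟩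
        - (u * (y * (1# - q * w)) * (g * (c * ((1# - w) * (1# - w) * (1# - q * w * D))))) - (u * (w - y)) *
          (c * ((1# - q * w) * (1# - w * D))) * (e * g)
          ≈⟨ solve 8 (λ u y q w g c D e →
               :- (u :* (y :* (one :- q :* w)) :* (g :* (c :* ((one :- w) :* (one :- w) :* (one :- q :* w :* D))))) :- (u :* (w :- y))
                 :* (c :* ((one :- q :* w) :* (one :- w :* D))) :* (e :* g)
               := (one :- q :* w) :* u :* g :* (:- ((one :- w) :* (one :- w) :* c :* y :* (one :- q :* w :* D)) :- c :* (w :- y) :*
                 (one :- w :* D) :* e))
               refl u y q w g c D e ⟩
        (1# - q * w) * u * g * (- ((1# - w) * (1# - w) * c * y * (1# - q * w * D)) - c * (w - y) * (1# - w * D) * e)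
          ≈⟨ *-congˡ (kernel q y w D) ⟩
        (1# - q * w) * u * g * ((1# - q * y) * (1# - q * y) * (D - y) * (w - y) * w - w * ((1# - y) * (1# - y)) * (1# - q * y * D) * e)
          ≈⟨ solve 7 (λ u y q w g D e →
               (one :- q :* w) :* u :* g :* ((one :- q :* y) :* (one :- q :* y) :* (D :- y) :* (w :- y) :* w :- w :*
                 ((one :- y) :* (one :- y)) :* (one :- q :* y :* D) :* e)
               := (one :- q :* w) :* u :* ((one :- q :* y) :* (one :- q :* y) :* (D :- y) :* (w :- y) :* w :* g) :- (one :- q :* w) :* w
                 :* u :* ((one :- y) :* (one :- y) :* (one :- q :* y :* D)) :* (e :* g))
               refl u y q w g D e ⟩
        (1# - q * w) * u * ((1# - q * y) * (1# - q * y) * (D - y) * (w - y) * w * g) - certificate N k * (e * g)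
          ≈⟨ +-cong (sym (certificate-suc N k)) (-‿cong (trans (*-congˡ (G-inverse′ N k)) (*-identityʳ _))) ⟩
        certificate N (suc k) - certificate N k ∎
        where
        w = p ^ suc N
        y = p ^ k
        c = 1# - q * (y * y)
        e = 1# - q * (w * y)
        g = G⁻¹ (suc N ℕ.+ k)
        τ′ = τ (suc N) k
        t = τ N k
        u = v N k

    sixφfive-suc : ∀ N → sixφfive (suc N) * ((1# - p ^ suc N) * (1# - q * p ^ suc N * D))
                       ≈ sixφfive N * ((1# - q * p ^ suc N) * (1# - p ^ suc N * D))
    sixφfive-suc N = begin
      S′ * α  ≈⟨ solve 2 (λ x y → x := (x :- y) :+ y) refl (S′ * α) (S * β) ⟩
      (S′ * α - S * β) + S * β  ≈⟨ +-congʳ difference ⟩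
      0# + S * β  ≈⟨ +-identityˡ _ ⟩
      S * β  ∎
      where
      w = p ^ suc N
      α = (1# - w) * (1# - q * w * D)
      β = (1# - q * w) * (1# - w * D)
      S′ = sixφfive (suc N)
      S = sixφfive N
      c : ℕ → Carrier
      c k = 1# - q * (p ^ k * p ^ k)
      -- The factor p^N - p^N ends the series for N, so both sums may run to N + 1.
      last-term : c (suc N) * τ N (suc N) ≈ 0#
      last-term = solve 7 (λ c t f x p D r → c :* (t :* (f :* ((x :- x) :* p :* D) :* r)) := con (+ 0)) refl
        (c (suc N)) (τ N N) ((1# - q * p ^ N) * (1# - q * p ^ N) * (1# - C * p ^ N)) (p ^ N) p D (A⁻¹ N * A⁻¹ N * B⁻¹ N * G⁻¹ (suc N ℕ.+ N))
      -- The upper end vanishes through w - w in the last `common` factor, the lower end through (1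
      -- - p^0)².
      boundary : certificate N (suc (suc N)) - certificate N 0 ≈ 0#
      boundary = solve 8 (λ q w v f D r E F → (one :- q :* w) :* w :* (v :* (f :* ((w :- w) :* D) :* r)) :* E :- (one :- q :* w) :* w :*
        one :* ((one :- one) :* (one :- one) :* F) := con (+ 0)) refl
        q w (v N (suc N)) ((1# - q * w) * (1# - q * w) * (1# - C * w)) D (A⁻¹ (suc N) * A⁻¹ (suc N) * B⁻¹ (suc N) * G⁻¹ (suc N ℕ.+ suc N))
        ((1# - p * w) * (1# - p * w) * (1# - q * (p * w) * D)) (1# - q * 1# * D)
      termwise : (w - 1#) * (S′ * α - S * β) ≈ 0#
      termwise = begin
        (w - 1#) * (S′ * α - S * β)
          ≈⟨ *-congˡ (+-congˡ (-‿cong (*-congʳ (sym (trans (+-congˡ last-term) (+-identityʳ S)))))) ⟩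
        (w - 1#) * (S′ * α - ∑ (suc (suc N)) (λ k → c k * τ N k) * β)
          ≈⟨ ∑-linear (suc (suc N)) ⟩
        ∑ (suc (suc N)) (λ k → (w - 1#) * (c k * τ (suc N) k * α - c k * τ N k * β))
          ≈⟨ ∑-cong (suc (suc N)) (λ {k} _ → wz-pair N k) ⟩
        ∑ (suc (suc N)) (λ k → certificate N (suc k) - certificate N k)
          ≈⟨ ∑-telescope (suc (suc N)) (certificate N) ⟩
        certificate N (suc (suc N)) - certificate N 0
          ≈⟨ boundary ⟩
        0# ∎
        where
        ∑-linear : ∀ n → (w - 1#) * (∑ n (λ k → c k * τ (suc N) k) * α - ∑ n (λ k → c k * τ N k) * β)
          ≈ ∑ n (λ k → (w - 1#) * (c k * τ (suc N) k * α - c k * τ N k * β))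
        ∑-linear zero    = solve 3 (λ w a b → (w :- one) :* (con (+ 0) :* a :- con (+ 0) :* b) := con (+ 0)) refl w α β
        ∑-linear (suc n) = trans
          (solve 7 (λ w a b x y s t → (w :- one) :* ((x :+ s) :* a :- (y :+ t) :* b)
            := (w :- one) :* (x :* a :- y :* b) :+ (w :- one) :* (s :* a :- t :* b))
            refl w α β (∑ n (λ k → c k * τ (suc N) k)) (∑ n (λ k → c k * τ N k)) (c n * τ (suc N) n) (c n * τ N n))
          (+-congʳ (∑-linear n))
      difference : S′ * α - S * β ≈ 0#
      difference = begin
        S′ * α - S * β  ≈⟨ *-identityˡ _ ⟨
        1# * (S′ * α - S * β)  ≈⟨ *-congʳ (A-inverse N) ⟨
        (1# - w) * A⁻¹ N * (S′ * α - S * β)  ≈⟨ solve 3 (λ w a x → (one :- w) :* a :* x := (:- a) :* ((w :- one) :* x)) refl w (A⁻¹ N)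
          (S′ * α - S * β) ⟩
        - A⁻¹ N * ((w - 1#) * (S′ * α - S * β))  ≈⟨ *-congˡ termwise ⟩
        - A⁻¹ N * 0#  ≈⟨ zeroʳ _ ⟩
        0#  ∎

    -- The classical value (ap, ap/bc; p)_N / (ap/b, ap/c; p)_N at a = b = q and c = C, with
    -- denominators cleared and the factor 1 - q restored.
    sixφfive-sum : ∀ N → sixφfive N * ∏ N (λ j → (1# - p ^ suc j) * (1# - q * p ^ suc j * D))
                       ≈ (1# - q) * ∏ N (λ j → (1# - q * p ^ suc j) * (1# - p ^ suc j * D))
    sixφfive-sum zero = solve 1 (λ q → (con (+ 0) :+ (one :- q :* (one :* one)) :* one) :* one := (one :- q) :* one) refl q
    sixφfive-sum (suc N) = begin
      sixφfive (suc N) * (P * α)  ≈⟨ solve 3 (λ a b c → a :* (b :* c) := (a :* c) :* b) refl (sixφfive (suc N)) P α ⟩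
      sixφfive (suc N) * α * P  ≈⟨ *-congʳ (sixφfive-suc N) ⟩
      sixφfive N * β * P  ≈⟨ solve 3 (λ a b c → (a :* c) :* b := (a :* b) :* c) refl (sixφfive N) P β ⟩
      sixφfive N * P * β  ≈⟨ *-congʳ (sixφfive-sum N) ⟩
      (1# - q) * Q * β  ≈⟨ *-assoc _ _ _ ⟩
      (1# - q) * (Q * β)  ∎
      where
      w = p ^ suc N
      α = (1# - w) * (1# - q * w * D)
      β = (1# - q * w) * (1# - w * D)
      P = ∏ N (λ j → (1# - p ^ suc j) * (1# - q * p ^ suc j * D))
      Q = ∏ N (λ j → (1# - q * p ^ suc j) * (1# - p ^ suc j * D))

-- The reflection k ↦ r − k modulo Φ_d

module Reflection (A : CommutativeRing 0ℓ 0ℓ) where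
  open RingKit A

  module Reflected (Q : Carrier) (r : ℕ) (Q^[4r+1] : Q ^ (4 ℕ.* r ℕ.+ 1) ≈ 1#)
    (½ : Carrier) (½-half : (1# + 1#) * ½ ≈ 1#) (H⁻¹ : ℕ → Carrier)
    (inverse₁ : ∀ {i} → i < r → (1# - Q ^ (4 ℕ.* i ℕ.+ 1)) * H⁻¹ (4 ℕ.* i ℕ.+ 1) ≈ 1#)
    (inverse₄ : ∀ {i} → i < r → (1# - Q ^ (4 ℕ.* i ℕ.+ 4)) * H⁻¹ (4 ℕ.* i ℕ.+ 4) ≈ 1#) where

    H f b c L : ℕ → Carrier
    H m = 1# - Q ^ m
    f m = Q ^ m * (H⁻¹ m * H⁻¹ m)
    b k = ∏ k (λ i → H (4 ℕ.* i ℕ.+ 1) * H⁻¹ (4 ℕ.* i ℕ.+ 4))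
    c k = H (8 ℕ.* k ℕ.+ 1) * b k ^ 4 * Q ^ (2 ℕ.* k)
    L k = ∑ k (λ i → f (4 ℕ.* i ℕ.+ 4) - f (4 ℕ.* i ℕ.+ 1))

    private
      H-reflect : ∀ m m′ → Q ^ (m ℕ.+ m′) ≈ 1# → H m * Q ^ m′ ≈ - H m′
      H-reflect m m′ eq = begin
        (1# - Q ^ m) * Q ^ m′  ≈⟨ solve 2 (λ x y → (one :- x) :* y := y :- x :* y) refl (Q ^ m) (Q ^ m′) ⟩
        Q ^ m′ - Q ^ m * Q ^ m′  ≈⟨ +-congˡ (-‿cong (trans (sym (^-homo-* Q m m′)) eq)) ⟩
        Q ^ m′ - 1#  ≈⟨ solve 1 (λ y → y :- one := :- (one :- y)) refl (Q ^ m′) ⟩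
        - (1# - Q ^ m′)  ∎

      -- The function x / (1 - x)² is invariant under x ↦ 1/x.
      f-reflect : ∀ m m′ → Q ^ (m ℕ.+ m′) ≈ 1# → H m * H⁻¹ m ≈ 1# → H m′ * H⁻¹ m′ ≈ 1# → f m ≈ f m′
      f-reflect m m′ eq inv inv′ = begin
        x * (g * g)  ≈⟨ *-congˡ (*-cong g≈ g≈) ⟩
        x * ((- (x′ * g′)) * (- (x′ * g′)))  ≈⟨ solve 3 (λ x x′ g′ → x :* ((:- (x′ :* g′)) :* (:- (x′ :* g′)))
          := (x :* x′) :* (x′ :* (g′ :* g′))) refl x x′ g′ ⟩
        (x * x′) * (x′ * (g′ * g′))  ≈⟨ *-congʳ (trans (sym (^-homo-* Q m m′)) eq) ⟩
        1# * (x′ * (g′ * g′))  ≈⟨ *-identityˡ _ ⟩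
        x′ * (g′ * g′)  ∎
        where
        x = Q ^ m
        x′ = Q ^ m′
        g = H⁻¹ m
        g′ = H⁻¹ m′
        g≈ : g ≈ - (x′ * g′)
        g≈ = begin
          g  ≈⟨ *-identityʳ g ⟨
          g * 1#  ≈⟨ *-congˡ inv′ ⟨
          g * (H m′ * g′)  ≈⟨ solve 3 (λ g h g′ → g :* (h :* g′) := :- (g :* (:- h) :* g′)) refl g (H m′) g′ ⟩
          - (g * (- H m′) * g′)  ≈⟨ -‿cong (*-congʳ (*-congˡ (H-reflect m m′ eq))) ⟨
          - (g * (H m * x′) * g′)  ≈⟨ solve 4 (λ g h x′ g′ → :- (g :* (h :* x′) :* g′) := :- ((h :* g) :* (x′ :* g′))) refl g (H m) x′ g′ ⟩
          - ((H m * g) * (x′ * g′))  ≈⟨ -‿cong (trans (*-congʳ inv) (*-identityˡ _)) ⟩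
          - (x′ * g′)  ∎

      -- Reflection exchanges the two residue classes of exponents: 4s′ + 4 is opposite to 4s + 1,
      -- and 4s′ + 1 to 4s + 4, each pair having sum 4r + 1.
      module Step (s s′ : ℕ) (eq : suc s ℕ.+ s′ ≡ r) where
        eq′ : s ℕ.+ suc s′ ≡ r
        eq′ = ≡.trans (ℕ.+-suc s s′) eq
        s<r : s < r
        s<r = ≡.subst (s <_) eq (s≤s (ℕ.m≤m+n s s′))
        s′<r : s′ < r
        s′<r = ≡.subst (s′ <_) eq (s≤s (ℕ.m≤n+m s′ s))
        period : ∀ {m} → m ≡ 4 ℕ.* (suc s ℕ.+ s′) ℕ.+ 1 → Q ^ m ≈ 1#
        period m≡ = trans (reflexive (≡.cong (Q ^_) (≡.trans m≡ (≡.cong (λ k → 4 ℕ.* k ℕ.+ 1) eq)))) Q^[4r+1]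
        period₄₁ : Q ^ ((4 ℕ.* s′ ℕ.+ 4) ℕ.+ (4 ℕ.* s ℕ.+ 1)) ≈ 1#
        period₄₁ = period (solveℕ 2 (λ s s′ → (lit 4 ✶ s′ ⊹ lit 4) ⊹ (lit 4 ✶ s ⊹ lit 1) ≐ lit 4 ✶ ((lit 1 ⊹ s) ⊹ s′) ⊹ lit 1) ≡.refl s s′)
        period₁₄ : Q ^ ((4 ℕ.* s′ ℕ.+ 1) ℕ.+ (4 ℕ.* s ℕ.+ 4)) ≈ 1#
        period₁₄ = period (solveℕ 2 (λ s s′ → (lit 4 ✶ s′ ⊹ lit 1) ⊹ (lit 4 ✶ s ⊹ lit 4) ≐ lit 4 ✶ ((lit 1 ⊹ s) ⊹ s′) ⊹ lit 1) ≡.refl s s′)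

      -- Lowering s′ by one removes H(4s′+1) / H(4s′+4). By reflection the inverse of this quotient
      -- is H(4s+1) / H(4s+4) times Q³, the next factor of b s up to a power of Q.
      b-reflect : ∀ s s′ → s ℕ.+ s′ ≡ r → b s′ ≈ b r * b s * Q ^ (3 ℕ.* s)
      b-reflect zero    s′ ≡.refl = sym (trans (*-identityʳ _) (*-identityʳ _))
      b-reflect (suc s) s′ eq = begin
        b s′  ≈⟨ trans (*-congˡ (trans (*-cong (inverse₁ s′<r) (inverse₄ s′<r)) (*-identityˡ 1#))) (*-identityʳ _) ⟨
        b s′ * ((a′ * ga′) * (e′ * ge′))  ≈⟨ solve 5 (λ b a ga e ge → b :* ((a :* ga) :* (e :* ge)) := (b :* (a :* ge)) :* (ga :* e))
          refl (b s′) a′ ga′ e′ ge′ ⟩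
        b (suc s′) * (ga′ * e′)  ≈⟨ *-cong (b-reflect s (suc s′) eq′) ratio ⟩
        b r * b s * Q ^ (3 ℕ.* s) * (a * ge * Q ^ 3)
          ≈⟨ solve 6 (λ x y z a g w → x :* y :* z :* (a :* g :* w) := x :* (y :* (a :* g)) :* (w :* z)) refl (b r) (b s) (Q ^ (3 ℕ.* s))
            a ge (Q ^ 3) ⟩
        b r * b (suc s) * (Q ^ 3 * Q ^ (3 ℕ.* s))  ≈⟨ *-congˡ
          (trans (sym (^-homo-* Q 3 (3 ℕ.* s))) (reflexive (≡.cong (Q ^_) (≡.sym (ℕ.*-suc 3 s))))) ⟩
        b r * b (suc s) * Q ^ (3 ℕ.* suc s)  ∎
        where
        open Step s s′ eq
        a = H (4 ℕ.* s ℕ.+ 1)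
        a′ = H (4 ℕ.* s′ ℕ.+ 1)
        e = H (4 ℕ.* s ℕ.+ 4)
        e′ = H (4 ℕ.* s′ ℕ.+ 4)
        ga′ = H⁻¹ (4 ℕ.* s′ ℕ.+ 1)
        ge = H⁻¹ (4 ℕ.* s ℕ.+ 4)
        ge′ = H⁻¹ (4 ℕ.* s′ ℕ.+ 4)
        x = Q ^ (4 ℕ.* s ℕ.+ 1)
        x*Q³ : Q ^ (4 ℕ.* s ℕ.+ 4) ≈ x * Q ^ 3
        x*Q³ = trans (reflexive (≡.cong (Q ^_) (≡.sym (ℕ.+-assoc (4 ℕ.* s) 1 3)))) (^-homo-* Q (4 ℕ.* s ℕ.+ 1) 3)
        ratio : ga′ * e′ ≈ a * ge * Q ^ 3
        ratio = begin
          ga′ * e′  ≈⟨ *-identityʳ _ ⟨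
          ga′ * e′ * 1#  ≈⟨ *-congˡ (inverse₄ s<r) ⟨
          ga′ * e′ * (e * ge)  ≈⟨ solve 4 (λ g e′ e h → g :* e′ :* (e :* h) := :- (g :* e′ :* ((:- e) :* h))) refl ga′ e′ e ge ⟩
          - (ga′ * e′ * ((- e) * ge))  ≈⟨ -‿cong (*-congˡ (*-congʳ
            (trans (*-congˡ (sym x*Q³)) (H-reflect (4 ℕ.* s′ ℕ.+ 1) (4 ℕ.* s ℕ.+ 4) period₁₄)))) ⟨
          - (ga′ * e′ * (a′ * (x * Q ^ 3) * ge))  ≈⟨ solve 6 (λ g e a x z h → :- (g :* e :* (a :* (x :* z) :* h))
            := (a :* g) :* ((:- (e :* x)) :* h :* z)) refl ga′ e′ a′ x (Q ^ 3) ge ⟩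
          (a′ * ga′) * ((- (e′ * x)) * ge * Q ^ 3) ≈⟨ *-cong (inverse₁ s′<r)
            (*-congʳ (*-congʳ (-‿cong (H-reflect (4 ℕ.* s′ ℕ.+ 4) (4 ℕ.* s ℕ.+ 1) period₄₁)))) ⟩
          1# * ((- - a) * ge * Q ^ 3)  ≈⟨ solve 3 (λ a g z → one :* ((:- (:- a)) :* g :* z) := a :* g :* z) refl a ge (Q ^ 3) ⟩
          a * ge * Q ^ 3  ∎

      -- The reflection of r to 0 gives b_r² Q^(3r) = 1, and squaring produces the fourth power that
      -- occurs in the summand.
      b[r]⁴ : b r ^ 4 * Q ^ (6 ℕ.* r) ≈ 1#
      b[r]⁴ = begin
        b r ^ 4 * Q ^ (6 ℕ.* r)  ≈⟨ *-congˡ (trans (reflexive (≡.cong (Q ^_) (ℕ.*-distribʳ-+ r 3 3))) (^-homo-* Q (3 ℕ.* r) (3 ℕ.* r))) ⟩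
        b r ^ 4 * (x * x)  ≈⟨ solve 2 (λ b x → b :^ 4 :* (x :* x) := (b :* b :* x) :* (b :* b :* x)) refl (b r) x ⟩
        (b r * b r * x) * (b r * b r * x)  ≈⟨ *-cong square square ⟨
        1# * 1#  ≈⟨ *-identityˡ 1# ⟩
        1#  ∎
        where
        x = Q ^ (3 ℕ.* r)
        square : 1# ≈ b r * b r * x
        square = b-reflect r 0 (ℕ.+-identityʳ r)

      -- The sign comes from the very-well-poised factor alone: (8s + 1) + (8s′ + 1) = 2(4r + 1).
      -- The remaining powers of Q combine with b_r⁴ to 1.
      c-reflect : ∀ s s′ → s ℕ.+ s′ ≡ r → c s′ ≈ - c s
      c-reflect s s′ eq = begin
        H (8 ℕ.* s′ ℕ.+ 1) * b s′ ^ 4 * Q ^ (2 ℕ.* s′)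
          ≈⟨ *-congʳ (*-cong H≈ (^-congˡ 4 (b-reflect s s′ eq))) ⟩
        - (H (8 ℕ.* s ℕ.+ 1) * Q ^ (8 ℕ.* s′ ℕ.+ 1)) * (b r * b s * Q ^ (3 ℕ.* s)) ^ 4 * Q ^ (2 ℕ.* s′)
          ≈⟨ solve 6 (λ h x b y z w → (:- (h :* x)) :* (b :* y :* z) :^ 4 :* w := :- (h :* (y :^ 4) :* (b :^ 4) :* (x :* z :^ 4 :* w)))
               refl (H (8 ℕ.* s ℕ.+ 1)) (Q ^ (8 ℕ.* s′ ℕ.+ 1)) (b r) (b s) (Q ^ (3 ℕ.* s)) (Q ^ (2 ℕ.* s′)) ⟩
        - (H (8 ℕ.* s ℕ.+ 1) * b s ^ 4 * b r ^ 4 * (Q ^ (8 ℕ.* s′ ℕ.+ 1) * (Q ^ (3 ℕ.* s)) ^ 4 * Q ^ (2 ℕ.* s′)))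
          ≈⟨ -‿cong (*-congˡ powers) ⟩
        - (H (8 ℕ.* s ℕ.+ 1) * b s ^ 4 * b r ^ 4 * (Q ^ (2 ℕ.* s) * Q ^ (6 ℕ.* r) * 1#))
          ≈⟨ solve 5 (λ h y b z w → :- (h :* y :* b :* (z :* w :* one)) := :- (h :* y :* z :* (b :* w))) refl (H (8 ℕ.* s ℕ.+ 1))
            (b s ^ 4) (b r ^ 4) (Q ^ (2 ℕ.* s)) (Q ^ (6 ℕ.* r)) ⟩
        - (H (8 ℕ.* s ℕ.+ 1) * b s ^ 4 * Q ^ (2 ℕ.* s) * (b r ^ 4 * Q ^ (6 ℕ.* r)))
          ≈⟨ -‿cong (trans (*-congˡ b[r]⁴) (*-identityʳ _)) ⟩
        - c s ∎
        where
        Q²≈1 : Q ^ (8 ℕ.* s ℕ.+ 1 ℕ.+ (8 ℕ.* s′ ℕ.+ 1)) ≈ 1#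
        Q²≈1 = begin
          Q ^ (8 ℕ.* s ℕ.+ 1 ℕ.+ (8 ℕ.* s′ ℕ.+ 1))
            ≡⟨ ≡.cong (Q ^_) (solveℕ 2 (λ s s′ → lit 8 ✶ s ⊹ lit 1 ⊹ (lit 8 ✶ s′ ⊹ lit 1)
              ≐ (lit 4 ✶ (s ⊹ s′) ⊹ lit 1) ⊹ (lit 4 ✶ (s ⊹ s′) ⊹ lit 1)) ≡.refl s s′) ⟩
          Q ^ ((4 ℕ.* (s ℕ.+ s′) ℕ.+ 1) ℕ.+ (4 ℕ.* (s ℕ.+ s′) ℕ.+ 1))
            ≡⟨ ≡.cong (λ k → Q ^ ((4 ℕ.* k ℕ.+ 1) ℕ.+ (4 ℕ.* k ℕ.+ 1))) eq ⟩
          Q ^ ((4 ℕ.* r ℕ.+ 1) ℕ.+ (4 ℕ.* r ℕ.+ 1))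
            ≈⟨ ^-homo-* Q (4 ℕ.* r ℕ.+ 1) (4 ℕ.* r ℕ.+ 1) ⟩
          Q ^ (4 ℕ.* r ℕ.+ 1) * Q ^ (4 ℕ.* r ℕ.+ 1)
            ≈⟨ trans (*-cong Q^[4r+1] Q^[4r+1]) (*-identityˡ 1#) ⟩
          1# ∎
        H≈ : H (8 ℕ.* s′ ℕ.+ 1) ≈ - (H (8 ℕ.* s ℕ.+ 1) * Q ^ (8 ℕ.* s′ ℕ.+ 1))
        H≈ = trans (solve 1 (λ h → h := :- (:- h)) refl _) (-‿cong (sym (H-reflect (8 ℕ.* s ℕ.+ 1) (8 ℕ.* s′ ℕ.+ 1) Q²≈1)))
        powers : Q ^ (8 ℕ.* s′ ℕ.+ 1) * (Q ^ (3 ℕ.* s)) ^ 4 * Q ^ (2 ℕ.* s′) ≈ Q ^ (2 ℕ.* s) * Q ^ (6 ℕ.* r) * 1#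
        powers = begin
          Q ^ (8 ℕ.* s′ ℕ.+ 1) * (Q ^ (3 ℕ.* s)) ^ 4 * Q ^ (2 ℕ.* s′)
            ≈⟨ *-congʳ (*-congˡ (^-assocʳ Q (3 ℕ.* s) 4)) ⟩
          Q ^ (8 ℕ.* s′ ℕ.+ 1) * Q ^ (3 ℕ.* s ℕ.* 4) * Q ^ (2 ℕ.* s′)
            ≈⟨ trans (^-homo-* Q (8 ℕ.* s′ ℕ.+ 1 ℕ.+ 3 ℕ.* s ℕ.* 4) (2 ℕ.* s′)) (*-congʳ (^-homo-* Q (8 ℕ.* s′ ℕ.+ 1) (3 ℕ.* s ℕ.* 4))) ⟨
          Q ^ (8 ℕ.* s′ ℕ.+ 1 ℕ.+ 3 ℕ.* s ℕ.* 4 ℕ.+ 2 ℕ.* s′)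
            ≡⟨ ≡.cong (Q ^_) (solveℕ 2 (λ s s′ → lit 8 ✶ s′ ⊹ lit 1 ⊹ lit 3 ✶ s ✶ lit 4 ⊹ lit 2 ✶ s′
                 ≐ lit 2 ✶ s ⊹ lit 6 ✶ (s ⊹ s′) ⊹ (lit 4 ✶ (s ⊹ s′) ⊹ lit 1)) ≡.refl s s′) ⟩
          Q ^ (2 ℕ.* s ℕ.+ 6 ℕ.* (s ℕ.+ s′) ℕ.+ (4 ℕ.* (s ℕ.+ s′) ℕ.+ 1))
            ≡⟨ ≡.cong (λ k → Q ^ (2 ℕ.* s ℕ.+ 6 ℕ.* k ℕ.+ (4 ℕ.* k ℕ.+ 1))) eq ⟩
          Q ^ (2 ℕ.* s ℕ.+ 6 ℕ.* r ℕ.+ (4 ℕ.* r ℕ.+ 1))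
            ≈⟨ trans (^-homo-* Q (2 ℕ.* s ℕ.+ 6 ℕ.* r) (4 ℕ.* r ℕ.+ 1)) (*-cong (^-homo-* Q (2 ℕ.* s) (6 ℕ.* r)) Q^[4r+1]) ⟩
          Q ^ (2 ℕ.* s) * Q ^ (6 ℕ.* r) * 1# ∎

      L-reflect-const : ∀ s s′ → s ℕ.+ s′ ≡ r → L s′ ≈ L r + L s
      L-reflect-const zero    s′ ≡.refl = sym (+-identityʳ _)
      L-reflect-const (suc s) s′ eq = begin
        L s′  ≈⟨ solve 3 (λ l x y → l := (l :+ (x :- y)) :- x :+ y) refl (L s′) (f (4 ℕ.* s′ ℕ.+ 4)) (f (4 ℕ.* s′ ℕ.+ 1)) ⟩
        L (suc s′) - f (4 ℕ.* s′ ℕ.+ 4) + f (4 ℕ.* s′ ℕ.+ 1)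
          ≈⟨ +-cong (+-cong (L-reflect-const s (suc s′) eq′)
            (-‿cong (f-reflect (4 ℕ.* s′ ℕ.+ 4) (4 ℕ.* s ℕ.+ 1) period₄₁ (inverse₄ s′<r) (inverse₁ s<r))))
            (f-reflect (4 ℕ.* s′ ℕ.+ 1) (4 ℕ.* s ℕ.+ 4) period₁₄ (inverse₁ s′<r) (inverse₄ s<r)) ⟩
        L r + L s - f (4 ℕ.* s ℕ.+ 1) + f (4 ℕ.* s ℕ.+ 4)
          ≈⟨ solve 4 (λ l m x y → l :+ m :- x :+ y := l :+ (m :+ (y :- x))) refl (L r) (L s) (f (4 ℕ.* s ℕ.+ 1)) (f (4 ℕ.* s ℕ.+ 4)) ⟩
        L r + L (suc s) ∎
        where open Step s s′ eq

      halve : ∀ {x} → x ≈ - x → x ≈ 0#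
      halve {x} x≈-x = begin
        x  ≈⟨ *-identityˡ x ⟨
        1# * x  ≈⟨ *-congʳ ½-half ⟨
        (1# + 1#) * ½ * x  ≈⟨ solve 2 (λ h x → (one :+ one) :* h :* x := h :* (x :+ x)) refl ½ x ⟩
        ½ * (x + x)  ≈⟨ *-congˡ (trans (+-congˡ x≈-x) (-‿inverseʳ x)) ⟩
        ½ * 0#  ≈⟨ zeroʳ ½ ⟩
        0#  ∎

      L-reflect : ∀ s s′ → s ℕ.+ s′ ≡ r → L s′ ≈ L s
      L-reflect s s′ eq = trans (L-reflect-const s s′ eq) (trans (+-congʳ Lr≈0) (+-identityˡ _))
        where
        -- The pair s = r, s′ = 0 says 0 = L r + L r.
        Lr≈0 : L r ≈ 0#
        Lr≈0 = halve (trans (solve 1 (λ l → l := (l :+ l) :- l) refl (L r))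
          (trans (+-congʳ (sym (L-reflect-const r 0 (ℕ.+-identityʳ r)))) (+-identityˡ _)))

      odd-sum : ∀ F → (∀ s s′ → s ℕ.+ s′ ≡ r → F s′ ≈ - F s) → ∑ (suc r) F ≈ 0#
      odd-sum F odd = halve (trans
        (∑-reverse (suc r) λ i j eq → odd j i (≡.trans (ℕ.+-comm j i) (ℕ.suc-injective eq)))
        (∑-neg (suc r)))
        where
        ∑-neg : ∀ n → ∑ n (λ i → - F i) ≈ - ∑ n F
        ∑-neg zero    = solve 0 (con (+ 0) := :- con (+ 0)) refl
        ∑-neg (suc n) = trans (+-congʳ (∑-neg n)) (solve 2 (λ x y → (:- x) :- y := :- (x :+ y)) refl _ _)

    ∑c≈0 : ∑ (suc r) c ≈ 0#
    ∑c≈0 = odd-sum c c-reflect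

    ∑cL≈0 : ∑ (suc r) (λ k → c k * L k) ≈ 0#
    ∑cL≈0 = odd-sum (λ k → c k * L k) λ s s′ eq → trans (*-cong (c-reflect s s′ eq) (L-reflect s s′ eq))
      (solve 2 (λ x y → (:- x) :* y := :- (x :* y)) refl (c s) (L s))

-- H⁻¹ 0 is arbitrary.
record QBase (K : CommutativeRing 0ℓ 0ℓ) : Set where
  open RingKit K
  field
    q q⁻¹     : Carrier
    q-inverse : q * q⁻¹ ≈ 1#
    H⁻¹       : ℕ → Carrier
    H-inverse : ∀ m → (1# - q ^ suc m) * H⁻¹ (suc m) ≈ 1#

  H : ℕ → Carrier
  H m = 1# - q ^ m

  H-inverse′ : ∀ {m} → 0 < m → H m * H⁻¹ m ≈ 1#
  H-inverse′ {suc m} _ = H-inverse m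

-- The summands and their deformation as q-series

module QSeries {K : CommutativeRing 0ℓ 0ℓ} (base : QBase K) where
  open RingKit K
  open QBase base

  q^-inverse : ∀ m → q ^ m * q⁻¹ ^ m ≈ 1#
  q^-inverse zero    = *-identityˡ 1#
  q^-inverse (suc m) = begin
    q * q ^ m * (q⁻¹ * q⁻¹ ^ m)  ≈⟨ solve 4 (λ a b c d → a :* b :* (c :* d) := (a :* c) :* (b :* d)) refl q (q ^ m) q⁻¹ (q⁻¹ ^ m) ⟩
    (q * q⁻¹) * (q ^ m * q⁻¹ ^ m)  ≈⟨ *-cong q-inverse (q^-inverse m) ⟩
    1# * 1#  ≈⟨ *-identityˡ 1# ⟩
    1#  ∎

  q^-split : ∀ {m} a b → m ≡ a ℕ.+ b → q ^ m ≈ q ^ a * q ^ b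
  q^-split a b ≡.refl = ^-homo-* q a b

  q⁻¹^-split : ∀ {m} a b → m ≡ a ℕ.+ b → q⁻¹ ^ m ≈ q⁻¹ ^ a * q⁻¹ ^ b
  q⁻¹^-split a b ≡.refl = ^-homo-* q⁻¹ a b

  cancel-positive : ∀ {m} a b → m ≡ a ℕ.+ b → q ^ m * q⁻¹ ^ b ≈ q ^ a
  cancel-positive a b eq = trans (*-congʳ (q^-split a b eq)) (trans (*-assoc _ _ _) (trans (*-congˡ (q^-inverse b)) (*-identityʳ _)))

  cancel-negative : ∀ {m} a b → m ≡ a ℕ.+ b → q ^ b * q⁻¹ ^ m ≈ q⁻¹ ^ a
  cancel-negative a b eq = trans (*-congˡ (q⁻¹^-split a b eq))
    (trans (solve 3 (λ x y z → x :* (y :* z) := y :* (x :* z)) refl _ _ _) (trans (*-congˡ (q^-inverse b)) (*-identityʳ _)))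

  H-negate : ∀ m → 1# - q⁻¹ ^ m ≈ - (q⁻¹ ^ m * H m)
  H-negate m = sym (begin
    - (q⁻¹ ^ m * (1# - q ^ m))  ≈⟨ solve 2 (λ x y → :- (x :* (one :- y)) := y :* x :- x) refl (q⁻¹ ^ m) (q ^ m) ⟩
    q ^ m * q⁻¹ ^ m - q⁻¹ ^ m  ≈⟨ +-congʳ (q^-inverse m) ⟩
    1# - q⁻¹ ^ m  ∎)

  H-negate-inverse : ∀ {m} → 0 < m → (1# - q⁻¹ ^ m) * - (q ^ m * H⁻¹ m) ≈ 1#
  H-negate-inverse {m} 0<m = begin
    (1# - q⁻¹ ^ m) * - (q ^ m * H⁻¹ m)  ≈⟨ *-congʳ (H-negate m) ⟩
    - (q⁻¹ ^ m * H m) * - (q ^ m * H⁻¹ m)  ≈⟨ solve 4 (λ x h y g → (:- (x :* h)) :* (:- (y :* g)) := (y :* x) :* (h :* g)) refl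
      (q⁻¹ ^ m) (H m) (q ^ m) (H⁻¹ m) ⟩
    (q ^ m * q⁻¹ ^ m) * (H m * H⁻¹ m)  ≈⟨ *-cong (q^-inverse m) (H-inverse′ 0<m) ⟩
    1# * 1#  ≈⟨ *-identityˡ 1# ⟩
    1#  ∎

  p^ : ∀ i → (q ^ 4) ^ i ≈ q ^ (4 ℕ.* i)
  p^ = ^-assocʳ q 4

  qp^ : ∀ i → q * (q ^ 4) ^ i ≈ q ^ (4 ℕ.* i ℕ.+ 1)
  qp^ i = trans (*-congˡ (p^ i)) (reflexive (≡.cong (q ^_) (ℕ.+-comm 1 (4 ℕ.* i))))

  p^suc : ∀ i → (q ^ 4) ^ suc i ≈ q ^ (4 ℕ.* i ℕ.+ 4)
  p^suc i = trans (p^ (suc i)) (reflexive (≡.cong (q ^_) (≡.trans (ℕ.*-suc 4 i) (ℕ.+-comm 4 (4 ℕ.* i)))))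

  -- (q^a; q⁴)_k / (q⁴; q⁴)_k
  B : ℕ → ℕ → Carrier
  B a k = ∏ k (λ i → H (4 ℕ.* i ℕ.+ a) * H⁻¹ (4 ℕ.* i ℕ.+ 4))

  -- c k is 1 − q times the k-th summand.
  c f L : ℕ → Carrier
  c k = H (8 ℕ.* k ℕ.+ 1) * B 1 k ^ 4 * q ^ (2 ℕ.* k)
  f m = q ^ m * (H⁻¹ m * H⁻¹ m)
  L k = ∑ k (λ i → f (4 ℕ.* i ℕ.+ 4) - f (4 ℕ.* i ℕ.+ 1))

  -- The parameter C = q^{1+n}, that is, a = q^n in the two-parameter family (aq, q/a; q⁴)_k.
  module Deformed (N : ℕ) where
    n : ℕ
    n = 4 ℕ.* N ℕ.+ 1

    C D : Carrier
    C = q ^ (4 ℕ.* N ℕ.+ 2)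
    D = q⁻¹ ^ (4 ℕ.* N ℕ.+ 2)

    qpD : ∀ i → q * (q ^ 4) ^ suc i * D ≈ q ^ (4 ℕ.* i ℕ.+ 4) * q⁻¹ ^ n
    qpD i = begin
      q * (q ^ 4) ^ suc i * D  ≈⟨ *-cong (*-congˡ (p^suc i)) (q⁻¹^-split n 1 (≡.sym (ℕ.+-assoc (4 ℕ.* N) 1 1))) ⟩
      q * q ^ (4 ℕ.* i ℕ.+ 4) * (q⁻¹ ^ n * q⁻¹ ^ 1)  ≈⟨ solve 4 (λ q x y q′ → q :* x :* (y :* (q′ :* one)) := (q :* q′) :* (x :* y))
        refl q _ _ q⁻¹ ⟩
      (q * q⁻¹) * (q ^ (4 ℕ.* i ℕ.+ 4) * q⁻¹ ^ n)  ≈⟨ trans (*-congʳ q-inverse) (*-identityˡ _) ⟩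
      q ^ (4 ℕ.* i ℕ.+ 4) * q⁻¹ ^ n  ∎

    below : ∀ {i} → i < N → n ≡ 4 ℕ.* (N ∸ suc i) ℕ.+ 1 ℕ.+ (4 ℕ.* i ℕ.+ 4)
    below {i} i<N = ≡.trans (≡.cong (λ k → 4 ℕ.* k ℕ.+ 1) (≡.sym (ℕ.m∸n+n≡m i<N)))
      (solveℕ 2 (λ x i → lit 4 ✶ (x ⊹ (lit 1 ⊹ i)) ⊹ lit 1 ≐ lit 4 ✶ x ⊹ lit 1 ⊹ (lit 4 ✶ i ⊹ lit 4)) ≡.refl (N ∸ suc i) i)

    above : ∀ {i} → N ≤ i → 4 ℕ.* i ℕ.+ 4 ≡ 4 ℕ.* (i ∸ N) ℕ.+ 3 ℕ.+ n
    above {i} N≤i = ≡.trans (≡.cong (λ k → 4 ℕ.* k ℕ.+ 4) (≡.sym (ℕ.m∸n+n≡m N≤i)))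
      (solveℕ 2 (λ x N → lit 4 ✶ (x ⊹ N) ⊹ lit 4 ≐ lit 4 ✶ x ⊹ lit 3 ⊹ (lit 4 ✶ N ⊹ lit 1)) ≡.refl (i ∸ N) N)

    -- Inverse of 1 - q^(4i+4-n). Because n ≡ 1 modulo 4 the exponent is never 0; it is negative
    -- exactly for i < N, where a power of q and a sign are split off.
    B⁻¹ : ℕ → Carrier
    B⁻¹ i with i ℕ.<? N
    ... | yes _ = let m = 4 ℕ.* (N ∸ suc i) ℕ.+ 1 in - (q ^ m * H⁻¹ m)
    ... | no  _ = H⁻¹ (4 ℕ.* (i ∸ N) ℕ.+ 3)

    B⁻¹-below : ∀ {i} → i < N → B⁻¹ i ≡ - (q ^ (4 ℕ.* (N ∸ suc i) ℕ.+ 1) * H⁻¹ (4 ℕ.* (N ∸ suc i) ℕ.+ 1))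
    B⁻¹-below {i} i<N with i ℕ.<? N
    ... | yes _   = ≡.refl
    ... | no  i≮N with () ← i≮N i<N

    B-inverse : ∀ i → (1# - q * (q ^ 4) ^ suc i * D) * B⁻¹ i ≈ 1#
    B-inverse i = trans (*-congʳ (+-congˡ (-‿cong (qpD i)))) inverse
      where
      inverse : (1# - q ^ (4 ℕ.* i ℕ.+ 4) * q⁻¹ ^ n) * B⁻¹ i ≈ 1#
      inverse with i ℕ.<? N
      ... | yes i<N = trans (*-congʳ (+-congˡ (-‿cong (cancel-negative (4 ℕ.* (N ∸ suc i) ℕ.+ 1) (4 ℕ.* i ℕ.+ 4) (below i<N)))))
        (H-negate-inverse (ℕ.m≤n+m 1 _))
      ... | no  i≮N = trans (*-congʳ (+-congˡ (-‿cong (cancel-positive (4 ℕ.* (i ∸ N) ℕ.+ 3) n (above (ℕ.≮⇒≥ i≮N))))))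
        (H-inverse′ (ℕ.≤-trans (s≤s z≤n) (ℕ.m≤n+m 3 _)))

    A⁻¹ G⁻¹ : ℕ → Carrier
    A⁻¹ i = H⁻¹ (4 ℕ.* i ℕ.+ 4)
    G⁻¹ m = H⁻¹ (4 ℕ.* m ℕ.+ 1)

    A-inverse : ∀ i → (1# - (q ^ 4) ^ suc i) * A⁻¹ i ≈ 1#
    A-inverse i = trans (*-congʳ (+-congˡ (-‿cong (p^suc i)))) (H-inverse′ (ℕ.≤-trans (s≤s z≤n) (ℕ.m≤n+m 4 _)))

    G-inverse : ∀ m → (1# - q * (q ^ 4) ^ m) * G⁻¹ m ≈ 1#
    G-inverse m = trans (*-congʳ (+-congˡ (-‿cong (qp^ m)))) (H-inverse′ (ℕ.m≤n+m 1 _))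

    open SixPhiFive K

    -- The recurrence behind `sixφfive-sum` changes the truncation while C stays fixed. Only at
    -- `S N` are the two tied together by C = q^(1+n).
    φ S : ℕ → Carrier
    φ = factor q (q ^ 4) C D (q^-inverse (4 ℕ.* N ℕ.+ 2)) A⁻¹ B⁻¹ G⁻¹ A-inverse B-inverse G-inverse N
    S k = sixφfive q (q ^ 4) C D (q^-inverse (4 ℕ.* N ℕ.+ 2)) A⁻¹ B⁻¹ G⁻¹ A-inverse B-inverse G-inverse k

    -- Reversed, the factors 1 - q p^(j+1) D and 1 - p^(j+1) D become 1 - q^(-(4i+1)) and 1 -
    -- q^(-(4i+2)). The former cancel the numerators 1 - q^(4i+1) with i < N up to powers of q, the
    -- one with i = N survives as H n, and each i leaves a factor 1/q.
    S-closed : S N ≈ H n * B 2 N * q⁻¹ ^ N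
    S-closed = begin
      S N
        ≈⟨ trans (*-congˡ (∏-one N λ {i} _ → cancelled i)) (*-identityʳ _) ⟨
      S N * ∏ N (λ i → (E i * e i) * (A⁻¹ i * e⁻¹ i))
        ≈⟨ *-congˡ (∏-* N _ _) ⟩
      S N * (∏ N (λ i → E i * e i) * M)
        ≈⟨ *-assoc _ _ _ ⟨
      S N * ∏ N (λ i → E i * e i) * M
        ≈⟨ *-congʳ (*-congˡ (trans (∏-* N _ _) (trans (*-congˡ (∏-reverse N e-reverse)) (sym (∏-* N _ _))))) ⟩
      S N * ∏ N (λ j → (1# - p ^ suc j) * (1# - q * p ^ suc j * D)) * M
        ≈⟨ *-congʳ (sixφfive-sum q (q ^ 4) C D (q^-inverse (4 ℕ.* N ℕ.+ 2)) A⁻¹ B⁻¹ G⁻¹ A-inverse B-inverse G-inverse N) ⟩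
      (1# - q) * ∏ N (λ j → (1# - q * p ^ suc j) * (1# - p ^ suc j * D)) * M
        ≈⟨ *-congʳ (trans (*-congˡ (∏-* N _ _)) (trans (sym (*-assoc _ _ _)) (*-cong numerators (∏-reverse N g-reverse)))) ⟩
      (∏ N a * H n) * ∏ N g * M
        ≈⟨ solve 4 (λ a h g m → (a :* h) :* g :* m := h :* (a :* (g :* m))) refl (∏ N a) (H n) (∏ N g) M ⟩
      H n * (∏ N a * (∏ N g * M))
        ≈⟨ *-congˡ (trans (*-congˡ (sym (∏-* N _ _))) (sym (∏-* N _ _))) ⟩
      H n * ∏ N (λ i → a i * (g i * (A⁻¹ i * e⁻¹ i)))
        ≈⟨ *-congˡ (trans (∏-cong N λ {i} _ → combined i) (trans (∏-* N _ _) (*-congˡ (∏-const N)))) ⟩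
      H n * (B 2 N * q⁻¹ ^ N)
        ≈⟨ *-assoc _ _ _ ⟨
      H n * B 2 N * q⁻¹ ^ N ∎
      where
      p = q ^ 4
      a E e e⁻¹ g : ℕ → Carrier
      a i = H (4 ℕ.* i ℕ.+ 1)
      E i = 1# - p ^ suc i
      e i = - (q⁻¹ ^ (4 ℕ.* i ℕ.+ 1) * H (4 ℕ.* i ℕ.+ 1))
      e⁻¹ i = - (q ^ (4 ℕ.* i ℕ.+ 1) * H⁻¹ (4 ℕ.* i ℕ.+ 1))
      g i = - (q⁻¹ ^ (4 ℕ.* i ℕ.+ 2) * H (4 ℕ.* i ℕ.+ 2))
      M = ∏ N (λ i → A⁻¹ i * e⁻¹ i)

      cancelled : ∀ i → (E i * e i) * (A⁻¹ i * e⁻¹ i) ≈ 1#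
      cancelled i = begin
        (E i * e i) * (A⁻¹ i * e⁻¹ i)  ≈⟨ solve 4 (λ x y z w → (x :* y) :* (z :* w) := (x :* z) :* (y :* w)) refl (E i) (e i) (A⁻¹ i)
          (e⁻¹ i) ⟩
        (E i * A⁻¹ i) * (e i * e⁻¹ i)  ≈⟨ *-cong (A-inverse i)
          (trans (*-congʳ (sym (H-negate (4 ℕ.* i ℕ.+ 1)))) (H-negate-inverse (ℕ.m≤n+m 1 _))) ⟩
        1# * 1#  ≈⟨ *-identityˡ 1# ⟩
        1#  ∎

      e-reverse : ∀ i j → suc (i ℕ.+ j) ≡ N → e i ≈ 1# - q * p ^ suc j * D
      e-reverse i j eq = sym (begin
        1# - q * p ^ suc j * D  ≈⟨ +-congˡ (-‿cong (qpD j)) ⟩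
        1# - q ^ (4 ℕ.* j ℕ.+ 4) * q⁻¹ ^ n  ≈⟨ +-congˡ (-‿cong (cancel-negative (4 ℕ.* i ℕ.+ 1) (4 ℕ.* j ℕ.+ 4)
             (≡.trans (≡.cong (λ k → 4 ℕ.* k ℕ.+ 1) (≡.sym eq)) (solveℕ 2 (λ i j → lit 4 ✶ (lit 1 ⊹ (i ⊹ j)) ⊹ lit 1
               ≐ lit 4 ✶ i ⊹ lit 1 ⊹ (lit 4 ✶ j ⊹ lit 4)) ≡.refl i j)))) ⟩
        1# - q⁻¹ ^ (4 ℕ.* i ℕ.+ 1)  ≈⟨ H-negate (4 ℕ.* i ℕ.+ 1) ⟩
        e i  ∎)

      g-reverse : ∀ j i → suc (j ℕ.+ i) ≡ N → 1# - p ^ suc j * D ≈ g i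
      g-reverse j i eq = begin
        1# - p ^ suc j * D  ≈⟨ +-congˡ (-‿cong (*-congʳ (p^suc j))) ⟩
        1# - q ^ (4 ℕ.* j ℕ.+ 4) * D  ≈⟨ +-congˡ (-‿cong (cancel-negative (4 ℕ.* i ℕ.+ 2) (4 ℕ.* j ℕ.+ 4)
             (≡.trans (≡.cong (λ k → 4 ℕ.* k ℕ.+ 2) (≡.sym eq)) (solveℕ 2 (λ i j → lit 4 ✶ (lit 1 ⊹ (j ⊹ i)) ⊹ lit 2
               ≐ lit 4 ✶ i ⊹ lit 2 ⊹ (lit 4 ✶ j ⊹ lit 4)) ≡.refl i j)))) ⟩
        1# - q⁻¹ ^ (4 ℕ.* i ℕ.+ 2)  ≈⟨ H-negate (4 ℕ.* i ℕ.+ 2) ⟩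
        g i  ∎

      numerators : (1# - q) * ∏ N (λ j → 1# - q * p ^ suc j) ≈ ∏ N a * H n
      numerators = begin
        (1# - q) * ∏ N (λ j → 1# - q * p ^ suc j)  ≈⟨ *-congʳ (+-congˡ (-‿cong (*-identityʳ q))) ⟨
        (1# - q * p ^ 0) * ∏ N (λ j → 1# - q * p ^ suc j) ≈⟨ ∏-head N (λ j → 1# - q * p ^ j) ⟨
        ∏ (suc N) (λ j → 1# - q * p ^ j)  ≈⟨ ∏-cong (suc N) (λ {j} _ → +-congˡ (-‿cong (qp^ j))) ⟩
        ∏ N a * H n  ∎

      combined : ∀ i → a i * (g i * (A⁻¹ i * e⁻¹ i)) ≈ H (4 ℕ.* i ℕ.+ 2) * A⁻¹ i * q⁻¹
      combined i = begin
        a i * (g i * (A⁻¹ i * e⁻¹ i))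
          ≈⟨ solve 6 (λ a x h A y k → a :* ((:- (x :* h)) :* (A :* (:- (y :* k)))) := h :* A :* (y :* x) :* (a :* k)) refl
               (a i) (q⁻¹ ^ (4 ℕ.* i ℕ.+ 2)) (H (4 ℕ.* i ℕ.+ 2)) (A⁻¹ i) (q ^ (4 ℕ.* i ℕ.+ 1)) (H⁻¹ (4 ℕ.* i ℕ.+ 1)) ⟩
        H (4 ℕ.* i ℕ.+ 2) * A⁻¹ i * (q ^ (4 ℕ.* i ℕ.+ 1) * q⁻¹ ^ (4 ℕ.* i ℕ.+ 2)) * (a i * H⁻¹ (4 ℕ.* i ℕ.+ 1))
          ≈⟨ *-cong (*-congˡ (cancel-negative 1 (4 ℕ.* i ℕ.+ 1)
            (≡.trans (≡.sym (ℕ.+-assoc (4 ℕ.* i) 1 1)) (ℕ.+-comm (4 ℕ.* i ℕ.+ 1) 1)))) (H-inverse′ (ℕ.m≤n+m 1 _)) ⟩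
        H (4 ℕ.* i ℕ.+ 2) * A⁻¹ i * (q⁻¹ * 1#) * 1#
          ≈⟨ trans (*-identityʳ _) (*-congˡ (*-identityʳ q⁻¹)) ⟩
        H (4 ℕ.* i ℕ.+ 2) * A⁻¹ i * q⁻¹ ∎

      ∏-const : ∀ k → ∏ k (λ _ → q⁻¹) ≈ q⁻¹ ^ k
      ∏-const zero    = refl
      ∏-const (suc k) = trans (*-comm _ _) (*-congˡ (∏-const k))

    S-terms : S N ≈ ∑ (suc N) (λ k → H (8 ℕ.* k ℕ.+ 1) * ∏ k φ)
    S-terms = ∑-cong (suc N) λ {k} _ → *-congʳ (+-congˡ (-‿cong (begin
      q * ((q ^ 4) ^ k * (q ^ 4) ^ k)  ≈⟨ *-congˡ (*-cong (p^ k) (p^ k)) ⟩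
      q * (q ^ (4 ℕ.* k) * q ^ (4 ℕ.* k))  ≈⟨ *-congˡ (^-homo-* q (4 ℕ.* k) (4 ℕ.* k)) ⟨
      q ^ suc (4 ℕ.* k ℕ.+ 4 ℕ.* k)  ≡⟨ ≡.cong (q ^_) (solveℕ 1 (λ k → lit 1 ⊹ (lit 4 ✶ k ⊹ lit 4 ✶ k) ≐ lit 8 ✶ k ⊹ lit 1) ≡.refl k) ⟩
      q ^ (8 ℕ.* k ℕ.+ 1)  ∎)))

    t : Carrier
    t = q ^ n + q⁻¹ ^ n - (1# + 1#)

    γ⁻¹ : ℕ → Carrier
    γ⁻¹ i = B⁻¹ i * G⁻¹ (suc N ℕ.+ i)

    γ : ℕ → Carrier
    γ m = H m * H m - q ^ m * t

    γ-split : ∀ m → (1# - q ^ n * q ^ m) * (1# - q⁻¹ ^ n * q ^ m) ≈ γ m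
    γ-split m = begin
      (1# - z * y) * (1# - z′ * y)  ≈⟨ solve 3 (λ y z z′ → (one :- z :* y) :* (one :- z′ :* y)
        := one :+ (z :* z′) :* (y :* y) :- y :* (z :+ z′)) refl y z z′ ⟩
      1# + (z * z′) * (y * y) - y * (z + z′)  ≈⟨ +-congʳ (+-congˡ (*-congʳ (q^-inverse n))) ⟩
      1# + 1# * (y * y) - y * (z + z′)  ≈⟨ solve 3 (λ y z z′ → one :+ one :* (y :* y) :- y :* (z :+ z′)
        := (one :- y) :* (one :- y) :- y :* (z :+ z′ :- (one :+ one))) refl y z z′ ⟩
      γ m  ∎
      where
      y = q ^ m
      z = q ^ n
      z′ = q⁻¹ ^ n

    γ-inverse : ∀ i → γ (4 ℕ.* i ℕ.+ 4) * γ⁻¹ i ≈ 1#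
    γ-inverse i = begin
      γ m * γ⁻¹ i  ≈⟨ *-congʳ (γ-split m) ⟨
      (1# - q ^ n * q ^ m) * (1# - q⁻¹ ^ n * q ^ m) * (B⁻¹ i * G⁻¹ (suc N ℕ.+ i))
        ≈⟨ solve 4 (λ x y b g → x :* y :* (b :* g) := (y :* b) :* (x :* g)) refl (1# - q ^ n * q ^ m) (1# - q⁻¹ ^ n * q ^ m) (B⁻¹ i)
          (G⁻¹ (suc N ℕ.+ i)) ⟩
      (1# - q⁻¹ ^ n * q ^ m) * B⁻¹ i * ((1# - q ^ n * q ^ m) * G⁻¹ (suc N ℕ.+ i))
        ≈⟨ *-cong (trans (*-congʳ (+-congˡ (-‿cong (trans (*-comm _ _) (sym (qpD i)))))) (B-inverse i))
                  (trans (*-congʳ (+-congˡ (-‿cong (sym q^shift)))) (G-inverse (suc N ℕ.+ i))) ⟩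
      1# * 1#  ≈⟨ *-identityˡ 1# ⟩
      1#  ∎
      where
      m = 4 ℕ.* i ℕ.+ 4
      q^shift : q * (q ^ 4) ^ (suc N ℕ.+ i) ≈ q ^ n * q ^ m
      q^shift = trans (qp^ (suc N ℕ.+ i)) (q^-split n m (solveℕ 2 (λ N i → lit 4 ✶ ((lit 1 ⊹ N) ⊹ i) ⊹ lit 1
        ≐ lit 4 ✶ N ⊹ lit 1 ⊹ (lit 4 ✶ i ⊹ lit 4)) ≡.refl N i))

    -- Collects the parameters C and p^(-N) in the symmetric γ, so that n enters only through t; the
    -- factor q² is the ratio of the powers q^(2k).
    φ-split : ∀ i → φ i ≈ q ^ 2 * (H (4 ℕ.* i ℕ.+ 1) * H (4 ℕ.* i ℕ.+ 1)) * γ (4 ℕ.* i ℕ.+ 1) * (A⁻¹ i * A⁻¹ i * γ⁻¹ i)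
    φ-split i = begin
      (1# - q * p ^ i) * (1# - q * p ^ i) * (1# - C * p ^ i) * ((p ^ N - p ^ i) * p * D) * (A⁻¹ i * A⁻¹ i * B⁻¹ i * G⁻¹ (suc N ℕ.+ i))
        ≈⟨ *-cong (*-cong (*-cong (*-cong H≈ H≈) (+-congˡ (-‿cong C≈))) D≈) (*-assoc _ _ _) ⟩
      h * h * (1# - q ^ n * y) * (q ^ 2 * (1# - q⁻¹ ^ n * y)) * (A⁻¹ i * A⁻¹ i * γ⁻¹ i)
        ≈⟨ *-congʳ (solve 4 (λ h x y r → h :* h :* x :* (r :* y) := r :* (h :* h) :* (x :* y)) refl h (1# - q ^ n * y)
          (1# - q⁻¹ ^ n * y) (q ^ 2)) ⟩
      q ^ 2 * (h * h) * ((1# - q ^ n * y) * (1# - q⁻¹ ^ n * y)) * (A⁻¹ i * A⁻¹ i * γ⁻¹ i)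
        ≈⟨ *-congʳ (*-congˡ (γ-split (4 ℕ.* i ℕ.+ 1))) ⟩
      q ^ 2 * (h * h) * γ (4 ℕ.* i ℕ.+ 1) * (A⁻¹ i * A⁻¹ i * γ⁻¹ i) ∎
      where
      p = q ^ 4
      y = q ^ (4 ℕ.* i ℕ.+ 1)
      h = H (4 ℕ.* i ℕ.+ 1)
      H≈ : 1# - q * p ^ i ≈ h
      H≈ = +-congˡ (-‿cong (qp^ i))
      C≈ : C * p ^ i ≈ q ^ n * y
      C≈ = trans (*-congˡ (p^ i)) (trans (sym (^-homo-* q (4 ℕ.* N ℕ.+ 2) (4 ℕ.* i))) (q^-split n (4 ℕ.* i ℕ.+ 1)
        (solveℕ 2 (λ N i → lit 4 ✶ N ⊹ lit 2 ⊹ lit 4 ✶ i ≐ lit 4 ✶ N ⊹ lit 1 ⊹ (lit 4 ✶ i ⊹ lit 1)) ≡.refl N i)))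
      D≈ : (p ^ N - p ^ i) * p * D ≈ q ^ 2 * (1# - q⁻¹ ^ n * y)
      D≈ = begin
        (p ^ N - p ^ i) * p * D
          ≈⟨ solve 4 (λ x y p D → (x :- y) :* p :* D := p :* x :* D :- p :* y :* D) refl (p ^ N) (p ^ i) p D ⟩
        p ^ suc N * D - p ^ suc i * D
          ≈⟨ +-cong (trans (*-congʳ (p^suc N)) (cancel-positive 2 (4 ℕ.* N ℕ.+ 2)
            (solveℕ 1 (λ N → lit 4 ✶ N ⊹ lit 4 ≐ lit 2 ⊹ (lit 4 ✶ N ⊹ lit 2)) ≡.refl N)))
                    (-‿cong (*-cong (trans (p^suc i) (q^-split 3 (4 ℕ.* i ℕ.+ 1)
                      (solveℕ 1 (λ i → lit 4 ✶ i ⊹ lit 4 ≐ lit 3 ⊹ (lit 4 ✶ i ⊹ lit 1)) ≡.refl i)))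
                                    (q⁻¹^-split n 1 (≡.sym (ℕ.+-assoc (4 ℕ.* N) 1 1))))) ⟩
        q ^ 2 - q ^ 3 * y * (q⁻¹ ^ n * q⁻¹ ^ 1)
          ≈⟨ solve 4 (λ q q′ y z → q :^ 2 :- q :^ 3 :* y :* (z :* (q′ :* one)) := q :^ 2 :- (q :* q′) :* (q :^ 2 :* (z :* y))) refl q
            q⁻¹ y (q⁻¹ ^ n) ⟩
        q ^ 2 - (q * q⁻¹) * (q ^ 2 * (q⁻¹ ^ n * y))
          ≈⟨ +-congˡ (-‿cong (*-congʳ q-inverse)) ⟩
        q ^ 2 - 1# * (q ^ 2 * (q⁻¹ ^ n * y))
          ≈⟨ solve 2 (λ q x → q :- one :* (q :* x) := q :* (one :- x)) refl (q ^ 2) (q⁻¹ ^ n * y) ⟩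
        q ^ 2 * (1# - q⁻¹ ^ n * y) ∎

    t-square : t ≈ q⁻¹ ^ n * (H n * H n)
    t-square = sym (begin
      q⁻¹ ^ n * ((1# - q ^ n) * (1# - q ^ n))  ≈⟨ solve 2 (λ z z′ → z′ :* ((one :- z) :* (one :- z))
        := z′ :- (z :* z′) :- (z :* z′) :+ (z :* z′) :* z) refl (q ^ n) (q⁻¹ ^ n) ⟩
      q⁻¹ ^ n - zz′ - zz′ + zz′ * q ^ n  ≈⟨ +-cong (+-cong (+-congˡ (-‿cong (q^-inverse n))) (-‿cong (q^-inverse n)))
        (*-congʳ (q^-inverse n)) ⟩
      q⁻¹ ^ n - 1# - 1# + 1# * q ^ n  ≈⟨ solve 2 (λ z z′ → z′ :- one :- one :+ one :* z := z :+ z′ :- (one :+ one)) refl (q ^ n) (q⁻¹ ^ n) ⟩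
      t  ∎)
      where zz′ = q ^ n * q⁻¹ ^ n

-- Supercongruences at one place

-- d plays the part of the order of q at a place of K: q^d ≡ 1 in the residue ring.
record Place {K : CommutativeRing 0ℓ 0ℓ} (base : QBase K) (d : ℕ) : Set₁ where
  open RingKit K
  open QBase base
  field
    filtration : Filtration K
  open Filtration filtration public
  field
    1<d        : 1 < d
    4-coprime  : ∀ {x} → d ∣ 4 ℕ.* x → d ∣ x
    q∈         : I 0 q
    q⁻¹∈       : I 0 q⁻¹
    H⁻¹∈       : ∀ {m} → d ∤ m → I 0 (H⁻¹ m)
    H[d]∈      : I 1 (H d)
    -- This says that all 1 - q^m with d ∣ m > 0 have the same order, so one zero of a numerator
    -- cancels one pole of a denominator.
    ratio∈     : ∀ {m m′} → d ∣ m → d ∣ m′ → 0 < m′ → I 0 (H m * H⁻¹ m′)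
    ½          : Carrier
    ½-half     : (1# + 1#) * ½ ≈ 1#
    ½∈         : I 0 ½

  0<d : 0 < d
  0<d = ℕ.<-trans (s≤s z≤n) 1<d

module Local {K : CommutativeRing 0ℓ 0ℓ} {base : QBase K} {d : ℕ} (place : Place base d) where
  open RingKit K
  open QBase base
  open QSeries base
  open Place place

  d∤ : ∀ {m} → 0 < m → m < d → d ∤ m
  d∤ {suc m} _ m<d d∣m = ℕ.<⇒≱ m<d (ℕ.∣⇒≤ d∣m)

  H∈ : ∀ m → I 0 (H m)
  H∈ m = I-- I-1# (I-^ m q∈)

  H∣∈ : ∀ {m} → d ∣ m → I 1 (H m)
  H∣∈ (ℕ.divides zero    ≡.refl) = I-resp (sym (-‿inverseʳ 1#)) (I-0# 1)
  H∣∈ (ℕ.divides (suc j) ≡.refl) = I-resp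
    (trans (solve 2 (λ x y → (one :- x) :+ x :* (one :- y) := one :- x :* y) refl (q ^ d) (q ^ (j ℕ.* d)))
      (+-congˡ (-‿cong (sym (^-homo-* q d (j ℕ.* d))))))
    (I-+ H[d]∈ (I-* (I-^ d q∈) (H∣∈ (ℕ.divides j ≡.refl))))

  private
    -- H m is e m times a unit of I 0.
    e e⁻¹ : ℕ → Carrier
    e m with d ∣? m
    ... | yes _ = H d
    ... | no  _ = 1#
    e⁻¹ m with d ∣? m
    ... | yes _ = H⁻¹ d
    ... | no  _ = 1#

    e-∣ : ∀ {m} → d ∣ m → e m ≡ H d
    e-∣ {m} d∣m with d ∣? m
    ... | yes _  = ≡.refl
    ... | no d∤m = ⊥-elim (d∤m d∣m)

    e-∤ : ∀ {m} → d ∤ m → e m ≡ 1#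
    e-∤ {m} d∤m with d ∣? m
    ... | yes d∣m = ⊥-elim (d∤m d∣m)
    ... | no  _   = ≡.refl

    e⁻¹-∣ : ∀ {m} → d ∣ m → e⁻¹ m ≡ H⁻¹ d
    e⁻¹-∣ {m} d∣m with d ∣? m
    ... | yes _  = ≡.refl
    ... | no d∤m = ⊥-elim (d∤m d∣m)

    e⁻¹-∤ : ∀ {m} → d ∤ m → e⁻¹ m ≡ 1#
    e⁻¹-∤ {m} d∤m with d ∣? m
    ... | yes d∣m = ⊥-elim (d∤m d∣m)
    ... | no  _   = ≡.refl

    e-inverse : ∀ m → e m * e⁻¹ m ≈ 1#
    e-inverse m with d ∣? m
    ... | yes _ = H-inverse′ 0<d
    ... | no  _ = *-identityˡ 1#

    He⁻¹∈ : ∀ m → I 0 (H m * e⁻¹ m)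
    He⁻¹∈ m with d ∣? m
    ... | yes d∣m = ratio∈ d∣m ℕ.∣-refl 0<d
    ... | no  d∤m = I-* (H∈ m) I-1#

    H⁻¹e∈ : ∀ {m} → 0 < m → I 0 (H⁻¹ m * e m)
    H⁻¹e∈ {m} 0<m with d ∣? m
    ... | yes d∣m = I-resp (*-comm _ _) (ratio∈ ℕ.∣-refl d∣m 0<m)
    ... | no  d∤m = I-* (H⁻¹∈ d∤m) I-1#

  -- In each block of d indices exactly one numerator factor of `B a` vanishes at the place, at
  -- offset ρ, and exactly one denominator factor, at the final offset d - 1. The zero never comes
  -- after the pole, so the product is integral throughout and of positive order between the two.
  -- The cases a = 1 and a = 2 serve the summands and the closed form.
  module Integrality (a ρ : ℕ) (ρ<d : ρ < d) (d∣4ρ+a : d ∣ 4 ℕ.* ρ ℕ.+ a) where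

    private
      E : ℕ → Carrier
      E k = ∏ k (λ i → e (4 ℕ.* i ℕ.+ a) * e⁻¹ (4 ℕ.* i ℕ.+ 4))

      shift : ∀ l s x → 4 ℕ.* (l ℕ.* d ℕ.+ s) ℕ.+ x ≡ (4 ℕ.* l) ℕ.* d ℕ.+ (4 ℕ.* s ℕ.+ x)
      shift l s x = solveℕ 4 (λ l d s x → lit 4 ✶ (l ✶ d ⊹ s) ⊹ x ≐ (lit 4 ✶ l) ✶ d ⊹ (lit 4 ✶ s ⊹ x)) ≡.refl l d s x

      remove-block : ∀ l s x → d ∣ 4 ℕ.* (l ℕ.* d ℕ.+ s) ℕ.+ x → d ∣ 4 ℕ.* s ℕ.+ x
      remove-block l s x p = ℕ.∣m+n∣m⇒∣n (≡.subst (d ∣_) (shift l s x) p) (ℕ.n∣m*n (4 ℕ.* l))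

      add-block : ∀ l s x → d ∣ 4 ℕ.* s ℕ.+ x → d ∣ 4 ℕ.* (l ℕ.* d ℕ.+ s) ℕ.+ x
      add-block l s x p = ≡.subst (d ∣_) (≡.sym (shift l s x)) (ℕ.∣m∣n⇒∣m+n (ℕ.n∣m*n (4 ℕ.* l)) p)

      -- Otherwise d would divide 4(s′ - s), hence s′ - s, which lies strictly between 0 and d.
      distinct : ∀ {s s′} → s < s′ → s′ < d → d ∣ 4 ℕ.* s ℕ.+ a → d ∤ 4 ℕ.* s′ ℕ.+ a
      distinct {s} s<s′ s′<d p p′ with ℕ.m≤n⇒∃[o]m+o≡n s<s′
      ... | k , ≡.refl = d∤ (s≤s z≤n) (ℕ.≤-trans (s≤s (s≤s (ℕ.m≤n+m k s))) s′<d) (4-coprime {suc k} (ℕ.∣m+n∣m⇒∣n (≡.subst (d ∣_)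
          (solveℕ 3 (λ s k a → lit 4 ✶ (lit 1 ⊹ s ⊹ k) ⊹ a ≐ (lit 4 ✶ s ⊹ a) ⊹ lit 4 ✶ (lit 1 ⊹ k)) ≡.refl s k a) p′) p))

    root : ∀ {l s} → s < d → s ≢ ρ → d ∤ 4 ℕ.* (l ℕ.* d ℕ.+ s) ℕ.+ a
    root {l} {s} s<d s≢ρ p with ℕ.<-cmp s ρ
    ... | tri< s<ρ _ _ = distinct s<ρ ρ<d (remove-block l s a p) d∣4ρ+a
    ... | tri≈ _ s≡ρ _ = s≢ρ s≡ρ
    ... | tri> _ _ ρ<s = distinct ρ<s s<d d∣4ρ+a (remove-block l s a p)

    denominator : ∀ {l s} → suc s < d → d ∤ 4 ℕ.* (l ℕ.* d ℕ.+ s) ℕ.+ 4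
    denominator {l} {s} s<d p = d∤ (s≤s z≤n) s<d (4-coprime {suc s} (≡.subst (d ∣_)
      (solveℕ 1 (λ s → lit 4 ✶ s ⊹ lit 4 ≐ lit 4 ✶ (lit 1 ⊹ s)) ≡.refl s) (remove-block l s 4 p)))

    private
      block-end : ∀ {l s} → suc s ≡ d → d ∣ 4 ℕ.* (l ℕ.* d ℕ.+ s) ℕ.+ 4
      block-end {l} {s} eq = add-block l s 4 (≡.subst (_∣ 4 ℕ.* s ℕ.+ 4) eq (ℕ.divides 4
        (solveℕ 1 (λ s → lit 4 ✶ s ⊹ lit 4 ≐ lit 4 ✶ (lit 1 ⊹ s)) ≡.refl s)))

      module Block (l : ℕ) (start : E (l ℕ.* d) ≈ 1#) where

        step : ∀ s → E (l ℕ.* d ℕ.+ suc s) ≡ E (l ℕ.* d ℕ.+ s) * (e (4 ℕ.* (l ℕ.* d ℕ.+ s) ℕ.+ a) * e⁻¹ (4 ℕ.* (l ℕ.* d ℕ.+ s) ℕ.+ 4))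
        step s = ≡.cong E (ℕ.+-suc (l ℕ.* d) s)

        at : ∀ {s x y z} → E (l ℕ.* d ℕ.+ s) ≈ x → e (4 ℕ.* (l ℕ.* d ℕ.+ s) ℕ.+ a) ≡ y → e⁻¹ (4 ℕ.* (l ℕ.* d ℕ.+ s) ℕ.+ 4) ≡ z →
          E (l ℕ.* d ℕ.+ suc s) ≈ x * (y * z)
        at {s} p r t = trans (reflexive (step s)) (*-cong p (*-cong (reflexive r) (reflexive t)))

        before : ∀ s → s ≤ ρ → E (l ℕ.* d ℕ.+ s) ≈ 1#
        before zero    _   = trans (reflexive (≡.cong E (ℕ.+-identityʳ (l ℕ.* d)))) start
        before (suc s) s<ρ = trans (at (before s (ℕ.<⇒≤ s<ρ)) (e-∤ (root {l} {s} (ℕ.<-trans s<ρ ρ<d) (ℕ.<⇒≢ s<ρ)))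
            (e⁻¹-∤ (denominator {l} {s} (ℕ.≤-<-trans s<ρ ρ<d)))) (solve 0 (one :* (one :* one) := one) refl)

        after : ∀ s → ρ < s → s < d → E (l ℕ.* d ℕ.+ s) ≈ H d
        after (suc s) (s≤s ρ≤s) s<d with ℕ.m≤n⇒m<n∨m≡n ρ≤s
        ... | inj₁ ρ<s = trans (at (after s ρ<s (ℕ.<⇒≤ s<d)) (e-∤ (root {l} {s} (ℕ.<⇒≤ s<d) (ℕ.<⇒≢ ρ<s ∘ ≡.sym)))
          (e⁻¹-∤ (denominator {l} {s} s<d)))
            (solve 1 (λ h → h :* (one :* one) := h) refl (H d))
        ... | inj₂ ≡.refl = trans (at (before s ℕ.≤-refl) (e-∣ (add-block l s a d∣4ρ+a)) (e⁻¹-∤ (denominator {l} {s} s<d)))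
            (solve 1 (λ h → one :* (h :* one) := h) refl (H d))

        end : ∀ s → suc s ≡ d → E (l ℕ.* d ℕ.+ suc s) ≈ 1#
        end s eq with ℕ.m≤n⇒m<n∨m≡n (ℕ.s≤s⁻¹ (≡.subst (ρ <_) (≡.sym eq) ρ<d))
        ... | inj₁ ρ<s = trans (at (after s ρ<s s<d) (e-∤ (root {l} {s} s<d (ℕ.<⇒≢ ρ<s ∘ ≡.sym))) (e⁻¹-∣ (block-end {l} {s} eq)))
            (trans (*-congˡ (*-identityˡ _)) (H-inverse′ 0<d))
          where
          s<d : s < d
          s<d = ℕ.≤-reflexive eq
        -- If ρ = d - 1, zero and pole sit in the same factor.
        ... | inj₂ ≡.refl = trans (at (before s ℕ.≤-refl) (e-∣ (add-block l s a d∣4ρ+a)) (e⁻¹-∣ (block-end {l} {s} eq)))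
            (trans (*-identityˡ _) (H-inverse′ 0<d))

      E-start : ∀ l → E (l ℕ.* d) ≈ 1#
      E-start zero    = refl
      E-start (suc l) = trans (reflexive (≡.cong E eq)) (Block.end l (E-start l) (ℕ.pred d) (ℕ.suc-pred d {{ℕ.>-nonZero 0<d}}))
        where
        eq : d ℕ.+ l ℕ.* d ≡ l ℕ.* d ℕ.+ suc (ℕ.pred d)
        eq = ≡.trans (ℕ.+-comm d (l ℕ.* d)) (≡.cong (l ℕ.* d ℕ.+_) (≡.sym (ℕ.suc-pred d {{ℕ.>-nonZero 0<d}})))

      -- Inserting e m e⁻¹ m and e m′ e⁻¹ m′ makes H m e⁻¹ m and H⁻¹ m′ e m′ integral; the
      -- bookkeeping of zeros and poles is left to `E`.
      B-split : ∀ k → ∃[ u ] I 0 u × B a k ≈ u * E k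
      B-split zero    = 1# , I-1# , sym (*-identityˡ 1#)
      B-split (suc k) = let u , u∈ , eq = B-split k in
        u * ((H m * e⁻¹ m) * (H⁻¹ m′ * e m′)) , I-* u∈ (I-* (He⁻¹∈ m) (H⁻¹e∈ (ℕ.≤-trans (s≤s z≤n) (ℕ.m≤n+m 4 (4 ℕ.* k))))) , (begin
        B a k * (H m * H⁻¹ m′)
          ≈⟨ *-congʳ eq ⟩
        u * E k * (H m * H⁻¹ m′)
          ≈⟨ trans (*-congˡ (trans (*-cong (e-inverse m) (e-inverse m′)) (*-identityˡ 1#))) (*-identityʳ _) ⟨
        u * E k * (H m * H⁻¹ m′) * ((e m * e⁻¹ m) * (e m′ * e⁻¹ m′))
          ≈⟨ solve 8 (λ u E h h′ x x′ y y′ → u :* E :* (h :* h′) :* ((x :* x′) :* (y :* y′))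
            := u :* ((h :* x′) :* (h′ :* y)) :* (E :* (x :* y′))) refl
               u (E k) (H m) (H⁻¹ m′) (e m) (e⁻¹ m) (e m′) (e⁻¹ m′) ⟩
        u * ((H m * e⁻¹ m) * (H⁻¹ m′ * e m′)) * (E k * (e m * e⁻¹ m′)) ∎)
        where
        m = 4 ℕ.* k ℕ.+ a
        m′ = 4 ℕ.* k ℕ.+ 4

    B∈₀ : ∀ {l s} → s ≤ ρ → I 0 (B a (l ℕ.* d ℕ.+ s))
    B∈₀ {l} {s} s≤ρ = let u , u∈ , eq = B-split (l ℕ.* d ℕ.+ s) in
      I-resp (sym (trans eq (trans (*-congˡ (Block.before l (E-start l) s s≤ρ)) (*-identityʳ u)))) u∈

    B∈₁ : ∀ {l s} → ρ < s → s < d → I 1 (B a (l ℕ.* d ℕ.+ s))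
    B∈₁ {l} {s} ρ<s s<d = let u , u∈ , eq = B-split (l ℕ.* d ℕ.+ s) in
      I-resp (sym (trans eq (*-congˡ (Block.after l (E-start l) s ρ<s s<d)))) (I-* u∈ H[d]∈)

    B∈ : ∀ k → I 0 (B a k)
    B∈ k = ≡.subst (λ k → I 0 (B a k)) (≡.sym k≡) by-position
      where
      instance _ = ℕ.>-nonZero 0<d
      k≡ : k ≡ k ℕ./ d ℕ.* d ℕ.+ k % d
      k≡ = ≡.trans (ℕ.m≡m%n+[m/n]*n k d) (ℕ.+-comm (k % d) _)
      by-position : I 0 (B a (k ℕ./ d ℕ.* d ℕ.+ k % d))
      by-position with k % d ℕ.≤? ρ
      ... | yes s≤ρ = B∈₀ {k ℕ./ d} s≤ρ
      ... | no  s≰ρ = I-weaken (B∈₁ {k ℕ./ d} (ℕ.≰⇒> s≰ρ) (ℕ.m%n<n k d))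

  module Sums (N : ℕ) (d∣n : d ∣ 4 ℕ.* N ℕ.+ 1) where
    private
      instance _ = ℕ.>-nonZero 0<d

    -- As d ∣ 4N + 1, the remainder of N is itself the root of 4r + 1 modulo d. The truncated sum
    -- thus consists of whole blocks followed by exactly one half block 0, ..., r, on which the
    -- reflection acts.
    r : ℕ
    r = N % d

    N≡ : N ≡ N ℕ./ d ℕ.* d ℕ.+ r
    N≡ = ≡.trans (ℕ.m≡m%n+[m/n]*n N d) (ℕ.+-comm (N % d) _)

    r<d : r < d
    r<d = ℕ.m%n<n N d

    d∣4r+1 : d ∣ 4 ℕ.* r ℕ.+ 1
    d∣4r+1 = ℕ.∣m+n∣m⇒∣n (≡.subst (d ∣_) (≡.trans (≡.cong (λ k → 4 ℕ.* k ℕ.+ 1) N≡)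
      (solveℕ 3 (λ l d r → lit 4 ✶ (l ✶ d ⊹ r) ⊹ lit 1 ≐ (lit 4 ✶ l) ✶ d ⊹ (lit 4 ✶ r ⊹ lit 1)) ≡.refl (N ℕ./ d) d r)) d∣n)
      (ℕ.n∣m*n (4 ℕ.* (N ℕ./ d)))

    open Integrality 1 r r<d d∣4r+1 public

    d∤4i+1 : ∀ {i} → i < r → d ∤ 4 ℕ.* i ℕ.+ 1
    d∤4i+1 {i} i<r p = root {0} (ℕ.<-trans i<r r<d) (ℕ.<⇒≢ i<r) p

    d∤4i+4 : ∀ {i} → i < r → d ∤ 4 ℕ.* i ℕ.+ 4
    d∤4i+4 {i} i<r p = denominator {0} (ℕ.≤-<-trans i<r r<d) p

    open Residue filtration
    private
      module A = RingKit residueRing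

    -- Relates x to a residue without attaching an integrality proof to x; `lifts-∈` recovers one.
    -- Formulas over K are matched factor by factor with images whose exponents are already reduced
    -- modulo d.
    record Lifts (x : Carrier) (a : A.Carrier) : Set where
      constructor lifts
      field lift-eq : I 1 (x - proj₁ a)
    open Lifts

    lifts-≈ : ∀ {x a a′} → a A.≈ a′ → Lifts x a → Lifts x a′
    lifts-≈ {x} {a} {a′} (congruent p) (lifts s) = lifts
      (I-resp (solve 3 (λ x a a′ → (x :- a) :+ (a :- a′) := x :- a′) refl x (proj₁ a) (proj₁ a′)) (I-+ s p))

    lifts-self : ∀ {x} (x∈ : I 0 x) → Lifts x (x , x∈)
    lifts-self {x} x∈ = lifts (I-resp (sym (-‿inverseʳ x)) (I-0# 1))

    lifts-0 : ∀ {x} → Lifts x A.0# → I 1 x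
    lifts-0 {x} (lifts p) = I-resp (solve 1 (λ x → x :- con (+ 0) := x) refl x) p

    lifts-∈ : ∀ {x a} → Lifts x a → I 0 x
    lifts-∈ {x} {a} (lifts p) = I-resp (solve 2 (λ x a → (x :- a) :+ a := x) refl x (proj₁ a)) (I-+ (I-weaken p) (proj₂ a))

    lifts-eq : ∀ {x a a′} → Lifts x a → Lifts x a′ → a A.≈ a′
    lifts-eq {x} {a} {a′} (lifts p) (lifts s) = congruent
      (I-resp (solve 3 (λ x a a′ → (x :- a′) :- (x :- a) := a :- a′) refl x (proj₁ a) (proj₁ a′)) (I-- s p))

    lifts-+ : ∀ {x y a b} → Lifts x a → Lifts y b → Lifts (x + y) (a A.+ b)
    lifts-+ {x} {y} {a} {b} (lifts p) (lifts s) = lifts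
      (I-resp (solve 4 (λ x y a b → (x :- a) :+ (y :- b) := (x :+ y) :- (a :+ b)) refl x y (proj₁ a) (proj₁ b)) (I-+ p s))

    lifts-neg : ∀ {x a} → Lifts x a → Lifts (- x) (A.- a)
    lifts-neg {x} {a} (lifts p) = lifts (I-resp (solve 2 (λ x a → :- (x :- a) := (:- x) :- (:- a)) refl x (proj₁ a)) (I-neg p))

    lifts-* : ∀ {x y a b} → Lifts x a → Lifts y b → Lifts (x * y) (a A.* b)
    lifts-* {x} {y} {a} {b} (lifts p) y∼b@(lifts s) =
      lifts (I-resp (solve 4 (λ x y a b → (x :- a) :* y :+ a :* (y :- b) := (x :* y) :- (a :* b)) refl x y (proj₁ a) (proj₁ b))
        (I-+ (I-* p (lifts-∈ y∼b)) (I-* (proj₂ a) s)))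

    lifts-1 : Lifts 1# A.1#
    lifts-1 = lifts-self I-1#

    lifts-^ : ∀ {x a} m → Lifts x a → Lifts (x ^ m) (a A.^ m)
    lifts-^ zero    p = lifts-1
    lifts-^ (suc m) p = lifts-* p (lifts-^ m p)

    lifts-∑ : ∀ n {x a} → (∀ {i} → i < n → Lifts (x i) (a i)) → Lifts (∑ n x) (A.∑ n a)
    lifts-∑ zero    p = lifts-self (I-0# 0)
    lifts-∑ (suc n) p = lifts-+ (lifts-∑ n (p ∘ ℕ.m≤n⇒m≤1+n)) (p ℕ.≤-refl)

    Q : A.Carrier
    Q = q , q∈

    Q^d : Q A.^ d A.≈ A.1#
    Q^d = lifts-eq (lifts-^ d (lifts-self q∈)) (lifts (I-resp (solve 1 (λ x → :- (one :- x) := x :- one) refl (q ^ d)) (I-neg H[d]∈)))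

    Q^∣ : ∀ {m} → d ∣ m → Q A.^ m A.≈ A.1#
    Q^∣ (ℕ.divides j ≡.refl) = A.trans (A.reflexive (≡.cong (Q A.^_) (ℕ.*-comm j d)))
      (A.trans (A.sym (A.^-assocʳ Q d j)) (A.trans (A.^-congˡ j Q^d) (A.1^ j)))

    lifts-q^ : ∀ j {m m′} → m ≡ j ℕ.* d ℕ.+ m′ → Lifts (q ^ m) (Q A.^ m′)
    lifts-q^ j {m} {m′} ≡.refl = lifts-≈ (A.trans (A.^-homo-* Q (j ℕ.* d) m′) (A.trans (A.*-congʳ (Q^∣ (ℕ.n∣m*n j))) (A.*-identityˡ _)))
      (lifts-^ m (lifts-self q∈))

    -- The value 0 at multiples of d is a default, as 1 - Q^m is 0 there.
    Ĥ⁻¹ : ℕ → A.Carrier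
    Ĥ⁻¹ m with d ∣? m
    ... | yes _  = A.0#
    ... | no d∤m = H⁻¹ m , H⁻¹∈ d∤m

    lifts-Ĥ⁻¹ : ∀ {m} → d ∤ m → Lifts (H⁻¹ m) (Ĥ⁻¹ m)
    lifts-Ĥ⁻¹ {m} d∤m with d ∣? m
    ... | yes d∣m = ⊥-elim (d∤m d∣m)
    ... | no  d∤m = lifts-self (H⁻¹∈ d∤m)

    lifts-H : ∀ j {m m′} → m ≡ j ℕ.* d ℕ.+ m′ → Lifts (H m) (A.1# A.- Q A.^ m′)
    lifts-H j eq = lifts-+ lifts-1 (lifts-neg (lifts-q^ j eq))

    Ĥ-inverse : ∀ {m} → 0 < m → d ∤ m → (A.1# A.- Q A.^ m) A.* Ĥ⁻¹ m A.≈ A.1#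
    Ĥ-inverse {m} 0<m d∤m = lifts-eq (lifts-* (lifts-H 0 {m} {m} ≡.refl) (lifts-Ĥ⁻¹ d∤m))
      (lifts (I-resp (sym (trans (+-congʳ (H-inverse′ 0<m)) (-‿inverseʳ 1#))) (I-0# 1)))

    -- Both sides invert 1 - Q^m′ in the residue ring, since Q^(jd) = 1, and inverses are unique.
    lifts-H⁻¹ : ∀ j {m m′} → 0 < m′ → d ∤ m′ → m ≡ j ℕ.* d ℕ.+ m′ → Lifts (H⁻¹ m) (Ĥ⁻¹ m′)
    lifts-H⁻¹ j {m} {m′} 0<m′ d∤m′ eq = lifts-≈ unique (lifts-self m∈)
      where
      m∈ : I 0 (H⁻¹ m)
      m∈ = H⁻¹∈ λ d∣m → d∤m′ (ℕ.∣m+n∣m⇒∣n (≡.subst (d ∣_) eq d∣m) (ℕ.n∣m*n j))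
      0<m : 0 < m
      0<m = ≡.subst (0 <_) (≡.sym eq) (ℕ.≤-trans 0<m′ (ℕ.m≤n+m m′ (j ℕ.* d)))
      h g g′ : A.Carrier
      h = A.1# A.- Q A.^ m′
      g = H⁻¹ m , m∈
      g′ = Ĥ⁻¹ m′
      hg≈1 : h A.* g A.≈ A.1#
      hg≈1 = lifts-eq (lifts-* (lifts-H j eq) (lifts-self m∈))
        (lifts (I-resp (sym (trans (+-congʳ (H-inverse′ 0<m)) (-‿inverseʳ 1#))) (I-0# 1)))
      unique : g A.≈ g′
      unique = A.trans (A.sym (A.*-identityʳ g)) (A.trans (A.*-congˡ (A.sym (Ĥ-inverse 0<m′ d∤m′)))
        (A.trans (A.sym (A.*-assoc g h g′)) (A.trans (A.*-congʳ (A.trans (A.*-comm g h) hg≈1)) (A.*-identityˡ g′))))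

    private
      module R = Reflection residueRing
      module Ref = R.Reflected Q r (Q^∣ d∣4r+1) (½ , ½∈) (lifts-eq (lifts-self (I-* (I-+ I-1# I-1#) ½∈)) (lifts (I-resp (sym (trans (+-congʳ ½-half) (-‿inverseʳ 1#))) (I-0# 1))))
        Ĥ⁻¹ (λ {i} i<r → Ĥ-inverse (ℕ.m≤n+m 1 (4 ℕ.* i)) (d∤4i+1 i<r))
          (λ {i} i<r → Ĥ-inverse (ℕ.≤-trans (s≤s z≤n) (ℕ.m≤n+m 4 (4 ℕ.* i))) (d∤4i+4 i<r))

      block-index : ∀ x l s y → x ℕ.* (l ℕ.* d ℕ.+ s) ℕ.+ y ≡ x ℕ.* l ℕ.* d ℕ.+ (x ℕ.* s ℕ.+ y)
      block-index x l s y = solveℕ 5 (λ x l d s y → x ✶ (l ✶ d ⊹ s) ⊹ y ≐ x ✶ l ✶ d ⊹ (x ✶ s ⊹ y)) ≡.refl x l d s y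

      -- The product up to the start of a block is reduced as a whole: single factors may have poles
      -- that cancel only in the total.
      b̂ : ℕ → A.Carrier
      b̂ l = B 1 (l ℕ.* d) , B∈ (l ℕ.* d)

      lifts-B : ∀ l s → s ≤ r → Lifts (B 1 (l ℕ.* d ℕ.+ s)) (b̂ l A.* Ref.b s)
      lifts-B l zero    _   = lifts-≈ (A.sym (A.*-identityʳ _))
        (≡.subst (λ k → Lifts (B 1 k) (b̂ l)) (≡.sym (ℕ.+-identityʳ (l ℕ.* d))) (lifts-self (B∈ (l ℕ.* d))))
      lifts-B l (suc s) s<r = ≡.subst (λ k → Lifts (B 1 k) (b̂ l A.* Ref.b (suc s))) (≡.sym (ℕ.+-suc (l ℕ.* d) s))
        (lifts-≈ (A.*-assoc (b̂ l) (Ref.b s) (Ref.H (4 ℕ.* s ℕ.+ 1) A.* Ĥ⁻¹ (4 ℕ.* s ℕ.+ 4)))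
          (lifts-* (lifts-B l s (ℕ.<⇒≤ s<r)) (lifts-* (lifts-H (4 ℕ.* l) (block-index 4 l s 1))
            (lifts-H⁻¹ (4 ℕ.* l) (ℕ.≤-trans (s≤s z≤n) (ℕ.m≤n+m 4 (4 ℕ.* s))) (d∤4i+4 s<r) (block-index 4 l s 4)))))

      -- Every exponent shifts by a multiple of d, so block l repeats the first one up to the scalar
      -- b̂ l ^ 4.
      lifts-c : ∀ l s → s ≤ r → Lifts (c (l ℕ.* d ℕ.+ s)) (b̂ l A.^ 4 A.* Ref.c s)
      lifts-c l s s≤r = lifts-≈ rearrange (lifts-* (lifts-* (lifts-H (8 ℕ.* l) (block-index 8 l s 1)) (lifts-^ 4 (lifts-B l s s≤r)))
          (lifts-q^ (2 ℕ.* l) (≡.trans (≡.sym (ℕ.+-identityʳ _))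
            (≡.trans (block-index 2 l s 0) (≡.cong (2 ℕ.* l ℕ.* d ℕ.+_) (ℕ.+-identityʳ _))))))
        where
        rearrange : Ref.H (8 ℕ.* s ℕ.+ 1) A.* (b̂ l A.* Ref.b s) A.^ 4 A.* Q A.^ (2 ℕ.* s)
          A.≈ b̂ l A.^ 4 A.* Ref.c s
        rearrange = A.solve 4 (λ h x b y → h A.:* (x A.:* b) A.:^ 4 A.:* y A.:= x A.:^ 4 A.:* (h A.:* b A.:^ 4 A.:* y)) A.refl
          (Ref.H (8 ℕ.* s ℕ.+ 1)) (b̂ l) (Ref.b s) (Q A.^ (2 ℕ.* s))

      lifts-c₀ : ∀ s → s ≤ r → Lifts (c s) (Ref.c s)
      lifts-c₀ s s≤r = lifts-≈ (A.trans (A.*-congʳ (A.trans (A.^-congˡ 4 b₀≈1) (A.1^ 4))) (A.*-identityˡ (Ref.c s))) (lifts-c 0 s s≤r)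
        where
        b₀≈1 : (1# , B∈ 0) A.≈ A.1#
        b₀≈1 = lifts-eq (lifts-self (B∈ 0)) lifts-1

      lifts-f : ∀ {m} → 0 < m → d ∤ m → Lifts (f m) (Ref.f m)
      lifts-f {m} 0<m d∤m = lifts-* (lifts-q^ 0 {m} {m} ≡.refl) (lifts-* inv inv)
        where inv = lifts-H⁻¹ 0 0<m d∤m ≡.refl

      lifts-L : ∀ s → s ≤ r → Lifts (L s) (Ref.L s)
      lifts-L s s≤r = lifts-∑ s λ {i} i<s → let i<r = ℕ.≤-trans i<s s≤r in
        lifts-+ (lifts-f (ℕ.≤-trans (s≤s z≤n) (ℕ.m≤n+m 4 (4 ℕ.* i))) (d∤4i+4 i<r)) (lifts-neg (lifts-f (ℕ.m≤n+m 1 (4 ℕ.* i)) (d∤4i+1 i<r)))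

    ∑-half-block : ∀ l → I 1 (∑ (suc r) (λ s → c (l ℕ.* d ℕ.+ s)))
    ∑-half-block l = lifts-0 (lifts-≈ (A.trans (A.sym (A.*-∑ _ (suc r) Ref.c)) (A.trans (A.*-congˡ Ref.∑c≈0) (A.zeroʳ _)))
      (lifts-∑ (suc r) λ {s} s<1+r → lifts-c l s (ℕ.s≤s⁻¹ s<1+r)))

    ∑cL∈ : I 1 (∑ (suc r) (λ s → c s * L s))
    ∑cL∈ = lifts-0 (lifts-≈ Ref.∑cL≈0 (lifts-∑ (suc r) λ {s} s<1+r → lifts-* (lifts-c₀ s (ℕ.s≤s⁻¹ s<1+r)) (lifts-L s (ℕ.s≤s⁻¹ s<1+r))))

    -- Here B has passed its zero but not yet the pole at the end of the block, so it has order at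
    -- least 1, and it enters to the fourth power.
    c∈₄ : ∀ {l s} → r < s → s < d → I 4 (c (l ℕ.* d ℕ.+ s))
    c∈₄ {l} {s} r<s s<d = I-* (I-* (H∈ (8 ℕ.* (l ℕ.* d ℕ.+ s) ℕ.+ 1)) (I-* b∈ (I-* b∈ (I-* b∈ (I-* b∈ I-1#)))))
      (I-^ (2 ℕ.* (l ℕ.* d ℕ.+ s)) q∈)
      where
      b∈ : I 1 (B 1 (l ℕ.* d ℕ.+ s))
      b∈ = B∈₁ {l} r<s s<d

    ∑-rest-of-block : ∀ l → I 4 (∑ (d ∸ suc r) (λ i → c (l ℕ.* d ℕ.+ (suc r ℕ.+ i))))
    ∑-rest-of-block l = I-∑ (d ∸ suc r) λ {i} i< → c∈₄ {l} (s≤s (ℕ.m≤m+n r i))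
      (≡.subst (suc r ℕ.+ i <_) (ℕ.m+[n∸m]≡n r<d) (ℕ.+-monoʳ-< (suc r) i<))

    ∑-block : ∀ l → I 1 (∑ d (λ s → c (l ℕ.* d ℕ.+ s)))
    ∑-block l = ≡.subst (λ k → I 1 (∑ k (λ s → c (l ℕ.* d ℕ.+ s)))) (ℕ.m+[n∸m]≡n r<d)
      (I-resp (sym (∑-split (suc r) (d ∸ suc r) (λ s → c (l ℕ.* d ℕ.+ s)))) (I-+ (∑-half-block l) (I-≤ (s≤s z≤n) (∑-rest-of-block l))))

    ∑-blocks : ∀ l → I 1 (∑ (l ℕ.* d) c)
    ∑-blocks zero    = I-0# 1
    ∑-blocks (suc l) = ≡.subst (λ k → I 1 (∑ k c)) (ℕ.+-comm (l ℕ.* d) d)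
      (I-resp (sym (∑-split (l ℕ.* d) d c)) (I-+ (∑-blocks l) (∑-block l)))

    ∑-truncated∈ : I 1 (∑ (suc N) c)
    ∑-truncated∈ = ≡.subst (λ k → I 1 (∑ k c)) (≡.trans (ℕ.+-suc (N ℕ./ d ℕ.* d) r) (≡.cong suc (≡.sym N≡)))
      (I-resp (sym (∑-split (N ℕ./ d ℕ.* d) (suc r) c)) (I-+ (∑-blocks (N ℕ./ d)) (∑-half-block (N ℕ./ d))))

    ∑-full∈ : I 1 (∑ (4 ℕ.* N ℕ.+ 1) c)
    ∑-full∈ = ≡.subst (λ k → I 1 (∑ k c)) (≡.sym (_∣_.equality d∣n)) (∑-blocks (_∣_.quotient d∣n))

    open Deformed N

    -- In the closed form 1 - q^n supplies the order, and `B 2 N` is integral with root ρ = 2N mod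
    -- d, because 4 · 2N + 2 = 2n.
    S∈ : I 1 (S N)
    S∈ = I-resp (sym S-closed) (I-* (I-* (H∣∈ d∣n) (B₂.B∈ N)) (I-^ N q⁻¹∈))
      where
      ρ = (2 ℕ.* N) % d
      d∣4ρ+2 : d ∣ 4 ℕ.* ρ ℕ.+ 2
      d∣4ρ+2 = ℕ.∣m+n∣m⇒∣n (≡.subst (d ∣_) (≡.trans (≡.trans
          (solveℕ 1 (λ N → lit 2 ✶ (lit 4 ✶ N ⊹ lit 1) ≐ lit 4 ✶ (lit 2 ✶ N) ⊹ lit 2) ≡.refl N)
          (≡.cong (λ k → 4 ℕ.* k ℕ.+ 2) (≡.trans (ℕ.m≡m%n+[m/n]*n (2 ℕ.* N) d) (ℕ.+-comm ρ _))))
        (solveℕ 3 (λ l d r → lit 4 ✶ (l ✶ d ⊹ r) ⊹ lit 2 ≐ (lit 4 ✶ l) ✶ d ⊹ (lit 4 ✶ r ⊹ lit 2)) ≡.refl ((2 ℕ.* N) ℕ./ d) d ρ))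
          (ℕ.∣n⇒∣m*n 2 d∣n)) (ℕ.n∣m*n (4 ℕ.* ((2 ℕ.* N) ℕ./ d)))
      module B₂ = Integrality 2 ρ (ℕ.m%n<n (2 ℕ.* N) d) d∣4ρ+2

    module CubicOrder (d≡n : d ≡ 4 ℕ.* N ℕ.+ 1) where
      private
        r≡N : r ≡ N
        r≡N = ℕ.m<n⇒m%n≡m (≡.subst (N <_) (≡.sym d≡n) (ℕ.≤-<-trans (ℕ.m≤m+n N (3 ℕ.* N)) (ℕ.m<m+n (4 ℕ.* N) (s≤s z≤n))))

        <r : ∀ {i} → i < N → i < r
        <r i<N = ≡.subst (_ <_) (≡.sym r≡N) i<N

        A⁻¹∈ : ∀ {i} → i < N → I 0 (A⁻¹ i)
        A⁻¹∈ i<N = H⁻¹∈ (d∤4i+4 (<r i<N))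

        h⁻¹∈ : ∀ {i} → i < N → I 0 (H⁻¹ (4 ℕ.* i ℕ.+ 1))
        h⁻¹∈ i<N = H⁻¹∈ (d∤4i+1 (<r i<N))

        γ⁻¹∈ : ∀ {i} → i < N → I 0 (γ⁻¹ i)
        γ⁻¹∈ {i} i<N = I-* (≡.subst (I 0) (≡.sym (B⁻¹-below i<N)) (I-neg (I-* (I-^ m q∈) (H⁻¹∈ (d∤ (ℕ.m≤n+m 1 _) m<d))))) (H⁻¹∈ d∤shifted)
          where
          m = 4 ℕ.* (N ∸ suc i) ℕ.+ 1
          m<d : m < d
          m<d = ≡.subst (m <_) (≡.trans (≡.sym (below i<N)) (≡.sym d≡n)) (ℕ.m<m+n m (ℕ.≤-trans (s≤s z≤n) (ℕ.m≤n+m 4 (4 ℕ.* i))))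
          d∤shifted : d ∤ 4 ℕ.* (suc N ℕ.+ i) ℕ.+ 1
          d∤shifted p = d∤4i+4 (<r i<N) (ℕ.∣m+n∣m⇒∣n (≡.subst (d ∣_) (solveℕ 2 (λ N i → lit 4 ✶ ((lit 1 ⊹ N) ⊹ i) ⊹ lit 1
            ≐ (lit 4 ✶ N ⊹ lit 1) ⊹ (lit 4 ✶ i ⊹ lit 4)) ≡.refl N i) p) d∣n)

        H[n]∈ : I 1 (H n)
        H[n]∈ = H∣∈ d∣n

        t∈ : I 2 t
        t∈ = I-resp (sym t-square) (I-* (I-^ n q⁻¹∈) (I-* H[n]∈ H[n]∈))

        -- The quotient of φ by its undeformed value ψ is (1 - F t) / (1 - F′ t). Its linear
        -- coefficient is ℓ = F′ - F; η retains the inverse of 1 - F′ t, so that the expansion is an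
        -- exact identity.
        ℓ η ψ : ℕ → Carrier
        ℓ i = f (4 ℕ.* i ℕ.+ 4) - f (4 ℕ.* i ℕ.+ 1)
        η i = (1# - f (4 ℕ.* i ℕ.+ 1) * t) * (f (4 ℕ.* i ℕ.+ 4) * f (4 ℕ.* i ℕ.+ 4) * (γ⁻¹ i * (H (4 ℕ.* i ℕ.+ 4) * H (4 ℕ.* i ℕ.+ 4))))
              - f (4 ℕ.* i ℕ.+ 1) * f (4 ℕ.* i ℕ.+ 4)
        ψ i = q ^ 2 * (H (4 ℕ.* i ℕ.+ 1) * A⁻¹ i) ^ 4

        -- Dividing γ m by H m ² leaves 1 − f m t, which is expanded to second order in t.
        φ-expand : ∀ i → φ i ≈ ψ i * (1# + t * ℓ i + t * t * η i)
        φ-expand i = begin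
          φ i
            ≈⟨ φ-split i ⟩
          q ^ 2 * (h * h) * (h * h - y * t) * (g′ * g′ * G)
            ≈⟨ *-cong (*-congˡ (+-congˡ (-‿cong (*-congʳ y≈)))) (*-congˡ G≈) ⟩
          q ^ 2 * (h * h) * (h * h - F * (h * h) * t) * (g′ * g′ * (κ * (g′ * g′)))
            ≈⟨ solve 6 (λ r h F t g κ → r :* (h :* h) :* (h :* h :- F :* (h :* h) :* t) :* (g :* g :* (κ :* (g :* g)))
              := r :* (h :* g) :^ 4 :* ((one :- F :* t) :* κ)) refl (q ^ 2) h F t g′ κ ⟩
          ψ i * ((1# - F * t) * κ)
            ≈⟨ *-congˡ (*-congˡ κ≈) ⟩
          ψ i * ((1# - F * t) * (1# + F′ * t + F′ * F′ * t * t * κ))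
            ≈⟨ *-congˡ (solve 4 (λ F F′ t κ → (one :- F :* t) :* (one :+ F′ :* t :+ F′ :* F′ :* t :* t :* κ)
                 := one :+ t :* (F′ :- F) :+ t :* t :* ((one :- F :* t) :* (F′ :* F′ :* κ) :- F :* F′)) refl F F′ t κ) ⟩
          ψ i * (1# + t * ℓ i + t * t * η i) ∎
          where
          m = 4 ℕ.* i ℕ.+ 1
          m′ = 4 ℕ.* i ℕ.+ 4
          y = q ^ m
          y′ = q ^ m′
          h = H m
          h′ = H m′
          g = H⁻¹ m
          g′ = A⁻¹ i
          F = f m
          F′ = f m′
          G = γ⁻¹ i
          κ = G * (h′ * h′)
          hg : h * g ≈ 1#
          hg = H-inverse′ (ℕ.m≤n+m 1 _)
          hg′ : h′ * g′ ≈ 1#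
          hg′ = H-inverse′ (ℕ.≤-trans (s≤s z≤n) (ℕ.m≤n+m 4 _))
          square : ∀ {x z} y → x * z ≈ 1# → y * (z * z) * (x * x) ≈ y
          square {x} {z} y xz = trans (solve 3 (λ x z y → y :* (z :* z) :* (x :* x) := y :* ((x :* z) :* (x :* z))) refl x z y)
            (trans (*-congˡ (trans (*-cong xz xz) (*-identityˡ 1#))) (*-identityʳ y))
          y≈ : y ≈ F * (h * h)
          y≈ = sym (square y hg)
          G≈ : G ≈ κ * (g′ * g′)
          G≈ = sym (square G (trans (*-comm g′ h′) hg′))
          κ-inverse : (1# - F′ * t) * κ ≈ 1#
          κ-inverse = begin
            (1# - F′ * t) * (G * (h′ * h′))  ≈⟨ solve 4 (λ F t G h → (one :- F :* t) :* (G :* (h :* h))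
              := (h :* h :- F :* (h :* h) :* t) :* G) refl F′ t G h′ ⟩
            (h′ * h′ - F′ * (h′ * h′) * t) * G  ≈⟨ *-congʳ (+-congˡ (-‿cong (*-congʳ (square y′ hg′)))) ⟩
            γ m′ * G  ≈⟨ γ-inverse i ⟩
            1#  ∎
          -- The finite geometric expansion 1/(1 - x) = 1 + x + x²/(1 - x) at x = F′ t.
          κ≈ : κ ≈ 1# + F′ * t + F′ * F′ * t * t * κ
          κ≈ = begin
            κ  ≈⟨ solve 3 (λ F t κ → κ := (one :+ F :* t) :* ((one :- F :* t) :* κ) :+ F :* F :* t :* t :* κ) refl F′ t κ ⟩
            (1# + F′ * t) * ((1# - F′ * t) * κ) + F′ * F′ * t * t * κ ≈⟨ +-congʳ (trans (*-congˡ κ-inverse) (*-identityʳ _)) ⟩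
            1# + F′ * t + F′ * F′ * t * t * κ  ∎

        -- The summand without its factor 1 - q^(8k+1): a pure product with consecutive ratio ψ,
        -- hence comparable with the product of the φ.
        C₀ : ℕ → Carrier
        C₀ k = B 1 k ^ 4 * q ^ (2 ℕ.* k)

        C₀-suc : ∀ k → C₀ (suc k) ≈ C₀ k * ψ k
        C₀-suc k = begin
          (B 1 k * x) ^ 4 * q ^ (2 ℕ.* suc k)  ≈⟨ *-congˡ (q^-split 2 (2 ℕ.* k) (ℕ.*-suc 2 k)) ⟩
          (B 1 k * x) ^ 4 * (q ^ 2 * q ^ (2 ℕ.* k))  ≈⟨ solve 4 (λ b x y z → (b :* x) :^ 4 :* (y :* z) := b :^ 4 :* z :* (y :* x :^ 4))
            refl (B 1 k) x (q ^ 2) (q ^ (2 ℕ.* k)) ⟩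
          C₀ k * ψ k  ∎
          where x = H (4 ℕ.* k ℕ.+ 1) * A⁻¹ k

        f∈ : ∀ {m} → I 0 (H⁻¹ m) → I 0 (f m)
        f∈ {m} p = I-* (I-^ m q∈) (I-* p p)

        ℓ∈ : ∀ {i} → i < N → I 0 (ℓ i)
        ℓ∈ i<N = I-- (f∈ (A⁻¹∈ i<N)) (f∈ (h⁻¹∈ i<N))

        ψ∈ : ∀ {i} → i < N → I 0 (ψ i)
        ψ∈ {i} i<N = I-* (I-^ 2 q∈) (I-^ 4 (I-* (H∈ (4 ℕ.* i ℕ.+ 1)) (A⁻¹∈ i<N)))

        η∈ : ∀ {i} → i < N → I 0 (η i)
        η∈ {i} i<N = I-- (I-* (I-- I-1# (I-* F (I-≤ {0} {2} z≤n t∈)))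
          (I-* (I-* F′ F′) (I-* (γ⁻¹∈ i<N) (I-* (H∈ (4 ℕ.* i ℕ.+ 4)) (H∈ (4 ℕ.* i ℕ.+ 4)))))) (I-* F F′)
          where
          F = f∈ (h⁻¹∈ i<N)
          F′ = f∈ (A⁻¹∈ i<N)

        L∈ : ∀ k → k ≤ N → I 0 (L k)
        L∈ k k≤N = I-∑ k λ i<k → ℓ∈ (ℕ.≤-trans i<k k≤N)

        C₀∈ : ∀ k → I 0 (C₀ k)
        C₀∈ k = I-* (I-^ 4 (B∈ k)) (I-^ (2 ℕ.* k) q∈)

        -- In each step of the induction the linear coefficients ℓ add up to L, and everything else
        -- is a multiple of t², which has order 4.
        first-order : ∀ k → k ≤ N → I 3 (∏ k φ - C₀ k * (1# + t * L k))
        first-order zero    _   = I-resp (solve 1 (λ t → con (+ 0) := one :- one :^ 4 :* one :* (one :+ t :* con (+ 0))) refl t) (I-0# 3)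
        first-order (suc k) k<N = I-resp (begin
          (P - Cₖ * (1# + t * l)) * φ k + t * t * (Cₖ * ψ k * ((1# + t * l) * η k + l * ℓ k))
            ≈⟨ +-congʳ (solve 5 (λ P Cₖ t l x → (P :- Cₖ :* (one :+ t :* l)) :* x := P :* x :- Cₖ :* (one :+ t :* l) :* x) refl P Cₖ t l
              (φ k)) ⟩
          P * φ k - Cₖ * (1# + t * l) * φ k + t * t * (Cₖ * ψ k * ((1# + t * l) * η k + l * ℓ k))
            ≈⟨ +-congʳ (+-congˡ (-‿cong (*-congˡ (φ-expand k)))) ⟩
          P * φ k - Cₖ * (1# + t * l) * (ψ k * (1# + t * ℓ k + t * t * η k)) + t * t * (Cₖ * ψ k * ((1# + t * l) * η k + l * ℓ k))
            ≈⟨ solve 8 (λ P x Cₖ t l y e s → P :* x :- Cₖ :* (one :+ t :* l) :* (y :* (one :+ t :* e :+ t :* t :* s)) :+ t :* t :*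
              (Cₖ :* y :* ((one :+ t :* l) :* s :+ l :* e))
                 := P :* x :- Cₖ :* y :* (one :+ t :* (l :+ e))) refl P (φ k) Cₖ t l (ψ k) (ℓ k) (η k) ⟩
          P * φ k - Cₖ * ψ k * (1# + t * (l + ℓ k))
            ≈⟨ +-congˡ (-‿cong (*-congʳ (C₀-suc k))) ⟨
          P * φ k - C₀ (suc k) * (1# + t * (l + ℓ k)) ∎)
          (I-+ (I-* (first-order k (ℕ.<⇒≤ k<N)) φ∈) (I-≤ {3} {4} (ℕ.n≤1+n 3) (I-* (I-* t∈ t∈)
            (I-* (I-* (C₀∈ k) (ψ∈ k<N)) (I-+ (I-* (I-+ I-1# (I-* (I-≤ {0} {2} z≤n t∈) l∈)) (η∈ k<N)) (I-* l∈ (ℓ∈ k<N)))))))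
          where
          P = ∏ k φ
          Cₖ = C₀ k
          l = L k
          l∈ : I 0 l
          l∈ = L∈ k (ℕ.<⇒≤ k<N)
          t∈₀ : I 0 t
          t∈₀ = I-≤ {0} {2} z≤n t∈
          φ∈ : I 0 (φ k)
          φ∈ = I-resp (sym (φ-expand k)) (I-* (ψ∈ k<N) (I-+ (I-+ I-1# (I-* t∈₀ (ℓ∈ k<N))) (I-* (I-* t∈₀ t∈₀) (η∈ k<N))))

      -- The difference splits into the first-order errors, of order 3 termwise, and t times the sum
      -- of c_k L_k, where t has order 2 and the reflection supplies the third.
      ∑-truncated-S∈ : I 3 (∑ (suc N) c - S N)
      ∑-truncated-S∈ = I-resp (sym split) (I-neg (I-+
          (I-∑ (suc N) λ {k} k<1+N → I-* (H∈ (8 ℕ.* k ℕ.+ 1)) (first-order k (ℕ.s≤s⁻¹ k<1+N)))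
          (I-* t∈ (≡.subst (λ k → I 1 (∑ (suc k) (λ s → c s * L s))) r≡N ∑cL∈))))
        where
        X : ℕ → Carrier
        X k = H (8 ℕ.* k ℕ.+ 1) * (∏ k φ - C₀ k * (1# + t * L k))
        termwise : ∀ k → ∑ k c - ∑ k (λ j → H (8 ℕ.* j ℕ.+ 1) * ∏ j φ) ≈ - (∑ k X + t * ∑ k (λ s → c s * L s))
        termwise zero    = solve 1 (λ t → con (+ 0) :- con (+ 0) := :- (con (+ 0) :+ t :* con (+ 0))) refl t
        termwise (suc k) = begin
          (a + h * b * x) - (a′ + h * P)  ≈⟨ solve 6 (λ a a′ h b x P → (a :+ h :* b :* x) :- (a′ :+ h :* P)
            := (a :- a′) :- h :* (P :- b :* x)) refl a a′ h b x P ⟩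
          (a - a′) - h * (P - b * x)  ≈⟨ +-congʳ (termwise k) ⟩
          - (u + t * v) - h * (P - b * x)  ≈⟨ solve 8 (λ u t v h P b x l → :- (u :+ t :* v) :- h :* (P :- b :* x)
            := :- ((u :+ h :* (P :- b :* x :* (one :+ t :* l))) :+ t :* (v :+ h :* b :* x :* l))) refl u t v h P b x (L k) ⟩
          - ((u + X k) + t * (v + c k * L k))  ∎
          where
          a = ∑ k c
          a′ = ∑ k (λ j → H (8 ℕ.* j ℕ.+ 1) * ∏ j φ)
          h = H (8 ℕ.* k ℕ.+ 1)
          b = B 1 k ^ 4
          x = q ^ (2 ℕ.* k)
          P = ∏ k φ
          u = ∑ k X
          v = ∑ k (λ s → c s * L s)
        split : ∑ (suc N) c - S N ≈ - (∑ (suc N) X + t * ∑ (suc N) (λ s → c s * L s))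
        split = trans (+-congˡ (-‿cong S-terms)) (termwise (suc N))

      ∑-full-S∈ : I 3 (∑ (4 ℕ.* N ℕ.+ 1) c - S N)
      ∑-full-S∈ = I-resp (begin
        (∑ (suc N) c - S N) + rest  ≈⟨ solve 3 (λ a b c → (a :- b) :+ c := (a :+ c) :- b) refl (∑ (suc N) c) (S N) rest ⟩
        (∑ (suc N) c + rest) - S N  ≈⟨ +-congʳ (∑-split (suc N) (d ∸ suc N) c) ⟨
        ∑ (suc N ℕ.+ (d ∸ suc N)) c - S N  ≡⟨ ≡.cong (λ k → ∑ k c - S N) (≡.trans (ℕ.m+[n∸m]≡n (≡.subst (_< d) r≡N r<d)) d≡n) ⟩
        ∑ (4 ℕ.* N ℕ.+ 1) c - S N  ∎)
        (I-+ ∑-truncated-S∈ (≡.subst (λ k → I 3 (∑ (d ∸ suc k) (λ i → c (suc k ℕ.+ i)))) r≡N (I-≤ {3} {4} (ℕ.n≤1+n 3) (∑-rest-of-block 0))))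
        where rest = ∑ (d ∸ suc N) (λ i → c (suc N ℕ.+ i))

-- From the fractions of the statement to q-series

module Quotients {K : CommutativeRing 0ℓ 0ℓ} (base : QBase K)
  (inv : CommutativeRing.Carrier K → CommutativeRing.Carrier K)
  (inv-unique : ∀ {x y} → CommutativeRing._≈_ K (CommutativeRing._*_ K x y) (CommutativeRing.1# K) → CommutativeRing._≈_ K (inv x) y)
  where
  open RingKit K
  open QBase base
  open QSeries base

  shifted-factorial≈ : ∀ b k {a} → a ≈ q ^ b → ∏ k (λ i → 1# - a * (q ^ 4) ^ i) ≈ ∏ k (λ i → H (4 ℕ.* i ℕ.+ b))
  shifted-factorial≈ b k a≈ = ∏-cong k λ {i} _ → +-congˡ
    (-‿cong (trans (*-cong a≈ (p^ i)) (trans (*-comm _ _) (sym (^-homo-* q (4 ℕ.* i) b)))))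

  private
    Y Y⁻¹ : ℕ → Carrier
    Y k = ∏ k (λ i → H (4 ℕ.* i ℕ.+ 4))
    Y⁻¹ k = ∏ k (λ i → H⁻¹ (4 ℕ.* i ℕ.+ 4))

    Y-inverse : ∀ k → Y k * Y⁻¹ k ≈ 1#
    Y-inverse k = trans (sym (∏-* k _ _)) (∏-one k λ {i} _ → H-inverse′ (ℕ.≤-trans (s≤s z≤n) (ℕ.m≤n+m 4 (4 ℕ.* i))))

    quotient≈B : ∀ a k {x y} → x ≈ ∏ k (λ i → H (4 ℕ.* i ℕ.+ a)) → y ≈ Y k → x * inv y ≈ B a k
    quotient≈B a k x≈ y≈ = trans (*-cong x≈ (inv-unique (trans (*-congʳ y≈) (Y-inverse k)))) (sym (∏-* k _ _))

    quotient⁴≈B⁴ : ∀ k {x y} → x ≈ ∏ k (λ i → H (4 ℕ.* i ℕ.+ 1)) → y ≈ Y k → x ^ 4 * inv (y ^ 4) ≈ B 1 k ^ 4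
    quotient⁴≈B⁴ k {x} {y} x≈ y≈ = begin
      x ^ 4 * inv (y ^ 4)  ≈⟨ *-congˡ (inv-unique (trans (sym (^-distrib-* y (Y⁻¹ k) 4))
        (trans (^-congˡ 4 (trans (*-congʳ y≈) (Y-inverse k))) (1^ 4)))) ⟩
      x ^ 4 * Y⁻¹ k ^ 4  ≈⟨ ^-distrib-* x (Y⁻¹ k) 4 ⟨
      (x * Y⁻¹ k) ^ 4  ≈⟨ ^-congˡ 4 (trans (*-congʳ x≈) (sym (∏-* k _ _))) ⟩
      B 1 k ^ 4  ∎

  inv-H1 : inv (1# - q) ≈ H⁻¹ 1
  inv-H1 = inv-unique (trans (*-congʳ (+-congˡ (-‿cong (sym (*-identityʳ q))))) (H-inverse 0))

  summand≈ : ∀ k {h x y z} → h ≈ H (8 ℕ.* k ℕ.+ 1) → x ≈ ∏ k (λ i → H (4 ℕ.* i ℕ.+ 1)) → y ≈ ∏ k (λ i → H (4 ℕ.* i ℕ.+ 4)) →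
    z ≈ q ^ (2 ℕ.* k) → h * inv (1# - q) * (x ^ 4 * inv (y ^ 4)) * z ≈ H⁻¹ 1 * c k
  summand≈ k h≈ x≈ y≈ z≈ = trans (*-cong (*-cong (*-cong h≈ inv-H1) (quotient⁴≈B⁴ k x≈ y≈)) z≈)
    (solve 4 (λ h g b x → h :* g :* b :* x := g :* (h :* b :* x)) refl (H (8 ℕ.* k ℕ.+ 1)) (H⁻¹ 1) (B 1 k ^ 4) (q ^ (2 ℕ.* k)))

  module Closed (N : ℕ) where
    open Deformed N using (n; S; S-closed)

    value≈ : ∀ {h x y z} → h ≈ H n → x ≈ ∏ N (λ i → H (4 ℕ.* i ℕ.+ 2)) → y ≈ ∏ N (λ i → H (4 ℕ.* i ℕ.+ 4)) →
      z ≈ q⁻¹ ^ N → x * inv y * (h * inv (1# - q)) * z ≈ H⁻¹ 1 * S N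
    value≈ h≈ x≈ y≈ z≈ = trans (*-cong (*-cong (quotient≈B 2 N x≈ y≈) (*-cong h≈ inv-H1)) z≈)
      (trans (solve 4 (λ b h g x → b :* (h :* g) :* x := g :* (h :* b :* x)) refl (B 2 N) (H n) (H⁻¹ 1) (q⁻¹ ^ N)) (*-congˡ (sym S-closed)))

  module Error (N : ℕ) (summand : ℕ → Carrier) (value : Carrier)
    (summand≈c : ∀ k → summand k ≈ H⁻¹ 1 * c k) (value≈S : value ≈ H⁻¹ 1 * Deformed.S N N) where
    open Deformed N using (n; S)

    private
      error≈ : ∀ k → ∑ k summand - value ≈ H⁻¹ 1 * (∑ k c - S N)
      error≈ k = begin
        ∑ k summand - value  ≈⟨ +-cong (∑-cong k λ {j} _ → summand≈c j) (-‿cong value≈S) ⟩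
        ∑ k (λ j → H⁻¹ 1 * c j) - H⁻¹ 1 * S N  ≈⟨ +-congʳ (*-∑ (H⁻¹ 1) k c) ⟨
        H⁻¹ 1 * ∑ k c - H⁻¹ 1 * S N  ≈⟨ solve 3 (λ h x y → h :* x :- h :* y := h :* (x :- y)) refl (H⁻¹ 1) (∑ k c) (S N) ⟩
        H⁻¹ 1 * (∑ k c - S N)  ∎

    -- For n = 1 the sum has only its term at k = 0, and it agrees with the closed form exactly.
    error-trivial : N ≡ 0 → ∑ (suc N) summand - value ≈ 0#
    error-trivial N≡0 = trans (error≈ (suc N)) (trans (*-congˡ (trans (+-congˡ (-‿cong (Deformed.S-closed N))) (trivial N N≡0))) (zeroʳ _))
      where
      trivial : ∀ N → N ≡ 0 → ∑ (suc N) c - H (4 ℕ.* N ℕ.+ 1) * B 2 N * q⁻¹ ^ N ≈ 0#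
      trivial zero ≡.refl = solve 1 (λ h → con (+ 0) :+ h :* one :^ 4 :* one :- h :* one :* one := con (+ 0)) refl (H 1)

    module AtPlace {d : ℕ} (place : Place base d) (d∣n : d ∣ n) where
      open Place place
      open Local place
      open Sums N d∣n

      private
        H⁻¹1∈ : I 0 (H⁻¹ 1)
        H⁻¹1∈ = H⁻¹∈ (d∤ (s≤s z≤n) 1<d)

      truncated∈ : I 1 (∑ (suc N) summand - value)
      truncated∈ = I-resp (sym (error≈ (suc N))) (I-* H⁻¹1∈ (I-- ∑-truncated∈ S∈))

      full∈ : I 1 (∑ n summand - value)
      full∈ = I-resp (sym (error≈ n)) (I-* H⁻¹1∈ (I-- ∑-full∈ S∈))

      module _ (d≡n : d ≡ n) where
        open CubicOrder d≡n

        truncated∈₃ : I 3 (∑ (suc N) summand - value)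
        truncated∈₃ = I-resp (sym (error≈ (suc N))) (I-* H⁻¹1∈ ∑-truncated-S∈)

        full∈₃ : I 3 (∑ n summand - value)
        full∈₃ = I-resp (sym (error≈ n)) (I-* H⁻¹1∈ ∑-full-S∈)

-- Cyclotomic polynomials as places, and the modulus as their product

record Generic {R K : CommutativeRing 0ℓ 0ℓ} (C : Constants R) (ε : Embedding R K) (base : QBase K) : Set where
  private
    module R = RingKit R
  open RingKit K
  open Embedding ε
  open QBase base
  open Constants C
  field
    q̂      : R.Carrier
    ι-q̂    : ι q̂ ≈ q
    Const-2 : Const (R.1# R.+ R.1#)
    ½      : Carrier
    ½-half : (1# + 1#) * ½ ≈ 1#

module CyclotomicPlace {R K : CommutativeRing 0ℓ 0ℓ} {C : Constants R} {ε : Embedding R K} {base : QBase K} (generic : Generic C ε base) where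
  private
    module R = RingKit R
  open RingKit K
  open QBase base
  open Generic generic
  open Embedding ε
  open Comaximality R C
  open Cyclotomic R C using (geometric; cop-geometric)
  open Localisation C ε

  pow : ℕ → R.Carrier
  pow m = q̂ R.^ m R.- R.1#

  ι-^ : ∀ m → ι (q̂ R.^ m) ≈ q ^ m
  ι-^ zero    = ι-1#
  ι-^ (suc m) = trans (ι-* q̂ (q̂ R.^ m)) (*-cong ι-q̂ (ι-^ m))

  H≈ : ∀ m → H m ≈ - ι (pow m)
  H≈ m = begin
    1# - q ^ m  ≈⟨ solve 2 (λ x y → x :- y := :- (y :- x)) refl 1# (q ^ m) ⟩
    - (q ^ m - 1#)  ≈⟨ -‿cong (+-cong (ι-^ m) (trans (ι-neg R.1#) (-‿cong ι-1#))) ⟨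
    - (ι (q̂ R.^ m) + ι (R.- R.1#))  ≈⟨ -‿cong (ι-+ (q̂ R.^ m) (R.- R.1#)) ⟨
    - ι (pow m)  ∎

  bracket : ∀ n → H n * H⁻¹ 1 ≈ ι (R.∑ n (q̂ R.^_))
  bracket n = begin
    H n * H⁻¹ 1  ≈⟨ *-congʳ (trans (H≈ n) (-‿cong (trans (ι-cong (geometric q̂ n)) (ι-* (q̂ R.- R.1#) s)))) ⟩
    - (ι (q̂ R.- R.1#) * ι s) * H⁻¹ 1  ≈⟨ solve 3 (λ x s g → (:- (x :* s)) :* g := s :* ((:- x) :* g)) refl (ι (q̂ R.- R.1#)) (ι s)
      (H⁻¹ 1) ⟩
    ι s * (- ι (q̂ R.- R.1#) * H⁻¹ 1)  ≈⟨ *-congˡ (*-congʳ (trans (-‿cong (ι-cong (R.+-congʳ (R.sym (R.*-identityʳ q̂))))) (sym (H≈ 1)))) ⟩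
    ι s * (H 1 * H⁻¹ 1)  ≈⟨ *-congˡ (H-inverse 0) ⟩
    ι s * 1#  ≈⟨ *-identityʳ (ι s) ⟩
    ι s  ∎
    where s = R.∑ n (q̂ R.^_)

  module _ {d : ℕ} (1<d : 1 < d) (4-coprime : ∀ {x} → d ∣ 4 ℕ.* x → d ∣ x) (Φ Y : R.Carrier)
    (factorised : Φ R.* Y R.≈ q̂ R.^ d R.- R.1#) (Φ⊥pow : ∀ {m} → d ∤ m → Comaximal Φ (q̂ R.^ m R.- R.1#)) where
    open At Φ
    open Filtration order-filtration
    private
      0<d : 0 < d
      0<d = ℕ.<-trans (s≤s z≤n) 1<d

      -- From Φ Y = q^d - 1 one reads q^(d-1) q - Y Φ = 1.
      Φ⊥q : Comaximal Φ q̂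
      Φ⊥q = comaximal {u = R.- Y} {v = q̂ R.^ ℕ.pred d} (Constants.Const-1 C) (R.begin
        R.- Y R.* Φ R.+ q̂ R.^ ℕ.pred d R.* q̂  R.≈⟨ R.solve 4 (λ y f x q → (R.:- y) R.:* f R.:+ x R.:* q
          R.:= (R.:- (f R.:* y)) R.:+ q R.:* x) R.refl Y Φ (q̂ R.^ ℕ.pred d) q̂ ⟩
        R.- (Φ R.* Y) R.+ q̂ R.^ suc (ℕ.pred d)  R.≈⟨ R.+-cong (R.-‿cong factorised)
          (R.reflexive (≡.cong (q̂ R.^_) (ℕ.suc-pred d {{ℕ.>-nonZero 0<d}}))) ⟩
        R.- pow d R.+ q̂ R.^ d  R.≈⟨ R.solve 1 (λ x → (R.:- (x R.:- R.one)) R.:+ x R.:= R.one) R.refl (q̂ R.^ d) ⟩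
        R.1#  R.∎)

      H⁻¹∈ : ∀ {m} → d ∤ m → I 0 (H⁻¹ m)
      H⁻¹∈ {zero}  d∤0 = ⊥-elim (d∤0 (d ℕ.∣0))
      H⁻¹∈ {suc m} d∤m = I-resp (solve 1 (λ g → :- (:- g) := g) refl g) (I-neg (integral-inverse (Φ⊥pow d∤m) (begin
          ι (pow (suc m)) * - g  ≈⟨ solve 2 (λ x g → x :* (:- g) := (:- x) :* g) refl (ι (pow (suc m))) g ⟩
          - ι (pow (suc m)) * g  ≈⟨ *-congʳ (H≈ (suc m)) ⟨
          H (suc m) * g  ≈⟨ H-inverse m ⟩
          1#  ∎)))
        where g = H⁻¹ (suc m)

      H[d]∈ : I 1 (H d)
      H[d]∈ = I-resp (begin
          ι (Φ R.^ 1) * ι (R.- Y)  ≈⟨ ι-* (Φ R.^ 1) (R.- Y) ⟨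
          ι (Φ R.^ 1 R.* (R.- Y))  ≈⟨ ι-cong (R.trans (R.solve 2 (λ f y → f R.:* R.one R.:* (R.:- y) R.:= R.:- (f R.:* y)) R.refl Φ Y)
            (R.-‿cong factorised)) ⟩
          ι (R.- pow d)  ≈⟨ ι-neg (pow d) ⟩
          - ι (pow d)  ≈⟨ H≈ d ⟨
          H d  ∎) (order-ι 1 (R.- Y))

      multiple : ∀ j → pow (j ℕ.* d) R.≈ pow d R.* R.∑ j ((q̂ R.^ d) R.^_)
      multiple j = R.trans (R.+-congʳ (R.trans (R.reflexive (≡.cong (q̂ R.^_) (ℕ.*-comm j d))) (R.sym (R.^-assocʳ q̂ d j))))
        (geometric (q̂ R.^ d) j)

      -- Both q^m - 1 and q^m′ - 1 are q^d - 1 times a geometric sum in q^d. The sum for m′ is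
      -- comaximal to q^d - 1, hence to its factor Φ, and is an admissible denominator.
      ratio∈ : ∀ {m m′} → d ∣ m → d ∣ m′ → 0 < m′ → I 0 (H m * H⁻¹ m′)
      ratio∈ (ℕ.divides a ≡.refl) (ℕ.divides (suc b) ≡.refl) 0<m′ = order {D = s} {M = z} cop (begin
          ι s * (H m * g)  ≈⟨ *-congˡ (*-congʳ (trans (H≈ m) (-‿cong (trans (ι-cong (multiple a)) (ι-* (pow d) z))))) ⟩
          ι s * (- (ι (pow d) * ι z) * g)  ≈⟨ solve 4 (λ s x z g → s :* ((:- (x :* z)) :* g) := z :* ((:- (x :* s)) :* g)) refl (ι s)
            (ι (pow d)) (ι z) g ⟩
          ι z * (- (ι (pow d) * ι s) * g)  ≈⟨ *-congˡ (*-congʳ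
            (trans (H≈ m′) (-‿cong (trans (ι-cong (multiple (suc b))) (ι-* (pow d) s))))) ⟨
          ι z * (H m′ * g)  ≈⟨ *-congˡ (H-inverse′ 0<m′) ⟩
          ι z * 1#  ≈⟨ *-comm (ι z) 1# ⟩
          1# * ι z  ≈⟨ *-congʳ ι-1# ⟨
          ι R.1# * ι z  ∎)
        where
        m = a ℕ.* d
        m′ = suc b ℕ.* d
        g = H⁻¹ m′
        s = R.∑ (suc b) ((q̂ R.^ d) R.^_)
        z = R.∑ a ((q̂ R.^ d) R.^_)
        cop : Comaximal Φ s
        cop = cop-sym (cop-factor Y (cop-respʳ (R.sym factorised) (cop-sym (cop-geometric (q̂ R.^ d) b))))

    place : Place base d
    place = record
      { filtration = order-filtration
      ; 1<d        = 1<d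
      ; 4-coprime  = 4-coprime
      ; q∈         = I-resp ι-q̂ (integral-ι q̂)
      ; q⁻¹∈       = integral-inverse Φ⊥q (trans (*-congʳ ι-q̂) q-inverse)
      ; H⁻¹∈       = H⁻¹∈
      ; H[d]∈      = H[d]∈
      ; ratio∈     = ratio∈
      ; ½          = ½
      ; ½-half     = ½-half
      ; ½∈         = integral-inverse (cop-const Const-2) (trans (*-congʳ (trans (ι-+ R.1# R.1#) (+-cong ι-1# ι-1#))) ½-half)
      }

module CyclotomicModulus {R K : CommutativeRing 0ℓ 0ℓ} {C : Constants R} {ε : Embedding R K} {base : QBase K} (generic : Generic C ε base) where
  private
    module R = RingKit R
  open Generic generic using (q̂)
  open Comaximality R C
  open Localisation C ε
  open CyclotomicPlace generic using (place)

  module Assembly (cancel : ∀ n {x y} → x R.* (q̂ R.^ suc n R.- R.1#) R.≈ y R.* (q̂ R.^ suc n R.- R.1#) → x R.≈ y)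
    (Φ : ℕ → R.Carrier) where
    open Cyclotomic.WithBase R C q̂ cancel Φ

    module _ (factorised : ∀ {d} → 0 < d → Factorised d) (N : ℕ) (0<N : 0 < N) where
      n : ℕ
      n = 4 ℕ.* N ℕ.+ 1

      0<n : 0 < n
      0<n = ℕ.m≤n+m 1 (4 ℕ.* N)

      1<n : 1 < n
      1<n = ℕ.m<n+m 1 {4 ℕ.* N} (ℕ.*-mono-< {0} {4} (s≤s z≤n) 0<N)

      -- As n = 4N + 1, x = n x - N (4x).
      4-coprime : ∀ {d} → d ∣ n → ∀ {x} → d ∣ 4 ℕ.* x → d ∣ x
      4-coprime {d} d∣n {x} d∣4x = ℕ.∣m+n∣m⇒∣n (≡.subst (d ∣_)
        (solveℕ 2 (λ N x → (lit 4 ✶ N ⊹ lit 1) ✶ x ≐ N ✶ (lit 4 ✶ x) ⊹ x) ≡.refl N x)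
        (ℕ.∣m⇒∣m*n x d∣n)) (ℕ.∣n⇒∣m*n N d∣4x)

      place-at : ∀ {d} → 1 < d → d ∣ n → Place base d
      place-at {d} 1<d d∣n = place 1<d (4-coprime d∣n) (Φ d) (R.∏ d (Φ∣ d)) (factorised 0<d) (cop-pow 0<d λ 0<g _ → factorised 0<g)
        where
        0<d : 0 < d
        0<d = ℕ.<-trans (s≤s z≤n) 1<d

      Φ⊥Φ : ∀ {d e} → 0 < d → 0 < e → d ≢ e → Comaximal (Φ d) (Φ e)
      Φ⊥Φ {d} {e} 0<d 0<e = cop-Φ {d ℕ.+ e} (λ 0<g _ → factorised 0<g) 0<d 0<e (ℕ.m≤m+n d e) (ℕ.m≤n+m e d)

      m : ℕ
      m = n ∸ 2

      f : ℕ → R.Carrier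
      f i = Φ∣ n (2 ℕ.+ i)

      [n] P : R.Carrier
      [n] = R.∑ n (q̂ R.^_)
      P = [n] R.* (Φ n R.* Φ n)

      n≡2+m : n ≡ 2 ℕ.+ m
      n≡2+m = ≡.sym (ℕ.m+[n∸m]≡n 1<n)

      Φ³∏≈P : Φ n R.^ 3 R.* R.∏ m f R.≈ P
      Φ³∏≈P = R.trans
        (R.solve 2 (λ x y → x R.:^ 3 R.:* y R.:= (x R.:* y) R.:* (x R.:* x)) R.refl (Φ n) (R.∏ m f))
        (R.*-congʳ {Φ n R.* Φ n} (R.sym (q-integer m n≡2+m (factorised (s≤s z≤n)) (factorised 0<n))))

      2+i<n : ∀ {i} → i < m → 2 ℕ.+ i < n
      2+i<n {i} i<m = ≡.subst (2 ℕ.+ i <_) (≡.sym n≡2+m) (ℕ.+-monoʳ-< 2 i<m)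

      -- Continuations with equations for `f i` spare the goals that mention `f` from abstraction
      -- over the divisor test.
      f-cases : ∀ {i} {A : Set} → (f i ≡ R.1# → A) → ((2 ℕ.+ i) ∣ n → f i ≡ Φ (2 ℕ.+ i) → A) → A
      f-cases {i} no-case yes-case = by-dec ((2 ℕ.+ i) ∣? n)
        where
        by-dec : _ → _
        by-dec (yes i∣n) = yes-case i∣n (Φ∣-≡ {n} {2 ℕ.+ i} i∣n)
        by-dec (no  i∤n) = no-case (Φ∣-∤ {n} {2 ℕ.+ i} i∤n)

      Φ⊥f : ∀ {d i} → 0 < d → d ≢ 2 ℕ.+ i → Comaximal (Φ d) (f i)
      Φ⊥f {d} {i} 0<d d≢ = f-cases {i}
        (λ eq → ≡.subst (Comaximal (Φ d)) (≡.sym eq) cop-1)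
        (λ _ eq → ≡.subst (Comaximal (Φ d)) (≡.sym eq) (Φ⊥Φ 0<d (s≤s z≤n) d≢))

      f⊥f : ∀ {i j} → i < j → j < m → Comaximal (f i) (f j)
      f⊥f {i} {j} i<j _ = f-cases {i}
        (λ eq → ≡.subst (λ g → Comaximal g (f j)) (≡.sym eq) (cop-sym cop-1))
        (λ _ eq → ≡.subst (λ g → Comaximal g (f j)) (≡.sym eq) (Φ⊥f {2 ℕ.+ i} {j} (s≤s z≤n) (ℕ.<⇒≢ (ℕ.+-monoʳ-< 2 i<j))))

      -- One of the three factors Φ_n comes from [n] and two from Φ_n²; every other Φ_d occurs once
      -- in [n].
      assemble : ∀ {x} → At.Order (Φ n) 3 x → (∀ {d} → 1 < d → d ∣ n → At.Order (Φ d) 1 x) → Divides P x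
      assemble {x} cubic simple = divides-resp Φ³∏≈P (divides-∏ m {Φ n R.^ 3} {x} {f} (At.order⇒divides (Φ n) cubic) factor f⊥f)
        where
        factor : ∀ {i} → i < m → f i R.≈ R.1# ⊎ Comaximal (Φ n R.^ 3) (f i) × Divides (f i) x
        factor {i} i<m = f-cases {i} (λ eq → inj₁ (R.reflexive eq)) λ i∣n eq → inj₂
          ( cop-sym (cop-^ 3 (cop-sym (Φ⊥f {n} {i} 0<n (ℕ.<⇒≢ (2+i<n i<m) ∘ ≡.sym))))
          , ≡.subst (λ g → Divides g x) (≡.sym eq) (divides-resp (R.*-identityʳ (Φ (2 ℕ.+ i)))
            (At.order⇒divides (Φ (2 ℕ.+ i)) (simple (s≤s (s≤s z≤n)) i∣n))))

      module _ (inv : CommutativeRing.Carrier K → CommutativeRing.Carrier K)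
        (inv-unique : ∀ {x y} → CommutativeRing._≈_ K (CommutativeRing._*_ K x y) (CommutativeRing.1# K) → CommutativeRing._≈_ K (inv x) y)
        where
        open RingKit K
        open QBase base using (H⁻¹)
        open QSeries base using (c; module Deformed)
        open Quotients base inv inv-unique using (module Error)

        module _ (summand : ℕ → Carrier) (value : Carrier)
          (summand≈c : ∀ k → summand k ≈ H⁻¹ 1 * c k) (value≈S : value ≈ H⁻¹ 1 * Deformed.S N N) where
          open Error N summand value summand≈c value≈S

          P∣truncated : Divides P (∑ (suc N) summand - value)
          P∣truncated = assemble (AtPlace.truncated∈₃ (place-at 1<n ℕ.∣-refl) ℕ.∣-refl ≡.refl)
            (λ 1<d d∣n → AtPlace.truncated∈ (place-at 1<d d∣n) d∣n)

          P∣full : Divides P (∑ n summand - value)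
          P∣full = assemble (AtPlace.full∈₃ (place-at 1<n ℕ.∣-refl) ℕ.∣-refl ≡.refl)
            (λ 1<d d∣n → AtPlace.full∈ (place-at 1<d d∣n) d∣n)

import Defs as D
open import Defs using (ℤ[q]; coeff; _≈ₚ_; _≉ₚ_; _+ₚ_; _*ₚ_; _·ₚ_; -ₚ_; _^ₚ_; 0ₚ; 1ₚ; qₚ; productₚ; coeff-+; coeff-·; coeff-∷*; *-zero-product; zero?; degree; quotRem; quotₚ; Φ; Coprimeₚ; ℚ⟨q⟩; num; den; den≉0; ι)

-- Polynomials over ℤ

-- _≈ₚ_ as a record, so that f and g can be inferred from f ≋ g.
infix 4 _≋_
record _≋_ (f g : ℤ[q]) : Set where
  constructor ⟪_⟫
  field at : f ≈ₚ g
open _≋_ public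

module PolyLaws where
  open ≡.≡-Reasoning
  open +-*-Solver using (solve; _:+_; _:*_; _:=_; con)

  ∷-cong : ∀ {a b f g} → a ≡ b → f ≋ g → (a ∷ f) ≋ (b ∷ g)
  ∷-cong a≡b f≋g = ⟪ (λ { zero → a≡b ; (suc i) → at f≋g i }) ⟫

  +-cong : ∀ {f f′ g g′} → f ≋ f′ → g ≋ g′ → f +ₚ g ≋ f′ +ₚ g′
  +-cong {f} {f′} {g} {g′} p r = ⟪ (λ i → ≡.trans (coeff-+ f g i)
    (≡.trans (≡.cong₂ ℤ._+_ (at p i) (at r i)) (≡.sym (coeff-+ f′ g′ i)))) ⟫

  ·-cong : ∀ c {f f′} → f ≋ f′ → c ·ₚ f ≋ c ·ₚ f′
  ·-cong c {f} {f′} p = ⟪ (λ i → ≡.trans (coeff-· c f i)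
    (≡.trans (≡.cong (c ℤ.*_) (at p i)) (≡.sym (coeff-· c f′ i)))) ⟫

  +-assoc : ∀ f g h → (f +ₚ g) +ₚ h ≋ f +ₚ (g +ₚ h)
  +-assoc f g h = ⟪ (λ i → begin
    coeff ((f +ₚ g) +ₚ h) i  ≡⟨ coeff-+ (f +ₚ g) h i ⟩
    coeff (f +ₚ g) i ℤ.+ coeff h i  ≡⟨ ≡.cong (ℤ._+ coeff h i) (coeff-+ f g i) ⟩
    coeff f i ℤ.+ coeff g i ℤ.+ coeff h i  ≡⟨ ℤ.+-assoc (coeff f i) (coeff g i) (coeff h i) ⟩
    coeff f i ℤ.+ (coeff g i ℤ.+ coeff h i)  ≡⟨ ≡.cong (λ z → coeff f i ℤ.+ z) (coeff-+ g h i) ⟨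
    coeff f i ℤ.+ coeff (g +ₚ h) i  ≡⟨ coeff-+ f (g +ₚ h) i ⟨
    coeff (f +ₚ (g +ₚ h)) i  ∎) ⟫

  +-comm : ∀ f g → f +ₚ g ≋ g +ₚ f
  +-comm f g = ⟪ (λ i → ≡.trans (coeff-+ f g i)
    (≡.trans (ℤ.+-comm (coeff f i) (coeff g i)) (≡.sym (coeff-+ g f i)))) ⟫

  -‿inverseʳ : ∀ f → f +ₚ -ₚ f ≋ 0ₚ
  -‿inverseʳ f = ⟪ (λ i → begin
    coeff (f +ₚ -ₚ f) i  ≡⟨ coeff-+ f (-ₚ f) i ⟩
    coeff f i ℤ.+ coeff (-ₚ f) i  ≡⟨ ≡.cong (λ z → coeff f i ℤ.+ z) (coeff-· -1ℤ f i) ⟩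
    coeff f i ℤ.+ -1ℤ ℤ.* coeff f i  ≡⟨ solve 1 (λ x → x :+ con -1ℤ :* x := con 0ℤ) ≡.refl (coeff f i) ⟩
    0ℤ  ∎) ⟫

  *-congˡ : ∀ f {g g′} → g ≋ g′ → f *ₚ g ≋ f *ₚ g′
  *-congˡ []      p = ⟪ (λ _ → ≡.refl) ⟫
  *-congˡ (a ∷ f) p = +-cong (·-cong a p) (∷-cong ≡.refl (*-congˡ f p))

  *-zeroʳ : ∀ f → f *ₚ 0ₚ ≋ 0ₚ
  *-zeroʳ []      = ⟪ (λ _ → ≡.refl) ⟫
  *-zeroʳ (a ∷ f) = ⟪ (λ { zero → ≡.refl ; (suc i) → at (*-zeroʳ f) i }) ⟫

  *-∷ : ∀ f b g → f *ₚ (b ∷ g) ≋ (b ·ₚ f) +ₚ (0ℤ ∷ (f *ₚ g))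
  *-∷ []      b g = ⟪ (λ { zero → ≡.refl ; (suc i) → ≡.refl }) ⟫
  *-∷ (a ∷ f) b g = ⟪ (λ
    { zero → ≡.cong (ℤ._+ 0ℤ) (ℤ.*-comm a b)
    ; (suc j) → begin
      coeff ((a ∷ f) *ₚ (b ∷ g)) (suc j)
        ≡⟨ coeff-∷* a f (b ∷ g) (suc j) ⟩
      a ℤ.* coeff g j ℤ.+ coeff (f *ₚ (b ∷ g)) j
        ≡⟨ ≡.cong (λ z → a ℤ.* coeff g j ℤ.+ z) (≡.trans (at (*-∷ f b g) j) (coeff-+ (b ·ₚ f) _ j)) ⟩
      a ℤ.* coeff g j ℤ.+ (coeff (b ·ₚ f) j ℤ.+ coeff (0ℤ ∷ (f *ₚ g)) j)
        ≡⟨ solve 3 (λ x y z → x :+ (y :+ z) := y :+ (x :+ z)) ≡.refl (a ℤ.* coeff g j) (coeff (b ·ₚ f) j) (coeff (0ℤ ∷ (f *ₚ g)) j) ⟩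
      coeff (b ·ₚ f) j ℤ.+ (a ℤ.* coeff g j ℤ.+ coeff (0ℤ ∷ (f *ₚ g)) j)
        ≡⟨ ≡.cong (λ z → coeff (b ·ₚ f) j ℤ.+ z) (coeff-∷* a f g j) ⟨
      coeff (b ·ₚ f) j ℤ.+ coeff ((a ∷ f) *ₚ g) j
        ≡⟨ coeff-+ (b ·ₚ f) ((a ∷ f) *ₚ g) j ⟨
      coeff ((b ·ₚ (a ∷ f)) +ₚ (0ℤ ∷ ((a ∷ f) *ₚ g))) (suc j) ∎ }) ⟫

  ≋-sym : ∀ {f g} → f ≋ g → g ≋ f
  ≋-sym p = ⟪ (λ i → ≡.sym (at p i)) ⟫

  ≋-trans : ∀ {f g h} → f ≋ g → g ≋ h → f ≋ h
  ≋-trans p r = ⟪ (λ i → ≡.trans (at p i) (at r i)) ⟫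

  ≋-refl : ∀ {f} → f ≋ f
  ≋-refl = ⟪ (λ _ → ≡.refl) ⟫

  *-comm : ∀ f g → f *ₚ g ≋ g *ₚ f
  *-comm []      g = ≋-sym (*-zeroʳ g)
  *-comm (a ∷ f) g = ≋-trans (+-cong (≋-refl {a ·ₚ g}) (∷-cong ≡.refl (*-comm f g))) (≋-sym (*-∷ g a f))

  *-cong : ∀ {f f′ g g′} → f ≋ f′ → g ≋ g′ → f *ₚ g ≋ f′ *ₚ g′
  *-cong {f} {f′} {g} {g′} p r =
    ≋-trans (*-congˡ f r) (≋-trans (*-comm f g′) (≋-trans (*-congˡ g′ p) (*-comm g′ f′)))

  interchange : ∀ f g h k → (f +ₚ g) +ₚ (h +ₚ k) ≋ (f +ₚ h) +ₚ (g +ₚ k)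
  interchange f g h k = ≋-trans (+-assoc f g (h +ₚ k)) (≋-trans
    (+-cong (≋-refl {f}) (≋-trans (≋-sym (+-assoc g h k)) (≋-trans (+-cong (+-comm g h) (≋-refl {k})) (+-assoc h g k))))
    (≋-sym (+-assoc f h (g +ₚ k))))

  ·-+ : ∀ c f g → c ·ₚ (f +ₚ g) ≋ c ·ₚ f +ₚ c ·ₚ g
  ·-+ c f g = ⟪ (λ i → begin
    coeff (c ·ₚ (f +ₚ g)) i  ≡⟨ coeff-· c (f +ₚ g) i ⟩
    c ℤ.* coeff (f +ₚ g) i  ≡⟨ ≡.cong (c ℤ.*_) (coeff-+ f g i) ⟩
    c ℤ.* (coeff f i ℤ.+ coeff g i)  ≡⟨ ℤ.*-distribˡ-+ c (coeff f i) (coeff g i) ⟩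
    c ℤ.* coeff f i ℤ.+ c ℤ.* coeff g i  ≡⟨ ≡.cong₂ ℤ._+_ (coeff-· c f i) (coeff-· c g i) ⟨
    coeff (c ·ₚ f) i ℤ.+ coeff (c ·ₚ g) i  ≡⟨ coeff-+ (c ·ₚ f) (c ·ₚ g) i ⟨
    coeff (c ·ₚ f +ₚ c ·ₚ g) i  ∎) ⟫

  ·-· : ∀ c d f → c ·ₚ (d ·ₚ f) ≋ (c ℤ.* d) ·ₚ f
  ·-· c d f = ⟪ (λ i → begin
    coeff (c ·ₚ (d ·ₚ f)) i  ≡⟨ ≡.trans (coeff-· c (d ·ₚ f) i) (≡.cong (c ℤ.*_) (coeff-· d f i)) ⟩
    c ℤ.* (d ℤ.* coeff f i)  ≡⟨ ℤ.*-assoc c d (coeff f i) ⟨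
    c ℤ.* d ℤ.* coeff f i  ≡⟨ coeff-· (c ℤ.* d) f i ⟨
    coeff ((c ℤ.* d) ·ₚ f) i  ∎) ⟫

  *-distribˡ : ∀ f g h → f *ₚ (g +ₚ h) ≋ f *ₚ g +ₚ f *ₚ h
  *-distribˡ []      g h = ≋-refl
  *-distribˡ (a ∷ f) g h = ≋-trans
    (+-cong (·-+ a g h) (∷-cong {0ℤ} {0ℤ ℤ.+ 0ℤ} ≡.refl (*-distribˡ f g h)))
    (interchange (a ·ₚ g) (a ·ₚ h) (0ℤ ∷ (f *ₚ g)) (0ℤ ∷ (f *ₚ h)))

  *-distribʳ : ∀ h f g → (f +ₚ g) *ₚ h ≋ f *ₚ h +ₚ g *ₚ h
  *-distribʳ h f g = ≋-trans (*-comm (f +ₚ g) h) (≋-trans (*-distribˡ h f g) (+-cong (*-comm h f) (*-comm h g)))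

  ·-* : ∀ c f g → (c ·ₚ f) *ₚ g ≋ c ·ₚ (f *ₚ g)
  ·-* c []      g = ≋-refl
  ·-* c (a ∷ f) g = ≋-trans
    (+-cong (≋-sym (·-· c a g)) (∷-cong (≡.sym (ℤ.*-zeroʳ c)) (·-* c f g)))
    (≋-sym (·-+ c (a ·ₚ g) (0ℤ ∷ (f *ₚ g))))

  0∷-* : ∀ f g → (0ℤ ∷ f) *ₚ g ≋ 0ℤ ∷ (f *ₚ g)
  0∷-* f g = ⟪ (λ i → ≡.trans (coeff-∷* 0ℤ f g i) (ℤ.+-identityˡ _)) ⟫

  *-assoc : ∀ f g h → (f *ₚ g) *ₚ h ≋ f *ₚ (g *ₚ h)
  *-assoc []      g h = ≋-refl
  *-assoc (a ∷ f) g h = ≋-trans (*-distribʳ h (a ·ₚ g) (0ℤ ∷ (f *ₚ g)))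
    (+-cong (·-* a g h) (≋-trans (0∷-* (f *ₚ g) h) (∷-cong ≡.refl (*-assoc f g h))))

  cst-* : ∀ c f → (c ∷ []) *ₚ f ≋ c ·ₚ f
  cst-* c f = ⟪ (λ i → ≡.trans (coeff-∷* c [] f i) (≡.trans (≡.cong (λ z → c ℤ.* coeff f i ℤ.+ z) (0s i))
    (≡.trans (ℤ.+-identityʳ _) (≡.sym (coeff-· c f i))))) ⟫
    where
    0s : ∀ i → coeff (0ℤ ∷ []) i ≡ 0ℤ
    0s zero    = ≡.refl
    0s (suc i) = ≡.refl

  *-identityˡ : ∀ f → 1ₚ *ₚ f ≋ f
  *-identityˡ f = ≋-trans (cst-* 1ℤ f) ⟪ (λ i → ≡.trans (coeff-· 1ℤ f i) (ℤ.*-identityˡ _)) ⟫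

  +-identityʳ : ∀ f → f +ₚ 0ₚ ≋ f
  +-identityʳ f = +-comm f 0ₚ

ℤ[q]-commutativeRing : CommutativeRing 0ℓ 0ℓ
ℤ[q]-commutativeRing = record
  { Carrier = ℤ[q]
  ; _≈_     = _≋_
  ; _+_     = _+ₚ_
  ; _*_     = _*ₚ_
  ; -_      = -ₚ_
  ; 0#      = 0ₚ
  ; 1#      = 1ₚ
  ; isCommutativeRing = record
    { isRing = record
      { +-isAbelianGroup = record
        { isGroup = record
          { isMonoid = record
            { isSemigroup = record
              { isMagma = record
                { isEquivalence = record { refl = ≋-refl ; sym = ≋-sym ; trans = ≋-trans }
                ; ∙-cong = +-cong }
              ; assoc = +-assoc }
            ; identity = (λ _ → ≋-refl) , +-identityʳ }
          ; inverse = (λ f → ≋-trans (+-comm (-ₚ f) f) (-‿inverseʳ f)) , -‿inverseʳ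
          ; ⁻¹-cong = ·-cong -1ℤ }
        ; comm = +-comm }
      ; *-cong = *-cong
      ; *-assoc = *-assoc
      ; *-identity = *-identityˡ , (λ f → ≋-trans (*-comm f 1ₚ) (*-identityˡ f))
      ; distrib = *-distribˡ , *-distribʳ
      }
    ; *-comm = *-comm
    }
  }
  where open PolyLaws

-- Division by monic polynomials

record Monic (g : ℤ[q]) (m : ℕ) : Set where
  constructor monic
  field
    leading : coeff g m ≡ 1ℤ
    above   : ∀ {i} → m < i → coeff g i ≡ 0ℤ

module Division where
  open Monic
  open ≡.≡-Reasoning
  open +-*-Solver using (solve; _:+_; _:*_; _:=_; :-_; _:-_; con)
  open PolyLaws using (≋-refl; ≋-sym; ≋-trans)
  open CommutativeRing ℤ[q]-commutativeRing using (_-_)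

  0≢1 : ¬ (0ℤ ≡ 1ℤ)
  0≢1 ()

  degree-monic : ∀ g {m} → Monic g m → degree g ≡ m
  degree-monic []      g-monic = ⊥-elim (0≢1 (leading g-monic))
  degree-monic (a ∷ g) {m} g-monic with zero? g
  degree-monic (a ∷ g) {zero}  g-monic | yes _ = ≡.refl
  degree-monic (a ∷ g) {suc m} g-monic | yes g≈0 = ⊥-elim (0≢1 (≡.trans (≡.sym (g≈0 m)) (leading g-monic)))
  degree-monic (a ∷ g) {zero}  g-monic | no g≉0 = ⊥-elim (g≉0 λ i → above g-monic (s≤s z≤n))
  degree-monic (a ∷ g) {suc m} g-monic | no _ =
    ≡.cong suc (degree-monic g (monic (leading g-monic) λ m<i → above g-monic (s≤s m<i)))

  Below : ℤ[q] → ℕ → Set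
  Below f m = ∀ {i} → m ≤ i → coeff f i ≡ 0ℤ

  -- The uniqueness half of division. For i ≥ m the coefficient i + 1 of (a + q h) g is the
  -- coefficient i of h g, so the hypothesis passes to the tail; afterwards coefficient m reads a =
  -- 0.
  small-multiple : ∀ h {g m} → Monic g m → Below (h *ₚ g) m → h ≋ 0ₚ
  small-multiple []      g-monic hg<m = ≋-refl
  small-multiple (a ∷ h) {g} {m} g-monic hg<m = ⟪ (λ { zero → a≡0 ; (suc i) → at h≋0 i }) ⟫
    where
    h≋0 : h ≋ 0ₚ
    h≋0 = small-multiple h g-monic λ {i} m≤i → begin
      coeff (h *ₚ g) i  ≡⟨ ℤ.+-identityˡ _ ⟨
      0ℤ ℤ.+ coeff (h *ₚ g) i  ≡⟨ ≡.cong (ℤ._+ coeff (h *ₚ g) i) (ℤ.*-zeroʳ a) ⟨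
      a ℤ.* 0ℤ ℤ.+ coeff (h *ₚ g) i  ≡⟨ ≡.cong (λ z → a ℤ.* z ℤ.+ coeff (h *ₚ g) i) (above g-monic (s≤s m≤i)) ⟨
      a ℤ.* coeff g (suc i) ℤ.+ coeff (h *ₚ g) i  ≡⟨ coeff-∷* a h g (suc i) ⟨
      coeff ((a ∷ h) *ₚ g) (suc i)  ≡⟨ hg<m (ℕ.m≤n⇒m≤1+n m≤i) ⟩
      0ℤ  ∎
    shifted≡0 : ∀ i → coeff (0ℤ ∷ (h *ₚ g)) i ≡ 0ℤ
    shifted≡0 zero    = ≡.refl
    shifted≡0 (suc i) = at (PolyLaws.*-cong h≋0 (≋-refl {g})) i
    a≡0 : a ≡ 0ℤ
    a≡0 = begin
      a  ≡⟨ solve 1 (λ x → x := x :* con 1ℤ :+ con 0ℤ) ≡.refl a ⟩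
      a ℤ.* 1ℤ ℤ.+ 0ℤ  ≡⟨ ≡.cong₂ (λ x y → a ℤ.* x ℤ.+ y) (leading g-monic) (shifted≡0 m) ⟨
      a ℤ.* coeff g m ℤ.+ coeff (0ℤ ∷ (h *ₚ g)) m  ≡⟨ coeff-∷* a h g m ⟨
      coeff ((a ∷ h) *ₚ g) m  ≡⟨ hg<m ℕ.≤-refl ⟩
      0ℤ  ∎

  quotRem-spec : ∀ f {g m} → Monic g m →
    f ≋ proj₁ (quotRem f g) *ₚ g +ₚ proj₂ (quotRem f g) × Below (proj₂ (quotRem f g)) m
  quotRem-spec []      g-monic = ≋-refl , λ _ → ≡.refl
  quotRem-spec (a ∷ f) {g} {m} g-monic with quotRem f g | quotRem-spec f g-monic
  ... | Q , R | f≋ , R<m = ⟪ (λ i → ≡.sym (equation i)) ⟫ , remainder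
    where
    c = coeff (a ∷ R) (degree g)
    tail : ∀ i → coeff (a ∷ R) i ℤ.+ coeff (0ℤ ∷ (Q *ₚ g)) i ≡ coeff (a ∷ f) i
    tail zero    = ℤ.+-identityʳ a
    tail (suc i) = ≡.trans (ℤ.+-comm (coeff R i) _) (≡.sym (≡.trans (at f≋ i) (coeff-+ (Q *ₚ g) R i)))
    equation : ∀ i → coeff ((c ∷ Q) *ₚ g +ₚ ((a ∷ R) +ₚ (ℤ.- c) ·ₚ g)) i ≡ coeff (a ∷ f) i
    equation i = begin
      coeff ((c ∷ Q) *ₚ g +ₚ ((a ∷ R) +ₚ (ℤ.- c) ·ₚ g)) i
        ≡⟨ coeff-+ ((c ∷ Q) *ₚ g) _ i ⟩
      coeff ((c ∷ Q) *ₚ g) i ℤ.+ coeff ((a ∷ R) +ₚ (ℤ.- c) ·ₚ g) i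
        ≡⟨ ≡.cong₂ ℤ._+_ (coeff-∷* c Q g i) (≡.trans (coeff-+ (a ∷ R) ((ℤ.- c) ·ₚ g) i)
          (≡.cong (λ z → coeff (a ∷ R) i ℤ.+ z) (coeff-· (ℤ.- c) g i))) ⟩
      (c ℤ.* coeff g i ℤ.+ coeff (0ℤ ∷ (Q *ₚ g)) i) ℤ.+ (coeff (a ∷ R) i ℤ.+ (ℤ.- c) ℤ.* coeff g i)
        ≡⟨ solve 4 (λ c x y z → (c :* x :+ y) :+ (z :+ (:- c) :* x) := z :+ y) ≡.refl c (coeff g i) (coeff (0ℤ ∷ (Q *ₚ g)) i)
          (coeff (a ∷ R) i) ⟩
      coeff (a ∷ R) i ℤ.+ coeff (0ℤ ∷ (Q *ₚ g)) i
        ≡⟨ tail i ⟩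
      coeff (a ∷ f) i ∎
    at-top : coeff (a ∷ R) m ℤ.+ (ℤ.- c) ℤ.* coeff g m ≡ 0ℤ
    at-top = begin
      coeff (a ∷ R) m ℤ.+ (ℤ.- c) ℤ.* coeff g m  ≡⟨ ≡.cong₂ (λ k x → coeff (a ∷ R) k ℤ.+ (ℤ.- c) ℤ.* x) (≡.sym (degree-monic g g-monic))
        (leading g-monic) ⟩
      c ℤ.+ (ℤ.- c) ℤ.* 1ℤ  ≡⟨ solve 1 (λ c → c :+ (:- c) :* con 1ℤ := con 0ℤ) ≡.refl c ⟩
      0ℤ  ∎
    beyond : ∀ {i} → m < i → coeff (a ∷ R) i ℤ.+ (ℤ.- c) ℤ.* coeff g i ≡ 0ℤ
    beyond {suc i} m<i@(s≤s m≤i) = ≡.trans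
      (≡.cong₂ (λ x y → x ℤ.+ (ℤ.- c) ℤ.* y) (R<m m≤i) (above g-monic m<i))
      (≡.trans (ℤ.+-identityˡ _) (ℤ.*-zeroʳ (ℤ.- c)))
    remainder : Below ((a ∷ R) +ₚ (ℤ.- c) ·ₚ g) m
    remainder {i} m≤i = ≡.trans (≡.trans (coeff-+ (a ∷ R) ((ℤ.- c) ·ₚ g) i)
      (≡.cong (λ z → coeff (a ∷ R) i ℤ.+ z) (coeff-· (ℤ.- c) g i))) (value m≤i)
      where
      value : ∀ {i} → m ≤ i → coeff (a ∷ R) i ℤ.+ (ℤ.- c) ℤ.* coeff g i ≡ 0ℤ
      value m≤i with ℕ.m≤n⇒m<n∨m≡n m≤i
      ... | inj₁ m<i    = beyond m<i
      ... | inj₂ ≡.refl = at-top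

  -- Gives monicity of Φ n, a quotient of monic polynomials. Dropping the constant coefficient of h
  -- lowers the degree of the product by one, until h is a constant; then the degrees agree and the
  -- constant is 1.
  monic-quotient : ∀ h {g f m M} → Monic g m → Monic f M → h *ₚ g ≋ f → ∃[ k ] Monic h k
  monic-quotient [] {M = M} g-monic f-monic hg≋f = ⊥-elim (0≢1 (≡.trans (at hg≋f M) (leading f-monic)))
  monic-quotient (a ∷ h) {g} {f} {m} {M} g-monic f-monic hg≋f with zero? h
  ... | yes h≈0 = 0 , monic a≡1 λ { {suc i} _ → h≈0 i }
    where
    coeff-f : ∀ i → coeff f i ≡ a ℤ.* coeff g i
    coeff-f i = begin
      coeff f i  ≡⟨ at hg≋f i ⟨
      coeff ((a ∷ h) *ₚ g) i  ≡⟨ coeff-∷* a h g i ⟩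
      a ℤ.* coeff g i ℤ.+ coeff (0ℤ ∷ (h *ₚ g)) i  ≡⟨ ≡.cong (λ z → a ℤ.* coeff g i ℤ.+ z) (shifted≡0 i) ⟩
      a ℤ.* coeff g i ℤ.+ 0ℤ  ≡⟨ ℤ.+-identityʳ _ ⟩
      a ℤ.* coeff g i  ∎
      where
      shifted≡0 : ∀ i → coeff (0ℤ ∷ (h *ₚ g)) i ≡ 0ℤ
      shifted≡0 zero    = ≡.refl
      shifted≡0 (suc i) = at (PolyLaws.*-cong {h} {0ₚ} ⟪ h≈0 ⟫ (≋-refl {g})) i
    f-top : coeff f m ≡ a
    f-top = ≡.trans (coeff-f m) (≡.trans (≡.cong (a ℤ.*_) (leading g-monic)) (ℤ.*-identityʳ a))
    a≡1 : a ≡ 1ℤ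
    a≡1 with ℕ.<-cmp m M
    ... | tri≈ _ ≡.refl _ = ≡.trans (≡.sym f-top) (leading f-monic)
    ... | tri< m<M _ _ = ⊥-elim (0≢1 (≡.trans (≡.sym (≡.trans (coeff-f M)
                           (≡.trans (≡.cong (a ℤ.*_) (above g-monic m<M)) (ℤ.*-zeroʳ a)))) (leading f-monic)))
    ... | tri> _ _ M<m = ⊥-elim (0≢1 (≡.trans (≡.sym (≡.trans (coeff-f M)
                           (≡.cong (ℤ._* coeff g M) (≡.trans (≡.sym f-top) (above f-monic M<m))))) (leading f-monic)))
  ... | no h≉0 = shift (ℕ.<-cmp m M)
    where
    coeff-hg : ∀ {i} → m ≤ i → coeff (h *ₚ g) i ≡ coeff f (suc i)
    coeff-hg {i} m≤i = ≡.sym (begin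
      coeff f (suc i)  ≡⟨ at hg≋f (suc i) ⟨
      coeff ((a ∷ h) *ₚ g) (suc i)  ≡⟨ coeff-∷* a h g (suc i) ⟩
      a ℤ.* coeff g (suc i) ℤ.+ coeff (h *ₚ g) i  ≡⟨ ≡.cong (λ z → a ℤ.* z ℤ.+ coeff (h *ₚ g) i) (above g-monic (s≤s m≤i)) ⟩
      a ℤ.* 0ℤ ℤ.+ coeff (h *ₚ g) i  ≡⟨ ≡.cong (ℤ._+ coeff (h *ₚ g) i) (ℤ.*-zeroʳ a) ⟩
      0ℤ ℤ.+ coeff (h *ₚ g) i  ≡⟨ ℤ.+-identityˡ _ ⟩
      coeff (h *ₚ g) i  ∎)
    impossible : M ≤ m → ∃[ k ] Monic (a ∷ h) k
    impossible M≤m = ⊥-elim (h≉0 (at (small-multiple h g-monic λ {i} m≤i →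
      ≡.trans (coeff-hg m≤i) (above f-monic (s≤s (ℕ.≤-trans M≤m m≤i))))))
    shift : _ → ∃[ k ] Monic (a ∷ h) k
    shift (tri≈ _ m≡M _) = impossible (ℕ.≤-reflexive (≡.sym m≡M))
    shift (tri> _ _ M<m) = impossible (ℕ.<⇒≤ M<m)
    shift (tri< (s≤s {n = M′} m≤M′) _ _) with monic-quotient h {f = h *ₚ g} {M = M′} g-monic
        (monic (≡.trans (coeff-hg m≤M′) (leading f-monic))
               λ M′<i → ≡.trans (coeff-hg (ℕ.≤-trans m≤M′ (ℕ.<⇒≤ M′<i))) (above f-monic (s≤s M′<i)))
        ≋-refl
    ... | k , h-monic = suc k , monic (leading h-monic) λ { (s≤s k<i) → above h-monic k<i }

  monic-* : ∀ f {g k m} → Monic f k → Monic g m → Monic (f *ₚ g) (k ℕ.+ m)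
  monic-* []      f-monic g-monic = ⊥-elim (0≢1 (leading f-monic))
  monic-* (a ∷ f) {g} {zero} {m} f-monic g-monic = monic (≡.trans (coeff-fg m) (leading g-monic)) λ {i} m<i → ≡.trans (coeff-fg i)
    (above g-monic m<i)
    where
    shifted≡0 : ∀ i → coeff (0ℤ ∷ (f *ₚ g)) i ≡ 0ℤ
    shifted≡0 zero    = ≡.refl
    shifted≡0 (suc i) = at (PolyLaws.*-cong {f} {0ₚ} ⟪ (λ i → above f-monic (s≤s z≤n)) ⟫ (≋-refl {g})) i
    coeff-fg : ∀ i → coeff ((a ∷ f) *ₚ g) i ≡ coeff g i
    coeff-fg i = begin
      coeff ((a ∷ f) *ₚ g) i  ≡⟨ coeff-∷* a f g i ⟩
      a ℤ.* coeff g i ℤ.+ coeff (0ℤ ∷ (f *ₚ g)) i  ≡⟨ ≡.cong₂ (λ x y → x ℤ.* coeff g i ℤ.+ y) (leading f-monic) (shifted≡0 i) ⟩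
      1ℤ ℤ.* coeff g i ℤ.+ 0ℤ  ≡⟨ ≡.trans (ℤ.+-identityʳ _) (ℤ.*-identityˡ _) ⟩
      coeff g i  ∎
  monic-* (a ∷ f) {g} {suc k} {m} f-monic g-monic =
    monic (≡.trans (coeff-fg (ℕ.m≤n+m m k)) (leading fg-monic))
      λ { (s≤s k+m<i) → ≡.trans (coeff-fg (ℕ.≤-trans (ℕ.m≤n+m m k) (ℕ.<⇒≤ k+m<i))) (above fg-monic k+m<i) }
    where
    fg-monic = monic-* f {g} {k} {m} (monic (leading f-monic) λ k<i → above f-monic (s≤s k<i)) g-monic
    coeff-fg : ∀ {i} → m ≤ i → coeff ((a ∷ f) *ₚ g) (suc i) ≡ coeff (f *ₚ g) i
    coeff-fg {i} m≤i = begin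
      coeff ((a ∷ f) *ₚ g) (suc i)  ≡⟨ coeff-∷* a f g (suc i) ⟩
      a ℤ.* coeff g (suc i) ℤ.+ coeff (f *ₚ g) i  ≡⟨ ≡.cong (λ z → a ℤ.* z ℤ.+ coeff (f *ₚ g) i) (above g-monic (s≤s m≤i)) ⟩
      a ℤ.* 0ℤ ℤ.+ coeff (f *ₚ g) i  ≡⟨ ≡.cong (ℤ._+ coeff (f *ₚ g) i) (ℤ.*-zeroʳ a) ⟩
      0ℤ ℤ.+ coeff (f *ₚ g) i  ≡⟨ ℤ.+-identityˡ _ ⟩
      coeff (f *ₚ g) i  ∎

cst : ℤ → ℤ[q]
cst z = z ∷ []

module PolyDivisibility where
  open RingKit ℤ[q]-commutativeRing
  open Algebra.Properties.AbelianGroup +-abelianGroup using () renaming (x∙y⁻¹≈ε⇒x≈y to x-y≈0⇒x≈y)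
  open Division

  cst-*-cst : ∀ y z → cst y * cst z ≈ cst (y ℤ.* z)
  cst-*-cst y z = PolyLaws.cst-* y (cst z)

  cst-cancel : ∀ {z f g} → z ≢ 0ℤ → cst z * f ≈ cst z * g → f ≈ g
  cst-cancel {z} {f} {g} z≢0 eq = ⟪ (λ i → ℤ.*-cancelˡ-≡ z _ _ {{ℤ.≢-nonZero z≢0}}
    (≡.trans (≡.sym (coeff-cst f i)) (≡.trans (at eq i) (coeff-cst g i)))) ⟫
    where
    coeff-cst : ∀ h i → coeff (cst z * h) i ≡ z ℤ.* coeff h i
    coeff-cst h i = ≡.trans (at (PolyLaws.cst-* z h) i) (coeff-· z h i)

  Below-cst : ∀ z {f m} → Below f m → Below (cst z * f) m
  Below-cst z {f} f<m {i} m≤i = ≡.trans (≡.trans (at (PolyLaws.cst-* z f) i) (coeff-· z f i))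
    (≡.trans (≡.cong (z ℤ.*_) (f<m m≤i)) (ℤ.*-zeroʳ z))

  -- A Gauss lemma for monic g: if f = Q g + R, then (w - z Q) g = z R has degree below that of g,
  -- so w = z Q. It clears the integer constants left by comaximality.
  monic-multiple : ∀ {z w f g m} → Monic g m → z ≢ 0ℤ → w * g ≈ cst z * f →
    ∃[ h ] w ≈ cst z * h × h * g ≈ f
  monic-multiple {z} {w} {f} {g} {m} g-monic z≢0 wg≈zf = Q , w≈zQ , cst-cancel z≢0 (begin
    cst z * (Q * g)  ≈⟨ *-assoc (cst z) Q g ⟨
    cst z * Q * g  ≈⟨ *-congʳ w≈zQ ⟨
    w * g  ≈⟨ wg≈zf ⟩
    cst z * f  ∎)
    where
    Q = proj₁ (quotRem f g)
    R = proj₂ (quotRem f g)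
    difference : (w - cst z * Q) * g ≈ cst z * R
    difference = begin
      (w - cst z * Q) * g  ≈⟨ solve 4 (λ w z Q g → (w :- z :* Q) :* g := w :* g :- z :* (Q :* g)) refl w (cst z) Q g ⟩
      w * g - cst z * (Q * g)  ≈⟨ +-congʳ (trans wg≈zf (*-congˡ {cst z} (proj₁ (quotRem-spec f g-monic)))) ⟩
      cst z * (Q * g + R) - cst z * (Q * g)  ≈⟨ solve 3 (λ z x R → z :* (x :+ R) :- z :* x := z :* R) refl (cst z) (Q * g) R ⟩
      cst z * R  ∎
    w≈zQ : w ≈ cst z * Q
    w≈zQ = x-y≈0⇒x≈y w (cst z * Q) (small-multiple (w - cst z * Q) g-monic
      λ {i} m≤i → ≡.trans (at difference i) (Below-cst z {R} (proj₂ (quotRem-spec f g-monic)) m≤i))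

  quotₚ-exact : ∀ {f g h m} → Monic g m → h * g ≈ f → quotₚ f g ≈ h
  quotₚ-exact {f} {g} {h} {m} g-monic hg≈f = sym (x-y≈0⇒x≈y h Q (small-multiple (h - Q) g-monic
      λ {i} m≤i → ≡.trans (at difference i) (proj₂ (quotRem-spec f g-monic) m≤i)))
    where
    Q = proj₁ (quotRem f g)
    R = proj₂ (quotRem f g)
    difference : (h - Q) * g ≈ R
    difference = begin
      (h - Q) * g  ≈⟨ solve 3 (λ h Q g → (h :- Q) :* g := h :* g :- Q :* g) refl h Q g ⟩
      h * g - Q * g  ≈⟨ +-congʳ (trans hg≈f (proj₁ (quotRem-spec f g-monic))) ⟩
      (Q * g + R) - Q * g  ≈⟨ solve 2 (λ x R → (x :+ R) :- x := R) refl (Q * g) R ⟩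
      R  ∎

  monic-cancel : ∀ {x y g m} → Monic g m → x * g ≈ y * g → x ≈ y
  monic-cancel {x} {y} {g} g-monic eq = x-y≈0⇒x≈y x y (small-multiple (x - y) g-monic λ {i} _ → at difference i)
    where
    difference : (x - y) * g ≈ 0#
    difference = begin
      (x - y) * g  ≈⟨ solve 3 (λ x y g → (x :- y) :* g := x :* g :- y :* g) refl x y g ⟩
      x * g - y * g  ≈⟨ +-congʳ eq ⟩
      y * g - y * g  ≈⟨ -‿inverseʳ (y * g) ⟩
      0#  ∎

  -- An integer that divides a multiple of g already divides the cofactor, as for g of content 1.
  Regular : ℤ[q] → Set
  Regular g = ∀ {z w f} → z ≢ 0ℤ → w * g ≈ cst z * f → ∃[ h ] w ≈ cst z * h

  monic⇒regular : ∀ {g m} → Monic g m → Regular g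
  monic⇒regular g-monic z≢0 eq = let h , w≈ , _ = monic-multiple g-monic z≢0 eq in h , w≈

IsConstant : ℤ[q] → Set
IsConstant c = ∃[ z ] z ≢ 0ℤ × c ≋ cst z

integers : Constants ℤ[q]-commutativeRing
integers = record
  { Const   = IsConstant
  ; Const-* = λ { (y , y≢0 , c≈) (z , z≢0 , d≈) → y ℤ.* z
      , (λ yz≡0 → [ y≢0 , z≢0 ]′ (ℤ.i*j≡0⇒i≡0∨j≡0 y yz≡0))
      , trans (*-cong c≈ d≈) (cst-*-cst y z) }
  ; Const-ℕ = λ n → + suc n , (λ ()) , ℕ-constant (suc n)
  ; Const-1 = 1ℤ , (λ ()) , refl
  }
  where
  open RingKit ℤ[q]-commutativeRing
  open PolyDivisibility
  ℕ-constant : ∀ n → n ℕ× 1ₚ ≈ cst (+ n)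
  ℕ-constant zero    = ⟪ (λ { zero → ≡.refl ; (suc i) → ≡.refl }) ⟫
  ℕ-constant (suc n) = +-congˡ {1ₚ} (ℕ-constant n)

-- Factorisation of q^n - 1 into cyclotomic polynomials

module CyclotomicPolynomials where
  open RingKit ℤ[q]-commutativeRing
  open PolyDivisibility
  open Division
  open Comaximality ℤ[q]-commutativeRing integers public
  open Cyclotomic ℤ[q]-commutativeRing integers

  1ₚ-monic : Monic 1ₚ 0
  1ₚ-monic = monic ≡.refl λ { {suc i} _ → ≡.refl }

  qₚ^-monic : ∀ n → Monic (qₚ ^ n) n
  qₚ^-monic zero    = 1ₚ-monic
  qₚ^-monic (suc n) = monic-* qₚ {k = 1} (monic ≡.refl λ { {suc zero} (s≤s ()) ; {suc (suc i)} _ → ≡.refl }) (qₚ^-monic n)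

  pow-monic : ∀ n → Monic (qₚ ^ suc n - 1ₚ) (suc n)
  pow-monic n = monic (≡.trans (coeff-suc n) (Monic.leading (qₚ^-monic (suc n))))
    λ { {suc i} n<i → ≡.trans (coeff-suc i) (Monic.above (qₚ^-monic (suc n)) n<i) }
    where
    coeff-suc : ∀ i → coeff (qₚ ^ suc n - 1ₚ) (suc i) ≡ coeff (qₚ ^ suc n) (suc i)
    coeff-suc i = ≡.trans (coeff-+ (qₚ ^ suc n) (- 1ₚ) (suc i)) (ℤ.+-identityʳ _)

  open WithBase qₚ (λ n → monic-cancel (pow-monic n)) Φ public

  ^≡^ₚ : ∀ f n → f ^ n ≡ f ^ₚ n
  ^≡^ₚ f zero    = ≡.refl
  ^≡^ₚ f (suc n) = ≡.cong (f *_) (^≡^ₚ f n)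

  -- Unfolding the recursion asks that its step respect pointwise equal recursive values. They enter
  -- only as factors of a finite product, so pointwise congruence replaces function extensionality.
  Φ-unfold : ∀ n → Φ n ≡ quotₚ (qₚ ^ n - 1ₚ) (productₚ {n} λ i → Φ∣ n (toℕ i))
  Φ-unfold n = ≡.trans (FixPoint.unfold-wfRec <-wellFounded (λ _ → ℤ[q])
    (λ n Φ< → quotₚ (qₚ ^ₚ n +ₚ -ₚ 1ₚ) (productₚ {n} λ i → if does (toℕ i ∣? n) then Φ< (toℕ<n i) else 1ₚ))
    (λ n IH≡IH′ → ≡.cong (quotₚ (qₚ ^ₚ n +ₚ -ₚ 1ₚ)) (sum-cong-≗ λ i →
      ≡.cong (λ f → if does (toℕ i ∣? n) then f else 1ₚ) (IH≡IH′ (toℕ<n i)))) {n})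
    (≡.cong (λ f → quotₚ (f - 1ₚ) (productₚ {n} λ i → Φ∣ n (toℕ i))) (≡.sym (^≡^ₚ qₚ n)))
    where open Algebra.Properties.Monoid.Sum *-monoid using (sum-cong-≗)

  record Cyc (n : ℕ) : Set where
    field
      factorised : Factorised n
      {Φ-degree} : ℕ
      Φ-monic    : Monic (Φ n) Φ-degree

  -- Factorisation and monicity are proved together: `quotₚ` is exact only for a monic divisor, and
  -- here the divisor is a product of smaller Φ.
  cyc : ∀ n → 0 < n → Cyc n
  cyc = <-rec (λ n → 0 < n → Cyc n) step
    where
    step : ∀ n → (∀ {i} → i < n → 0 < i → Cyc i) → 0 < n → Cyc n
    step n@(suc n′) IH 0<n = record { factorised = trans (*-congʳ Φ≈h) hD≈X ; Φ-monic = monic-resp (sym Φ≈h) (proj₂ h-monic) }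
      where
      X = qₚ ^ n - 1ₚ
      0∤n : ∀ {j} → j ∣ n → 0 < j
      0∤n {zero}  0∣n with () ← ℕ.0∣⇒≡0 0∣n
      0∤n {suc j} _   = s≤s z≤n

      monic-resp : ∀ {f g m} → f ≈ g → Monic f m → Monic g m
      monic-resp f≈g f-monic = monic (≡.trans (≡.sym (at f≈g _)) (Monic.leading f-monic))
        λ m<i → ≡.trans (≡.sym (at f≈g _)) (Monic.above f-monic m<i)

      Partial : ℕ → Set
      Partial j = ∃[ h ] h * ∏ j (Φ∣ n) ≈ X × ∃[ m ] Monic (∏ j (Φ∣ n)) m

      -- Φ j divides q^j - 1 and therefore X. It is comaximal to the product so far, so together
      -- they divide X up to an integer, which is removed because the enlarged product is monic.
      extend : ∀ {j} → j < n → 0 < j → j ∣ n → Partial j → ∃[ h ] h * (∏ j (Φ∣ n) * Φ j) ≈ X × ∃[ m ] Monic (∏ j (Φ∣ n) * Φ j) m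
      extend {j} j<n 0<j j∣n (h , hD≈X , m , D-monic) =
        let z , pow≈ = pow-∣ {j} {n} j∣n
            c , (k , k≢0 , c≈k) , y , Dy≈cX = lcm-∣ {∏ j (Φ∣ n)} {Φ j} {X} {h} {∏ j (Φ∣ j) * z} (cop-sym cop)
              (trans (*-comm (∏ j (Φ∣ n)) h) hD≈X) (begin
              Φ j * (∏ j (Φ∣ j) * z)  ≈⟨ *-assoc (Φ j) (∏ j (Φ∣ j)) z ⟨
              Φ j * ∏ j (Φ∣ j) * z  ≈⟨ *-congʳ {z} fact ⟩
              (qₚ ^ j - 1ₚ) * z  ≈⟨ *-comm (qₚ ^ j - 1ₚ) z ⟩
              z * (qₚ ^ j - 1ₚ)  ≈⟨ pow≈ ⟨
              X  ∎)
            w , _ , wD≈X = monic-multiple {k} {y} {X} {∏ j (Φ∣ n) * Φ j} D′-monic k≢0 (trans (*-comm y _) (trans Dy≈cX (*-congʳ {X} c≈k)))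
        in w , wD≈X , _ , D′-monic
        where
        fact = Cyc.factorised (IH j<n 0<j)
        D′-monic = monic-* (∏ j (Φ∣ n)) D-monic (Cyc.Φ-monic (IH j<n 0<j))
        cop : Comaximal (Φ j) (∏ j (Φ∣ n))
        cop = cop-∏ j λ {i} i<j → cop-Φ∣ i i<j
          where
          cop-Φ∣ : ∀ i → i < j → Comaximal (Φ j) (Φ∣ n i)
          cop-Φ∣ i i<j with i ∣? n
          ... | no  _   = cop-1
          ... | yes i∣n = cop-Φ (λ 0<g g≤j → Cyc.factorised (IH (ℕ.≤-trans (s≤s g≤j) j<n) 0<g)) 0<j (0∤n i∣n) ℕ.≤-refl (ℕ.<⇒≤ i<j)
            (ℕ.<⇒≢ i<j ∘ ≡.sym)

      partial : ∀ j → j ≤ n → Partial j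
      partial zero    _   = X , *-identityʳ X , 0 , 1ₚ-monic
      partial (suc j) j<n with j ∣? n
      ... | yes j∣n = extend j<n (0∤n j∣n) j∣n (partial j (ℕ.<⇒≤ j<n))
      ... | no  _   = let h , hD≈X , m , D-monic = partial j (ℕ.<⇒≤ j<n) in
        h , trans (*-congˡ {h} (*-identityʳ (∏ j (Φ∣ n)))) hD≈X , m , monic-resp (sym (*-identityʳ (∏ j (Φ∣ n)))) D-monic

      D = ∏ n (Φ∣ n)
      h = proj₁ (partial n ℕ.≤-refl)
      hD≈X : h * D ≈ X
      hD≈X = proj₁ (proj₂ (partial n ℕ.≤-refl))
      D-monic = proj₂ (proj₂ (proj₂ (partial n ℕ.≤-refl)))
      h-monic = monic-quotient h D-monic (pow-monic n′) hD≈X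
      P≈D : productₚ {n} (λ i → Φ∣ n (toℕ i)) ≈ D
      P≈D = product≈∏ n (Φ∣ n)
      Φ≈h : Φ n ≈ h
      Φ≈h = trans (reflexive (Φ-unfold n)) (quotₚ-exact (monic-resp (sym P≈D) D-monic) (trans (*-congˡ {h} P≈D) hD≈X))

-- Rational functions

infix 4 _≃_
record _≃_ (x y : ℚ⟨q⟩) : Set where
  constructor cross
  field cross-eq : num x *ₚ den y ≋ num y *ₚ den x
open _≃_ public

module FractionLaws where
  open RingKit ℤ[q]-commutativeRing
  open Algebra.Properties.AbelianGroup +-abelianGroup using () renaming (x∙y⁻¹≈ε⇒x≈y to x-y≈0⇒x≈y)

  *-cancelʳ-nonzero : ∀ {f g h} → h ≉ₚ 0ₚ → f * h ≈ g * h → f ≈ g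
  *-cancelʳ-nonzero {f} {g} {h} h≉0 eq = x-y≈0⇒x≈y f g (zero-product (*-zero-product (f - g) h (at difference)))
    where
    difference : (f - g) * h ≈ 0#
    difference = begin
      (f - g) * h  ≈⟨ solve 3 (λ f g h → (f :- g) :* h := f :* h :- g :* h) refl f g h ⟩
      f * h - g * h  ≈⟨ +-congʳ eq ⟩
      g * h - g * h  ≈⟨ -‿inverseʳ (g * h) ⟩
      0#  ∎
    zero-product : _ → f - g ≈ 0#
    zero-product (inj₁ f-g≈0) = ⟪ f-g≈0 ⟫
    zero-product (inj₂ h≈0)   = ⊥-elim (h≉0 h≈0)

  ≃-refl : ∀ {x} → x ≃ x
  ≃-refl = cross refl

  ≃-sym : ∀ {x y} → x ≃ y → y ≃ x
  ≃-sym (cross eq) = cross (sym eq)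

  ≃-trans : ∀ {x y z} → x ≃ y → y ≃ z → x ≃ z
  ≃-trans {x} {y} {z} (cross x≃y) (cross y≃z) = cross (*-cancelʳ-nonzero (den≉0 y) (begin
    num x * den z * den y  ≈⟨ solve 3 (λ a b c → a :* b :* c := a :* c :* b) refl (num x) (den z) (den y) ⟩
    num x * den y * den z  ≈⟨ *-congʳ {den z} x≃y ⟩
    num y * den x * den z  ≈⟨ solve 3 (λ a b c → a :* b :* c := a :* c :* b) refl (num y) (den x) (den z) ⟩
    num y * den z * den x  ≈⟨ *-congʳ {den x} y≃z ⟩
    num z * den y * den x  ≈⟨ solve 3 (λ a b c → a :* b :* c := a :* c :* b) refl (num z) (den y) (den x) ⟩
    num z * den x * den y  ∎))

  +-cong′ : ∀ {x x′ y y′} → x ≃ x′ → y ≃ y′ → x D.+ y ≃ x′ D.+ y′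
  +-cong′ {x} {x′} {y} {y′} (cross p) (cross r) = cross (begin
    (num x * den y + num y * den x) * (den x′ * den y′)
      ≈⟨ solve 6 (λ a b c d b′ d′ → (a :* d :+ c :* b) :* (b′ :* d′) := (a :* b′) :* (d :* d′) :+ (c :* d′) :* (b :* b′)) refl (num x)
        (den x) (num y) (den y) (den x′) (den y′) ⟩
    num x * den x′ * (den y * den y′) + num y * den y′ * (den x * den x′)
      ≈⟨ +-cong (*-congʳ {den y * den y′} p) (*-congʳ {den x * den x′} r) ⟩
    num x′ * den x * (den y * den y′) + num y′ * den y * (den x * den x′)
      ≈⟨ solve 6 (λ a b c d b′ d′ → (a :* b′) :* (d′ :* d) :+ (c :* d′) :* (b′ :* b) := (a :* d :+ c :* b) :* (b′ :* d′)) refl (num x′)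
        (den x′) (num y′) (den y′) (den x) (den y) ⟩
    (num x′ * den y′ + num y′ * den x′) * (den x * den y) ∎)

  *-cong′ : ∀ {x x′ y y′} → x ≃ x′ → y ≃ y′ → x D.* y ≃ x′ D.* y′
  *-cong′ {x} {x′} {y} {y′} (cross p) (cross r) = cross (begin
    num x * num y * (den x′ * den y′)  ≈⟨ solve 4 (λ a b c d → a :* b :* (c :* d) := (a :* c) :* (b :* d)) refl (num x) (num y) (den x′)
      (den y′) ⟩
    num x * den x′ * (num y * den y′)  ≈⟨ *-cong p r ⟩
    num x′ * den x * (num y′ * den y)  ≈⟨ solve 4 (λ a b c d → (a :* c) :* (b :* d) := a :* b :* (c :* d)) refl (num x′) (num y′)
      (den x) (den y) ⟩
    num x′ * num y′ * (den x * den y)  ∎)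

  -‿cong′ : ∀ {x y} → x ≃ y → D.- x ≃ D.- y
  -‿cong′ {x} {y} (cross p) = cross (begin
    - num x * den y  ≈⟨ solve 2 (λ a b → (:- a) :* b := :- (a :* b)) refl (num x) (den y) ⟩
    - (num x * den y)  ≈⟨ -‿cong p ⟩
    - (num y * den x)  ≈⟨ solve 2 (λ a b → :- (a :* b) := (:- a) :* b) refl (num y) (den x) ⟩
    - num y * den x  ∎)

  +-assoc′ : ∀ x y z → (x D.+ y) D.+ z ≃ x D.+ (y D.+ z)
  +-assoc′ x y z = cross (solve 6 (λ a b c d e f →
    ((a :* d :+ c :* b) :* f :+ e :* (b :* d)) :* (b :* (d :* f)) := (a :* (d :* f) :+ (c :* f :+ e :* d) :* b) :* (b :* d :* f))
    refl (num x) (den x) (num y) (den y) (num z) (den z))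

  *-assoc′ : ∀ x y z → (x D.* y) D.* z ≃ x D.* (y D.* z)
  *-assoc′ x y z = cross (solve 6 (λ a b c d e f →
    (a :* c :* e) :* (b :* (d :* f)) := (a :* (c :* e)) :* (b :* d :* f))
    refl (num x) (den x) (num y) (den y) (num z) (den z))

  +-comm′ : ∀ x y → x D.+ y ≃ y D.+ x
  +-comm′ x y = cross (solve 4 (λ a b c d → (a :* d :+ c :* b) :* (d :* b) := (c :* b :+ a :* d) :* (b :* d))
    refl (num x) (den x) (num y) (den y))

  *-comm′ : ∀ x y → x D.* y ≃ y D.* x
  *-comm′ x y = cross (solve 4 (λ a b c d → (a :* c) :* (d :* b) := (c :* a) :* (b :* d))
    refl (num x) (den x) (num y) (den y))

  +-identityˡ′ : ∀ x → D.0# D.+ x ≃ x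
  +-identityˡ′ x = cross (solve 2 (λ a b → (con (+ 0) :* b :+ a :* one) :* b := a :* (one :* b)) refl (num x) (den x))

  *-identityˡ′ : ∀ x → D.1# D.* x ≃ x
  *-identityˡ′ x = cross (solve 2 (λ a b → (one :* a) :* b := a :* (one :* b)) refl (num x) (den x))

  -‿inverseˡ′ : ∀ x → (D.- x) D.+ x ≃ D.0#
  -‿inverseˡ′ x = cross (solve 2 (λ a b → ((:- a) :* b :+ a :* b) :* one := con (+ 0) :* (b :* b)) refl (num x) (den x))

  distribˡ′ : ∀ x y z → x D.* (y D.+ z) ≃ x D.* y D.+ x D.* z
  distribˡ′ x y z = cross (solve 6 (λ a b c d e f →
    (a :* (c :* f :+ e :* d)) :* ((b :* d) :* (b :* f)) := (a :* c :* (b :* f) :+ a :* e :* (b :* d)) :* (b :* (d :* f)))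
    refl (num x) (den x) (num y) (den y) (num z) (den z))

ℚ⟨q⟩-commutativeRing : CommutativeRing 0ℓ 0ℓ
ℚ⟨q⟩-commutativeRing = record
  { Carrier = ℚ⟨q⟩
  ; _≈_     = _≃_
  ; _+_     = D._+_
  ; _*_     = D._*_
  ; -_      = D.-_
  ; 0#      = D.0#
  ; 1#      = D.1#
  ; isCommutativeRing = record
    { isRing = record
      { +-isAbelianGroup = record
        { isGroup = record
          { isMonoid = record
            { isSemigroup = record
              { isMagma = record
                { isEquivalence = record { refl = ≃-refl ; sym = ≃-sym ; trans = ≃-trans }
                ; ∙-cong = +-cong′ }
              ; assoc = +-assoc′ }
            ; identity = +-identityˡ′ , (λ x → ≃-trans (+-comm′ x D.0#) (+-identityˡ′ x)) }
          ; inverse = -‿inverseˡ′ , (λ x → ≃-trans (+-comm′ x (D.- x)) (-‿inverseˡ′ x))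
          ; ⁻¹-cong = -‿cong′ }
        ; comm = +-comm′ }
      ; *-cong = *-cong′
      ; *-assoc = *-assoc′
      ; *-identity = *-identityˡ′ , (λ x → ≃-trans (*-comm′ x D.1#) (*-identityˡ′ x))
      ; distrib = distribˡ′ , (λ x y z → ≃-trans (*-comm′ (y D.+ z) x) (≃-trans (distribˡ′ x y z) (+-cong′ (*-comm′ x y) (*-comm′ x z))))
      }
    ; *-comm = *-comm′
    }
  }
  where open FractionLaws

module Fractions where
  open RingKit ℤ[q]-commutativeRing

  ι-cong : ∀ {f g} → f ≈ g → ι f ≃ ι g
  ι-cong f≈g = cross (*-congʳ {1ₚ} f≈g)

  ι-injective : ∀ {f g} → ι f ≃ ι g → f ≈ g
  ι-injective {f} {g} (cross eq) = trans (sym (*-identityʳ f)) (trans eq (*-identityʳ g))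

  ι-+ : ∀ f g → ι (f + g) ≃ ι f D.+ ι g
  ι-+ f g = cross (solve 2 (λ f g → (f :+ g) :* (one :* one) := (f :* one :+ g :* one) :* one) refl f g)

  ι-* : ∀ f g → ι (f * g) ≃ ι f D.* ι g
  ι-* f g = cross (solve 2 (λ f g → (f :* g) :* (one :* one) := (f :* g) :* one) refl f g)

  ⁻¹-inverseʳ : ∀ x → ¬ (x ≃ D.0#) → x D.* x D.⁻¹ ≃ D.1#
  ⁻¹-inverseʳ x x≄0 with zero? (num x)
  ... | no  _   = cross (solve 2 (λ a b → (a :* b) :* one := one :* (b :* a)) refl (num x) (den x))
  ... | yes x≈0 = ⊥-elim (x≄0 (cross (trans (*-identityʳ (num x)) ⟪ x≈0 ⟫)))

  fraction : ∀ {x f g} (g≉0 : g ≉ₚ 0ₚ) → ι g D.* x ≃ ι f → x ≃ D.mk f g g≉0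
  fraction {x} {f} {g} g≉0 (cross eq) = cross (trans
    (solve 2 (λ n g → n :* g := (g :* n) :* one) refl (num x) g)
    (trans eq (solve 2 (λ f d → f :* (one :* d) := f :* d) refl f (den x))))

module RationalFunctions where
  open RingKit ℚ⟨q⟩-commutativeRing
  open Fractions
  private
    module R = RingKit ℤ[q]-commutativeRing

  embedding : Embedding ℤ[q]-commutativeRing ℚ⟨q⟩-commutativeRing
  embedding = record
    { ι      = ι
    ; ι-cong = ι-cong
    ; ι-+    = ι-+
    ; ι-*    = ι-*
    ; ι-neg  = λ _ → refl
    ; ι-0#   = refl
    ; ι-1#   = refl
    }

  ι-^ : ∀ f n → ι (f R.^ n) ≈ ι f ^ n
  ι-^ f zero    = refl
  ι-^ f (suc n) = trans (ι-* f (f R.^ n)) (*-congˡ {ι f} (ι-^ f n))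

  H≈ : ∀ m → 1# - D.q ^ m ≈ - ι (qₚ R.^ m R.- 1ₚ)
  H≈ m = begin
    1# - D.q ^ m  ≈⟨ solve 2 (λ x y → x :- y := :- (y :- x)) refl 1# (D.q ^ m) ⟩
    - (D.q ^ m - 1#)  ≈⟨ -‿cong {ι (qₚ R.^ m R.- 1ₚ)} {D.q ^ m - 1#} (trans (ι-+ (qₚ R.^ m) (R.- 1ₚ)) (+-congʳ {ι (R.- 1ₚ)} (ι-^ qₚ m))) ⟨
    - ι (qₚ R.^ m R.- 1ₚ)  ∎

  1≢0 : ¬ (1ℤ ≡ 0ℤ)
  1≢0 ()

  H≉0 : ∀ m → ¬ (1# - D.q ^ suc m ≈ 0#)
  H≉0 m H≈0 = 1≢0 (≡.trans (≡.sym (Monic.leading (CyclotomicPolynomials.pow-monic m))) (at pow≈0 (suc m)))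
    where
    open import Algebra.Properties.Ring ring using (-‿involutive; -0#≈0#)
    pow≈0 : qₚ R.^ suc m R.- 1ₚ R.≈ 0ₚ
    pow≈0 = ι-injective (trans (sym (-‿involutive (ι (qₚ R.^ suc m R.- 1ₚ)))) (trans (-‿cong (trans (sym (H≈ (suc m))) H≈0)) -0#≈0#))

  q≉0 : ¬ (D.q ≈ 0#)
  q≉0 q≈0 = 1≢0 (at (ι-injective {qₚ} {0ₚ} q≈0) 1)

  base : QBase ℚ⟨q⟩-commutativeRing
  base = record
    { q         = D.q
    ; q⁻¹       = D.q D.⁻¹
    ; q-inverse = ⁻¹-inverseʳ D.q q≉0
    ; H⁻¹       = λ m → (1# - D.q ^ m) D.⁻¹
    ; H-inverse = λ m → ⁻¹-inverseʳ (1# - D.q ^ suc m) (H≉0 m)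
    }

  -- The totalised inverse is a true inverse here, because x y = 1 excludes x = 0.
  inv-unique : ∀ {x y} → x * y ≈ 1# → x D.⁻¹ ≈ y
  inv-unique {x} {y} xy≈1 = begin
    x D.⁻¹  ≈⟨ *-identityʳ (x D.⁻¹) ⟨
    x D.⁻¹ * 1#  ≈⟨ *-congˡ {x D.⁻¹} xy≈1 ⟨
    x D.⁻¹ * (x * y)  ≈⟨ *-assoc (x D.⁻¹) x y ⟨
    x D.⁻¹ * x * y  ≈⟨ *-congʳ {y} (trans (*-comm (x D.⁻¹) x) (⁻¹-inverseʳ x x≉0)) ⟩
    1# * y  ≈⟨ *-identityˡ y ⟩
    y  ∎
    where
    x≉0 : ¬ (x ≈ 0#)
    x≉0 x≈0 = 1≢0 (at (ι-injective {1ₚ} {0ₚ} (trans (sym xy≈1) (trans (*-congʳ {y} x≈0) (zeroˡ y)))) 0)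

module CyclotomicPlaces where
  open RationalFunctions
  open CyclotomicPolynomials
  open Fractions
  open RingKit ℚ⟨q⟩-commutativeRing

  2≉0 : ¬ (1# + 1# ≈ 0#)
  2≉0 2≈0 = 2≢0 (at (ι-injective {1ₚ D.+ₚ 1ₚ} {0ₚ} (trans (ι-+ 1ₚ 1ₚ) 2≈0)) 0)
    where
    2≢0 : ¬ (+ 2 ≡ 0ℤ)
    2≢0 ()

  generic : Generic integers embedding base
  generic = record
    { q̂       = qₚ
    ; ι-q̂     = refl
    ; Const-2 = + 2 , (λ ()) , CommutativeRing.refl ℤ[q]-commutativeRing
    ; ½       = (1# + 1#) D.⁻¹
    ; ½-half  = ⁻¹-inverseʳ (1# + 1#) 2≉0
    }

  open CyclotomicPlace generic public

  factorised : ∀ {n} → 0 < n → Factorised n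
  factorised {n} 0<n = Cyc.factorised (cyc n 0<n)

-- The congruences in ℚ(q)

module SumAndValue where
  open RationalFunctions
  open RingKit ℚ⟨q⟩-commutativeRing
  open QBase base using (H; H⁻¹; q⁻¹)
  open QSeries base
  open Quotients base D._⁻¹ inv-unique

  ^≡^ : ∀ x m → x D.^ m ≡ x ^ m
  ^≡^ x zero    = ≡.refl
  ^≡^ x (suc m) = ≡.cong (x *_) (^≡^ x m)

  factorial≈ : ∀ a p k → (D.⟨ a ⨾ p ⟩ k) ≈ ∏ k (λ i → 1# - a * p ^ i)
  factorial≈ a p k = trans (reflexive (sum-cong-≗ {k} {λ i → 1# - a * p D.^ toℕ i} {λ i → 1# - a * p ^ toℕ i} λ i → ≡.cong
    (λ z → 1# - a * z) (^≡^ p (toℕ i)))) (product≈∏ k (λ i → 1# - a * p ^ i))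
    where open Algebra.Properties.Monoid.Sum *-monoid using (sum-cong-≗)

  bracket≈H : ∀ m → 1# - D.q D.^ m ≈ H m
  bracket≈H m = reflexive (≡.cong (λ z → 1# - z) (^≡^ D.q m))

  summand≈c : ∀ k →
    D.[ + (8 ℕ.* k ℕ.+ 1) ] D.* ((D.⟨ D.q ⨾ D.q D.^ 4 ⟩ k) D.^ 4 D./ (D.⟨ D.q D.^ 4 ⨾ D.q D.^ 4 ⟩ k) D.^ 4) D.* D.q D.^ (2 ℕ.* k)
      ≈ H⁻¹ 1 * c k
  summand≈c k = summand≈ k
    {1# - D.q D.^ (8 ℕ.* k ℕ.+ 1)} {D.⟨ D.q ⨾ D.q D.^ 4 ⟩ k} {D.⟨ D.q D.^ 4 ⨾ D.q D.^ 4 ⟩ k} {D.q D.^ (2 ℕ.* k)}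
    (bracket≈H (8 ℕ.* k ℕ.+ 1))
    (trans (factorial≈ D.q (D.q D.^ 4) k) (shifted-factorial≈ 1 k {D.q} (sym (*-identityʳ D.q))))
    (trans (factorial≈ (D.q D.^ 4) (D.q D.^ 4) k) (shifted-factorial≈ 4 k {D.q D.^ 4} refl))
    (reflexive (^≡^ D.q (2 ℕ.* k)))

  q^ᶻ-negative : ∀ N → D.q D.^ᶻ (ℤ.- + N) ≈ q⁻¹ ^ N
  q^ᶻ-negative zero    = refl
  q^ᶻ-negative (suc N) = reflexive (^≡^ q⁻¹ (suc N))

  value≈S : ∀ {n M e} N → n ≡ 4 ℕ.* N ℕ.+ 1 → M ≡ N → e ≡ ℤ.- + N →
    (D.⟨ D.q D.^ 2 ⨾ D.q D.^ 4 ⟩ M) D./ (D.⟨ D.q D.^ 4 ⨾ D.q D.^ 4 ⟩ M) D.* D.[ + n ] D.* D.q D.^ᶻ e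
      ≈ H⁻¹ 1 * Deformed.S N N
  value≈S N ≡.refl ≡.refl ≡.refl = Closed.value≈ N
    {1# - D.q D.^ (4 ℕ.* N ℕ.+ 1)} {D.⟨ D.q D.^ 2 ⨾ D.q D.^ 4 ⟩ N} {D.⟨ D.q D.^ 4 ⨾ D.q D.^ 4 ⟩ N} {D.q D.^ᶻ (ℤ.- + N)}
    (bracket≈H (4 ℕ.* N ℕ.+ 1))
    (trans (factorial≈ (D.q D.^ 2) (D.q D.^ 4) N) (shifted-factorial≈ 2 N {D.q D.^ 2} refl))
    (trans (factorial≈ (D.q D.^ 4) (D.q D.^ 4) N) (shifted-factorial≈ 4 N {D.q D.^ 4} refl))
    (q^ᶻ-negative N)

module Congruences where
  private module Mg = Algebra.Definitions.RawMagma (RawSemiring.*-rawMagma D.ℤ[q]-rawSemiring)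
  open RationalFunctions
  open CyclotomicPlaces
  open Fractions
  open PolyDivisibility using (monic⇒regular; cst-cancel; cst-*-cst)
  open Division using (Below; small-multiple; monic-*)
  open CyclotomicPolynomials using (qₚ^-monic; Comaximal; comaximal)
  open Localisation integers embedding using (Divides; divides)
  private
    module K = RingKit ℚ⟨q⟩-commutativeRing
    module R = RingKit ℤ[q]-commutativeRing

  -- A common divisor g divides the Bézout constant, w g = z. Writing P = b g gives w P = z b, and
  -- since P is monic z divides w; hence g is a unit of ℤ[q] itself.
  coprime : ∀ {P D k} → Monic P k → Comaximal P D → Coprimeₚ D P
  coprime {P} {D} P-monic (comaximal {u} {v} {c} (z , z≢0 , c≈z) bézout) {g} (a Mg., ag≈D) (b Mg., bg≈P) =
      h Mg., at (cst-cancel {z} {h R.* g} {1ₚ} z≢0 (R.begin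
        cst z R.* (h R.* g)  R.≈⟨ R.*-assoc (cst z) h g ⟨
        cst z R.* h R.* g  R.≈⟨ R.*-congʳ {g} (proj₂ quotient) ⟨
        w R.* g  R.≈⟨ wg≈z ⟩
        cst z  R.≈⟨ R.*-identityʳ (cst z) ⟨
        cst z R.* 1ₚ  R.∎))
    where
    w = u R.* b R.+ v R.* a
    wg≈z : w R.* g R.≈ cst z
    wg≈z = R.begin
      w R.* g  R.≈⟨ R.solve 5 (λ u b v a g → (u R.:* b R.:+ v R.:* a) R.:* g R.:= u R.:* (b R.:* g) R.:+ v R.:* (a R.:* g)) R.refl u b v
        a g ⟩
      u R.* (b R.* g) R.+ v R.* (a R.* g)  R.≈⟨ R.+-cong (R.*-congˡ {u} {b R.* g} {P} ⟪ bg≈P ⟫) (R.*-congˡ {v} {a R.* g} {D} ⟪ ag≈D ⟫) ⟩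
      u R.* P R.+ v R.* D  R.≈⟨ bézout ⟩
      c  R.≈⟨ c≈z ⟩
      cst z  R.∎
    quotient : ∃[ h ] w R.≈ cst z R.* h
    quotient = monic⇒regular P-monic {z} {w} {b} z≢0 (R.begin
      w R.* P  R.≈⟨ R.*-congˡ {w} {P} {b R.* g} ⟪ (λ i → ≡.sym (bg≈P i)) ⟫ ⟩
      w R.* (b R.* g)  R.≈⟨ R.solve 3 (λ w b g → w R.:* (b R.:* g) R.:= (w R.:* g) R.:* b) R.refl w b g ⟩
      w R.* g R.* b  R.≈⟨ R.*-congʳ {b} wg≈z ⟩
      cst z R.* b  R.∎)
    h = proj₁ quotient

  -- With D = 0 the monic P of positive degree would divide a nonzero integer.
  comaximal⇒nonzero : ∀ {P D k} → Monic P (suc k) → Comaximal P D → D ≉ₚ 0ₚ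
  comaximal⇒nonzero {P} {D} {k} P-monic (comaximal {u} {v} {c} (z , z≢0 , c≈z) bézout) D≈0 = z≢0 (≡.trans (≡.sym (at uP≈z 0)) (at uP≈0 0))
    where
    uP≈z : u R.* P R.≈ cst z
    uP≈z = R.begin
      u R.* P  R.≈⟨ R.+-identityʳ (u R.* P) ⟨
      u R.* P R.+ 0ₚ  R.≈⟨ R.+-congˡ {u R.* P} (R.trans (R.*-congˡ {v} {D} {0ₚ} ⟪ D≈0 ⟫) (R.zeroʳ v)) ⟨
      u R.* P R.+ v R.* D  R.≈⟨ bézout ⟩
      c  R.≈⟨ c≈z ⟩
      cst z  R.∎
    uP≈0 : u R.* P R.≈ 0ₚ
    uP≈0 = R.trans (R.*-congʳ {P} {u} {0ₚ} (small-multiple u P-monic λ { {suc i} _ → at uP≈z (suc i) })) (R.zeroˡ P)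

  divides⇒≅ : ∀ A B M {P x k} → Monic P (suc k) → Divides P x → M K.≈ ι P → A D.- B K.≈ x → A D.≅ B [mod M ]
  divides⇒≅ A B M {P} P-monic (divides {D} {Q} cop eq) M≈P A-B≈x =
    P , at (cross-eq M≈P) , P R.* Q , D , D≉0 ,
    at (cross-eq (K.trans A-B≈x (fraction D≉0 (K.trans eq (K.sym (ι-* P Q)))))) ,
    coprime P-monic cop , (Q Mg., at (R.*-comm Q P))
    where
    D≉0 : D ≉ₚ 0ₚ
    D≉0 = comaximal⇒nonzero P-monic cop

  zero⇒≅ : ∀ A B M {P} → M K.≈ ι P → A D.- B K.≈ K.0# → A D.≅ B [mod M ]
  zero⇒≅ A B M {P} M≈P A-B≈0 =
    P , at (cross-eq M≈P) , 0ₚ , 1ₚ , D.1-nonzero , at (cross-eq A-B≈0) , (λ z∣1 _ → z∣1) , (0ₚ Mg., λ _ → ≡.refl)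

  q-integer-monic : ∀ k → Monic (R.∑ (suc k) (qₚ R.^_)) k
  q-integer-monic k = monic
    (≡.trans (Defs.coeff-+ (R.∑ k (qₚ R.^_)) (qₚ R.^ k) k) (≡.cong₂ ℤ._+_ (below k ℕ.≤-refl) (Monic.leading (qₚ^-monic k))))
    λ {i} k<i → ≡.trans (Defs.coeff-+ (R.∑ k (qₚ R.^_)) (qₚ R.^ k) i) (≡.cong₂ ℤ._+_ (below k (ℕ.<⇒≤ k<i)) (Monic.above (qₚ^-monic k) k<i))
    where
    below : ∀ k → Below (R.∑ k (qₚ R.^_)) k
    below zero    _ = ≡.refl
    below (suc k) {i} k<i = ≡.trans (Defs.coeff-+ (R.∑ k (qₚ R.^_)) (qₚ R.^ k) i)
      (≡.cong₂ ℤ._+_ (below k (ℕ.<⇒≤ k<i)) (Monic.above (qₚ^-monic k) k<i))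

  modulus≈ : ∀ n F → D.[ + n ] D.* ι F D.^ 2 K.≈ ι (R.∑ n (qₚ R.^_) R.* (F R.* F))
  modulus≈ n F = K.trans (K.*-cong
      (K.trans (K.*-cong (SumAndValue.bracket≈H n) (Quotients.inv-H1 base D._⁻¹ inv-unique)) (bracket n))
      (K.trans (K.*-congˡ {ι F} (K.*-identityʳ (ι F))) (K.sym (ι-* F F))))
    (K.sym (ι-* (R.∑ n (qₚ R.^_)) (F R.* F)))

module Theorem where
  open RationalFunctions
  open CyclotomicPlaces
  open Congruences
  open Division using (monic-*)
  open CyclotomicPolynomials using (Cyc; cyc; pow-monic)
  open PolyDivisibility using (monic-cancel)
  open RangeSum ℚ⟨q⟩-commutativeRing using (∑; sum≈∑)
  private
    module K = RingKit ℚ⟨q⟩-commutativeRing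
    module R = RingKit ℤ[q]-commutativeRing

  module _ (N : ℕ) (summand : ℕ → ℚ⟨q⟩) (value : ℚ⟨q⟩)
    (summand≈c : ∀ k → summand k K.≈ QBase.H⁻¹ base 1 K.* QSeries.c base k)
    (value≈S : value K.≈ QBase.H⁻¹ base 1 K.* QSeries.Deformed.S base N N) where
    n : ℕ
    n = 4 ℕ.* N ℕ.+ 1

    modulus : ℚ⟨q⟩
    modulus = D.[ + n ] D.* ι (Φ n) D.^ 2

    Holds : ℕ → Set
    Holds k = D.∑≤ k summand D.≅ value [mod modulus ]

    sum≈ : ∀ k {x} → ∑ (suc k) summand K.- value K.≈ x → D.∑≤ k summand D.- value K.≈ x
    sum≈ k = K.trans (K.+-congʳ {K.- value} (sum≈∑ (suc k) summand))

    trivial : N ≡ 0 → Holds N × Holds (4 ℕ.* N)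
    trivial N≡0 = proof , ≡.subst Holds (≡.trans N≡0 (≡.sym (≡.cong (4 ℕ.*_) N≡0))) proof
      where
      proof : Holds N
      proof = zero⇒≅ (D.∑≤ N summand) value modulus (modulus≈ n (Φ n))
        (sum≈ N (Quotients.Error.error-trivial base D._⁻¹ inv-unique N summand value summand≈c value≈S N≡0))

    nontrivial : 0 < N → Holds N × Holds (4 ℕ.* N)
    nontrivial 0<N =
        divides⇒≅ (D.∑≤ N summand) value modulus P-monic P∣truncated (modulus≈ n (Φ n)) (sum≈ N K.refl)
      , divides⇒≅ (D.∑≤ (4 ℕ.* N) summand) value modulus P-monic
        (≡.subst (λ k → Divides P (∑ k summand K.- value)) (ℕ.+-comm (4 ℕ.* N) 1) P∣full) (modulus≈ n (Φ n)) (sum≈ (4 ℕ.* N) K.refl)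
      where
      open Localisation integers embedding using (Divides)
      module M = CyclotomicModulus.Assembly generic (λ n → monic-cancel (pow-monic n)) Φ
      P : ℤ[q]
      P = M.P factorised N 0<N
      P∣truncated : Divides P (∑ (suc N) summand K.- value)
      P∣truncated = M.P∣truncated factorised N 0<N D._⁻¹ inv-unique summand value summand≈c value≈S
      P∣full : Divides P (∑ n summand K.- value)
      P∣full = M.P∣full factorised N 0<N D._⁻¹ inv-unique summand value summand≈c value≈S
      Φ-cyc : Cyc n
      Φ-cyc = cyc n (ℕ.m≤n+m 1 (4 ℕ.* N))
      δ : ℕ
      δ = 4 ℕ.* N ℕ.+ (Cyc.Φ-degree Φ-cyc ℕ.+ Cyc.Φ-degree Φ-cyc)
      0<δ : 0 < δ
      0<δ = ℕ.≤-trans 0<N (ℕ.≤-trans (ℕ.m≤m+n N (3 ℕ.* N)) (ℕ.m≤m+n (4 ℕ.* N) _))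
      -- The degree is presented as a successor because positive degree is what makes denominators
      -- comaximal to P nonzero.
      P-monic : Monic P (suc (ℕ.pred δ))
      P-monic = ≡.subst (Monic P) (≡.sym (ℕ.suc-pred δ {{ℕ.>-nonZero 0<δ}}))
        (monic-* (∑ᴿ n) (≡.subst (λ k → Monic (∑ᴿ k) (4 ℕ.* N)) (ℕ.+-comm 1 (4 ℕ.* N)) (q-integer-monic (4 ℕ.* N)))
          (monic-* (Φ n) (Cyc.Φ-monic Φ-cyc) (Cyc.Φ-monic Φ-cyc)))
        where
        ∑ᴿ : ℕ → ℤ[q]
        ∑ᴿ k = RangeSum.∑ ℤ[q]-commutativeRing k (Algebra.Definitions.RawSemiring._^_ (Semiring.rawSemiring R.semiring) qₚ)

    congruences₄ : Holds N × Holds (4 ℕ.* N)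
    congruences₄ = [ nontrivial , (λ 0≡N → trivial (≡.sym 0≡N)) ]′ (ℕ.m≤n⇒m<n∨m≡n {0} {N} z≤n)

  congruences : ∀ {n M k} N summand value → n ≡ 4 ℕ.* N ℕ.+ 1 → M ≡ N → k ≡ 4 ℕ.* N →
    (∀ k → summand k K.≈ QBase.H⁻¹ base 1 K.* QSeries.c base k) → value K.≈ QBase.H⁻¹ base 1 K.* QSeries.Deformed.S base N N →
    (D.∑≤ M summand D.≅ value [mod D.[ + n ] D.* ι (Φ n) D.^ 2 ]) × (D.∑≤ k summand D.≅ value [mod D.[ + n ] D.* ι (Φ n) D.^ 2 ])
  congruences N summand value ≡.refl ≡.refl ≡.refl = congruences₄ N summand value

  -- Integer division rounds down, so on negative numbers it commutes with negation only when the
  -- remainder is 0.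
  -[1+]/ℕ4 : ∀ k → suc k % 4 ≡ 0 → -[1+ k ] ℤ./ℕ 4 ≡ ℤ.- + (suc k ℕ./ 4)
  -[1+]/ℕ4 k eq with suc k % 4 | eq
  ... | .0 | ≡.refl = ≡.refl

  exponent : ∀ N → (1ℤ ℤ.- + (4 ℕ.* N ℕ.+ 1)) ℤ./ℕ 4 ≡ ℤ.- + N
  exponent N = ≡.trans (≡.cong (ℤ._/ℕ 4) difference) (negative N)
    where
    difference : 1ℤ ℤ.- + (4 ℕ.* N ℕ.+ 1) ≡ ℤ.- + (4 ℕ.* N)
    difference = ≡.trans (≡.cong (λ k → 1ℤ ℤ.- + k) (ℕ.+-comm (4 ℕ.* N) 1))
      (≡.trans (ℤ.[1+m]⊖[1+n]≡m⊖n 0 (4 ℕ.* N)) (ℤ.⊖-≤ {0} {4 ℕ.* N} z≤n))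
    negative : ∀ N → (ℤ.- + (4 ℕ.* N)) ℤ./ℕ 4 ≡ ℤ.- + N
    negative zero    = ≡.refl
    negative (suc N) = ≡.trans (-[1+]/ℕ4 (N ℕ.+ 3 ℕ.* suc N) (≡.trans (≡.cong (_% 4) (ℕ.*-comm 4 (suc N))) (ℕ.m*n%n≡0 (suc N) 4)))
      (≡.cong (λ k → ℤ.- + k) (≡.trans (≡.cong (ℕ._/ 4) (ℕ.*-comm 4 (suc N))) (ℕ.m*n/n≡m (suc N) 4)))

open import Defs

theorem1 : (n : ℕ) → n % 4 ≡ 1 →
    (∑[ k ≤ (n ∸ 1) ℕ./ 4 ] [ + (8 ℕ.* k ℕ.+ 1) ] * ((⟨ q ⨾ q ^ 4 ⟩ k) ^ 4 / (⟨ q ^ 4 ⨾ q ^ 4 ⟩ k) ^ 4) * q ^ (2 ℕ.* k))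
    ≅ (⟨ q ^ 2 ⨾ q ^ 4 ⟩ ((n ∸ 1) ℕ./ 4)) / (⟨ q ^ 4 ⨾ q ^ 4 ⟩ ((n ∸ 1) ℕ./ 4)) * [ + n ] * q ^ᶻ ((1ℤ ℤ.- + n) ℤ./ℕ 4)
    [mod [ + n ] * ι (Φ n) ^ 2 ]
    ×
    (∑[ k ≤ n ∸ 1 ] [ + (8 ℕ.* k ℕ.+ 1) ] * ((⟨ q ⨾ q ^ 4 ⟩ k) ^ 4 / (⟨ q ^ 4 ⨾ q ^ 4 ⟩ k) ^ 4) * q ^ (2 ℕ.* k))
    ≅ (⟨ q ^ 2 ⨾ q ^ 4 ⟩ ((n ∸ 1) ℕ./ 4)) / (⟨ q ^ 4 ⨾ q ^ 4 ⟩ ((n ∸ 1) ℕ./ 4)) * [ + n ] * q ^ᶻ ((1ℤ ℤ.- + n) ℤ./ℕ 4)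
    [mod [ + n ] * ι (Φ n) ^ 2 ]
theorem1 n n%4≡1 = Theorem.congruences N _ _ n≡ M≡ n∸1≡ SumAndValue.summand≈c
    (SumAndValue.value≈S N n≡ M≡ (≡.trans (≡.cong (λ k → (1ℤ ℤ.- + k) ℤ./ℕ 4) n≡) (Theorem.exponent N)))
  where
  N : ℕ
  N = n ℕ./ 4
  n≡ : n ≡ 4 ℕ.* N ℕ.+ 1
  n≡ = ≡.trans (ℕ.m≡m%n+[m/n]*n n 4) (≡.trans (≡.cong₂ ℕ._+_ n%4≡1 (ℕ.*-comm N 4)) (ℕ.+-comm 1 (4 ℕ.* N)))
  n∸1≡ : n ∸ 1 ≡ 4 ℕ.* N
  n∸1≡ = ≡.trans (≡.cong (_∸ 1) n≡) (ℕ.m+n∸n≡m (4 ℕ.* N) 1)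
  M≡ : (n ∸ 1) ℕ./ 4 ≡ N
  M≡ = ≡.trans (≡.cong (ℕ._/ 4) n∸1≡) (≡.trans (≡.cong (ℕ._/ 4) (ℕ.*-comm 4 N)) (ℕ.m*n/n≡m N 4))
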